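{- Let $p$ be odd and let $p\times p$ denote the partition $(p,p,\dots,p)$ of $p^2$ (a $p\times p$ square). Then $$\mathrm{alt}(p\times p)=\mathrm{ralt}(p\times p)=\frac{E^p(E^2+2^2)^{p-1}(E^2+4^2)^{p-2}\cdots(E^2+(2(p-1))^2)}{H_{p\times p}},$$ where $H_{p\times p}$ is the product of the hook lengths of the $p\times p$ square and the right-hand side is evaluated umbrally.
   Context: For a standard Young tableau $T$ with $n$ entries, its descent set is $D(T)=\{i: i+1\text{ appears in a lower row than } i\}$; $T$ is alternating if $D(T)=\{1,3,5,\dots\}\cap[n-1]$ and reverse alternating if $D(T)=\{2,4,6,\dots\}\cap[n-1]$. $\mathrm{alt}(\lambda)$ and $\mathrm{ralt}(\lambda)$ are the numbers of alternating and reverse alternating SYT of shape $\lambda$. The numerator is $E^p\prod_{i=1}^{p-1}(E^2+(2i)^2)^{p-i}$. Euler numbers $E_n$: $\sum_{n\ge0}E_nx^n/n!=\sec x+\tan x$. Umbral evaluation: expand in powers of the indeterminate $E$, then replace each $E^k$ by $E_k$ as the last step. -}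

module Defs where

open import Data.Bool using (Bool; true; false; _∧_; _∨_; not; if_then_else_)
open import Data.Nat using (ℕ; zero; suc; _+_; _*_; _∸_; _^_; _<ᵇ_; _≡ᵇ_)
open import Data.Nat.ListAction using (sum; product)
open import Data.Nat.Properties using (_!≢0)
open import Data.Integer using (+_)
open import Data.List using (List; []; _∷_; length; map; foldr; upTo; filter; concat; concatMap; zipWith; replicate; lookup; allFin)
import Data.Nat.Base as ℕB
open import Data.Rational using (ℚ; 0ℚ; 1ℚ; _/_) renaming (_+_ to _+ℚ_; _*_ to _*ℚ_; -_ to -ℚ_)
open import Data.Fin using (toℕ)

range1 : ℕ → List ℕ
range1 n = map suc (upTo n)

wordsOf : {A : Set} → ℕ → List A → List (List A)
wordsOf zero    xs = [] ∷ []
wordsOf (suc k) xs = concatMap (λ x → map (x ∷_) (wordsOf k xs)) xs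

choices : {A : Set} → List (List A) → List (List A)
choices []         = [] ∷ []
choices (ys ∷ yss) = concatMap (λ y → map (y ∷_) (choices yss)) ys

allB : {A : Set} → (A → Bool) → List A → Bool
allB f xs = foldr (λ x b → f x ∧ b) true xs

countB : {A : Set} → (A → Bool) → List A → ℕ
countB f xs = length (filter (λ x → Data.Bool.T? (f x)) xs)
  where import Data.Bool

eqList : List ℕ → List ℕ → Bool
eqList []       []       = true
eqList (x ∷ xs) (y ∷ ys) = (x ≡ᵇ y) ∧ eqList xs ys
eqList _        _        = false

nth : ℕ → List ℕ → ℕ
nth _       []       = 0
nth zero    (x ∷ xs) = x
nth (suc i) (x ∷ xs) = nth i xs

nthRow : ℕ → List (List ℕ) → List ℕ
nthRow _       []       = []
nthRow zero    (r ∷ rs) = r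
nthRow (suc i) (r ∷ rs) = nthRow i rs

-- Partitions and Young tableaux (English convention: row 0 is the top
-- row, rows are numbered downwards).  A shape λ is the list of its row
-- lengths λ₀ ≥ λ₁ ≥ ...; a filling of shape λ is a list of rows.

size : List ℕ → ℕ
size λs = sum λs

square : ℕ → List ℕ
square p = replicate p p

fillings : List ℕ → ℕ → List (List (List ℕ))
fillings λs n = choices (map (λ l → wordsOf l (range1 n)) λs)

strictlyIncreasing : List ℕ → Bool
strictlyIncreasing []           = true
strictlyIncreasing (x ∷ [])     = true
strictlyIncreasing (x ∷ y ∷ xs) = (x <ᵇ y) ∧ strictlyIncreasing (y ∷ xs)

-- each entry of the upper row is smaller than the entry directly below it
-- (the lower row is at most as long as the upper one)
colsOK : List ℕ → List ℕ → Bool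
colsOK (x ∷ xs) (y ∷ ys) = (x <ᵇ y) ∧ colsOK xs ys
colsOK _        _        = true

columnsIncreasing : List (List ℕ) → Bool
columnsIncreasing []            = true
columnsIncreasing (r ∷ [])      = true
columnsIncreasing (r ∷ s ∷ rs)  = colsOK r s ∧ columnsIncreasing (s ∷ rs)

occurrences : ℕ → List ℕ → ℕ
occurrences k xs = countB (λ x → x ≡ᵇ k) xs

isSYT : ℕ → List (List ℕ) → Bool
isSYT n T =
  allB (λ k → occurrences k (concat T) ≡ᵇ 1) (range1 n)
  ∧ allB strictlyIncreasing T
  ∧ columnsIncreasing T

SYT : List ℕ → List (List (List ℕ))
SYT λs = filter (λ T → Data.Bool.T? (isSYT (size λs) T)) (fillings λs (size λs))
  where import Data.Bool

rowOf : List (List ℕ) → ℕ → ℕ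
rowOf []       k = 0
rowOf (r ∷ rs) k = if 0 <ᵇ occurrences k r then 0 else suc (rowOf rs k)

descentSet : ℕ → List (List ℕ) → List ℕ
descentSet n T =
  filter (λ i → Data.Bool.T? (rowOf T i <ᵇ rowOf T (suc i))) (range1 (n ∸ 1))
  where import Data.Bool

isOdd isEven : ℕ → Bool
isOdd n = n ℕB.% 2 ≡ᵇ 1
isEven n = n ℕB.% 2 ≡ᵇ 0

oddsUpTo evensUpTo : ℕ → List ℕ
oddsUpTo n  = filter (λ i → Data.Bool.T? (isOdd i))  (range1 (n ∸ 1))
  where import Data.Bool
evensUpTo n = filter (λ i → Data.Bool.T? (isEven i)) (range1 (n ∸ 1))
  where import Data.Bool

alternating : ℕ → List (List ℕ) → Bool
alternating n T = eqList (descentSet n T) (oddsUpTo n)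

reverseAlternating : ℕ → List (List ℕ) → Bool
reverseAlternating n T = eqList (descentSet n T) (evensUpTo n)

alt ralt : List ℕ → ℕ
alt  λs = countB (alternating (size λs)) (SYT λs)
ralt λs = countB (reverseAlternating (size λs)) (SYT λs)

conj : List ℕ → ℕ → ℕ
conj λs j = countB (λ l → j <ᵇ l) λs

hook : List ℕ → ℕ → ℕ → ℕ
hook λs i j = ((nth i λs ∸ j) + (conj λs j ∸ i)) ∸ 1

hookProduct : List ℕ → ℕ
hookProduct λs =
  product (concatMap (λ i → map (λ j → hook λs i j) (upTo (nth i λs)))
                     (upTo (length λs)))

Series : Set
Series = ℕ → ℚ

sumℚ : List ℚ → ℚ
sumℚ = foldr _+ℚ_ 0ℚ

fact : ℕ → ℕ
fact n = n ℕB.!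

invFact : ℕ → ℚ
invFact n = _/_ (+ 1) (fact n) {{n !≢0}}

signℚ : ℕ → ℚ
signℚ zero    = 1ℚ
signℚ (suc k) = -ℚ (signℚ k)

cosS sinS : Series
cosS n = if isEven n then signℚ (n ℕB./ 2) *ℚ invFact n else 0ℚ
sinS n = if isOdd n then signℚ (n ℕB./ 2) *ℚ invFact n else 0ℚ

mulS : Series → Series → Series
mulS f g n = sumℚ (map (λ k → f k *ℚ g (n ∸ k)) (upTo (suc n)))

-- multiplicative inverse of a series a with constant term 1:
-- b₀ = 1, bₙ = - Σ_{k=1}^{n} aₖ b_{n-k}.  invRev a n = [b_{n-1}, ..., b₀].
invRev : Series → ℕ → List ℚ
invRev a zero          = []
invRev a (suc zero)    = 1ℚ ∷ []
invRev a (suc (suc n)) =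
  let rs = invRev a (suc n) in
  -ℚ sumℚ (zipWith _*ℚ_ (map a (range1 (suc n))) rs) ∷ rs

headℚ : List ℚ → ℚ
headℚ []      = 0ℚ
headℚ (x ∷ _) = x

invS : Series → Series
invS a n = headℚ (invRev a (suc n))

secS tanS : Series
secS = invS cosS
tanS = mulS sinS secS

euler : ℕ → ℚ
euler n = (_/_ (+ fact n) 1) *ℚ (secS n +ℚ tanS n)

-- Polynomials in the indeterminate E with ℕ coefficients, as coefficient
-- lists (constant term first), and umbral evaluation Eᵏ ↦ E_k.

Poly : Set
Poly = List ℕ

addP : Poly → Poly → Poly
addP []       ys       = ys
addP xs       []       = xs
addP (x ∷ xs) (y ∷ ys) = (x + y) ∷ addP xs ys

scaleP : ℕ → Poly → Poly
scaleP c = map (c *_)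

mulP : Poly → Poly → Poly
mulP []       ys = []
mulP (x ∷ xs) ys = addP (scaleP x ys) (0 ∷ mulP xs ys)

powP : Poly → ℕ → Poly
powP f zero    = 1 ∷ []
powP f (suc k) = mulP f (powP f k)

prodP : List Poly → Poly
prodP = foldr mulP (1 ∷ [])

varE : Poly
varE = 0 ∷ 1 ∷ []

quadP : ℕ → Poly
quadP c = c ∷ 0 ∷ 1 ∷ []

numerator : ℕ → Poly
numerator p =
  mulP (powP varE p)
       (prodP (map (λ i → powP (quadP ((2 * i) ^ 2)) (p ∸ i)) (range1 (p ∸ 1))))

umbral : Poly → ℚ
umbral cs = sumℚ (zipWith (λ c k → _/_ (+ c) 1 *ℚ euler k) cs (upTo (length cs)))

ℕtoℚ : ℕ → ℚ
ℕtoℚ n = _/_ (+ n) 1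

{-# OPTIONS --safe #-}

-- Removing the boxes n, n−1, …, 1 turns a standard tableau into a word of row indices whose
-- ascents are the descents of the tableau, so ralt(λ) counts lattice words with an alternating
-- pattern.  Splitting such a word before its final increasing run and telescoping gives Foulkes'
-- relation: the signed sum of ralt over the shapes obtained from λ by removing a vertical strip
-- of even size vanishes unless λ is a column, and this relation determines ralt.
--
-- The Jacobi–Trudi determinants F(m) in the Delannoy numbers q m, where
-- Σ qₙ tⁿ = ((1 + t)/(1 − t))ᵐ, satisfy W₋ F(m+1) = W₊ F(m), with W± the (signed) sum over
-- vertical strips; this is row-multilinearity and (1 − t) Q_{m+1} = (1 + t) Q_m.  Hence twice the
-- Abel sum Σₘ (−1)ᵐ F(m) satisfies Foulkes' relation, and equals −ralt of the square.
--
-- For the square, F(m) is a Hankel determinant in the qₙ.  The continued fraction of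
-- ((1 + t)/(1 − t))ᶻ evaluates it as the imaginary part of the numerator at E = 2im over the hook product, and
-- Σₘ (−1)ᵐ (2im)ᵏ = −(i/2) E_k for odd k turns the Abel sum into the umbral evaluation.
-- Transposing the square exchanges alt and ralt.

module Submission where

open import Defs
open import Data.Bool using (Bool; true; false; _∧_; not; if_then_else_; T; T?)
open import Data.Empty using (⊥-elim)
open import Data.Integer using (+_)
open import Data.List using (List; applyUpTo; []; _∷_; _++_; length; map; upTo; filter; concat; concatMap; replicate; zipWith)
open import Data.List.Properties using (map-++; length-map; map-∘; map-upTo; length-replicate; length-++; length-applyUpTo; ∷-injectiveʳ)
open import Data.List.Membership.Propositional using (_∈_)
open import Data.List.Membership.Propositional.Properties using (∈-∃++; ∈-++⁻; ∈-++⁺ˡ; ∈-++⁺ʳ; ∈-map⁺; ∈-map⁻; ∈-filter⁺; ∈-filter⁻; ∈-upTo⁺; ∈-upTo⁻)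
open import Data.List.Relation.Unary.All using (All; []; _∷_; lookup; universal)
open import Data.List.Relation.Unary.AllPairs using ([]; _∷_)
open import Data.List.Relation.Unary.Any using (here; there)
open import Data.List.Relation.Unary.Unique.Propositional using (Unique)
import Data.List.Relation.Unary.All as All
import Data.List.Relation.Unary.All.Properties as Allₚ
import Data.List.Relation.Unary.AllPairs as AP
import Data.List.Relation.Unary.AllPairs.Properties as APₚ
import Data.List.Relation.Unary.Unique.Propositional.Properties as Unq
open import Data.List.Relation.Binary.Pointwise using (Pointwise; []; _∷_)
open import Data.Nat using (ℕ; zero; suc; pred; _+_; _*_; _∸_; _^_; _%_; _≤_; _<_; z≤n; s≤s; _<ᵇ_; _≡ᵇ_)
open import Data.Nat.ListAction using (sum; product)
open import Data.Nat.ListAction.Properties using (product-++)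
open import Data.Nat.Tactic.RingSolver using () renaming (solve-∀ to solve-∀ℕ)
open import Data.Nat.DivMod using (m/n≡1+[m∸n]/n)
open import Data.Product using (_×_; _,_; proj₁; proj₂; Σ; ∃)
open import Data.Rational using (ℚ; 0ℚ; 1ℚ; ½; _/_) renaming (_+_ to _+ℚ_; _*_ to _*ℚ_; -_ to -ℚ_; _-_ to _-ℚ_)
open import Data.Sum using (_⊎_; inj₁; inj₂)
open import Data.Unit using (tt)
open import Function using (_∘_; id; case_of_)
open import Level using (0ℓ)
open import Relation.Binary.PropositionalEquality using (_≡_; _≢_; refl; sym; trans; cong; cong₂; subst; subst₂; module ≡-Reasoning)
open import Relation.Binary.Definitions using (tri<; tri≈; tri>)
open import Relation.Nullary using (¬_; Dec; yes; no; does)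
open import Relation.Nullary.Decidable using (dec⇒maybe)
open import Tactic.RingSolver using (solve-∀)
open import Tactic.RingSolver.Core.AlmostCommutativeRing using (AlmostCommutativeRing; fromCommutativeRing)
import Data.Nat.Properties as ℕₚ
import Data.Integer as ℤ
import Data.Integer.Properties as ℤₚ
import Data.Nat as ℕ
import Data.Rational as ℚ
import Data.Rational.Unnormalised as ℚᵘ
import Data.Rational.Unnormalised.Properties as ℚᵘₚ
import Data.Rational.Properties as ℚₚ

open ≡-Reasoning

-- Since log ((1 + t)/(1 - t))ᵐ = Σ 2m tᵏ/k over odd k, F(m) is the Schur function at the power sums
-- 2m for odd k and 0 for even k. The alternating sum over m is dictated by the step relation: W₋
-- F(m+1) = W₊ F(m) telescopes under alternating signs, and W₋ + W₊ retains just the even strips.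
-- The sum diverges, but each F(m) is a polynomial in m, so a finite Euler transform replaces it and
-- no limit occurs. The obstacle lies at the boundary: removing boxes from distinct rows can leave
-- the set of partitions. If the rows are taken upwards, the only possible failure is an equality aᵢ
-- = aᵢ₊₁ in the encoding λᵢ + p - i, and it persists until the strip is complete. Word counts are
-- cut off there and determinants vanish there, so both obey one relation without side conditions.
-- Oddness of p enters through the odd word length p², through the numerator being odd in E (the
-- Abel sums yield only the tangent numbers), and through the sign of reversing p rows, which agrees
-- with the sign in iᵖ = ± i.

ringℚ : AlmostCommutativeRing 0ℓ 0ℓ
ringℚ = fromCommutativeRing ℚₚ.+-*-commutativeRing (λ x → dec⇒maybe (0ℚ ℚₚ.≟ x))

x*0-0 : ∀ x → x *ℚ 0ℚ -ℚ 0ℚ ≡ 0ℚ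
x*0-0 = solve-∀ ringℚ

0*x-0 : ∀ x → 0ℚ *ℚ x -ℚ 0ℚ ≡ 0ℚ
0*x-0 = solve-∀ ringℚ

0+x*0 : ∀ x → 0ℚ +ℚ x *ℚ 0ℚ ≡ 0ℚ
0+x*0 = solve-∀ ringℚ

0-x*0 : ∀ x → 0ℚ -ℚ x *ℚ 0ℚ ≡ 0ℚ
0-x*0 = solve-∀ ringℚ

Σ< : ℕ → (ℕ → ℚ) → ℚ
Σ< zero    f = 0ℚ
Σ< (suc n) f = Σ< n f +ℚ f n

Σ<-cong : ∀ n {f g} → (∀ i → i < n → f i ≡ g i) → Σ< n f ≡ Σ< n g
Σ<-cong zero    e = refl
Σ<-cong (suc n) e = cong₂ _+ℚ_ (Σ<-cong n (λ i i<n → e i (ℕₚ.m<n⇒m<1+n i<n))) (e n ℕₚ.≤-refl)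

Σ<-zero : ∀ n {f} → (∀ i → i < n → f i ≡ 0ℚ) → Σ< n f ≡ 0ℚ
Σ<-zero zero    e = refl
Σ<-zero (suc n) e = trans (cong₂ _+ℚ_ (Σ<-zero n (λ i i<n → e i (ℕₚ.m<n⇒m<1+n i<n))) (e n ℕₚ.≤-refl)) (ℚₚ.+-identityˡ 0ℚ)

-- Removing vertical strips

Shape : Set
Shape = List ℕ

hd : Shape → ℕ
hd []      = 0
hd (a ∷ _) = a

-- A partition λ with at most p rows is encoded by the strictly decreasing
-- sequence aᵢ = λᵢ + p − i (0 ≤ i < p), so that all aᵢ are positive.
data Valid : Shape → Set where
  []  : Valid []
  _∷_ : ∀ {a as} → hd as < a → Valid as → Valid (a ∷ as)

valid? : ∀ a → Dec (Valid a)
valid? [] = yes []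
valid? (a ∷ as) with hd as ℕₚ.<? a | valid? as
... | yes h | yes v = yes (h ∷ v)
... | no ¬h | _     = no λ { (h ∷ _) → ¬h h }
... | yes _ | no ¬v = no λ { (_ ∷ v) → ¬v v }

rem : ℕ → Shape → Shape
rem _       []       = []
rem zero    (a ∷ as) = pred a ∷ as
rem (suc x) (a ∷ as) = a ∷ rem x as

length-rem : ∀ x a → length (rem x a) ≡ length a
length-rem zero    []       = refl
length-rem (suc x) []       = refl
length-rem zero    (a ∷ as) = refl
length-rem (suc x) (a ∷ as) = cong suc (length-rem x as)

-- Flat x a: some i ≥ x has aᵢ = aᵢ₊₁ (where aₚ = 0).
data Flat : ℕ → Shape → Set where
  here : ∀ {a as} → a ≡ hd as → Flat zero (a ∷ as)
  skip : ∀ {a as} → Flat zero as → Flat zero (a ∷ as)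
  next : ∀ {x a as} → Flat x as → Flat (suc x) (a ∷ as)

flat⇒¬valid : ∀ {x a} → Flat x a → ¬ Valid a
flat⇒¬valid (here e) (h ∷ _) = ℕₚ.<⇒≢ h (sym e)
flat⇒¬valid (skip f) (_ ∷ v) = flat⇒¬valid f v
flat⇒¬valid (next f) (_ ∷ v) = flat⇒¬valid f v

flat-zero : ∀ {x a} → Flat x a → Flat zero a
flat-zero (here e) = here e
flat-zero (skip f) = skip f
flat-zero (next f) = skip (flat-zero f)

flat-pred : ∀ {x a} → Flat (suc x) a → Flat x a
flat-pred {zero}  (next f) = skip f
flat-pred {suc x} (next f) = next (flat-pred f)

flat-rem : ∀ {x a} → Flat (suc x) a → Flat x (rem x a)
flat-rem {zero}  (next f) = skip f
flat-rem {suc x} (next f) = next (flat-rem f)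

hd-rem : ∀ x a → hd (rem x a) ≤ hd a
hd-rem zero    []       = z≤n
hd-rem (suc x) []       = z≤n
hd-rem zero    (a ∷ as) = ℕₚ.pred[n]≤n
hd-rem (suc x) (a ∷ as) = ℕₚ.≤-refl

-- Lowering one entry of a strictly decreasing sequence widens the gap above it and narrows the gap
-- below it by one, so strictness can fail only by an equality with the next entry.
valid-rem : ∀ x {a} → Valid a → Valid (rem x a) ⊎ Flat x (rem x a)
valid-rem zero    [] = inj₁ []
valid-rem (suc x) [] = inj₁ []
valid-rem zero (_∷_ {suc a} {as} (s≤s h) v) with ℕₚ.m≤n⇒m<n∨m≡n h
... | inj₁ lt = inj₁ (lt ∷ v)
... | inj₂ e  = inj₂ (here (sym e))
valid-rem (suc x) (_∷_ {a} {as} h v) with valid-rem x v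
... | inj₁ v′ = inj₁ (ℕₚ.≤-<-trans (hd-rem x as) h ∷ v′)
... | inj₂ f  = inj₂ (next f)

-- Invariant while a strip is removed upwards and only rows with index less than `x` remain to be
-- chosen. An equality at an index at least `x` involves two finished rows and is never repaired.
Good : ℕ → Shape → Set
Good x a = Valid a ⊎ Flat x a

good-pred : ∀ {x a} → Good (suc x) a → Good x a
good-pred (inj₁ v) = inj₁ v
good-pred (inj₂ f) = inj₂ (flat-pred f)

good-rem : ∀ {x a} → Good (suc x) a → Good x (rem x a)
good-rem {x} (inj₁ v) = valid-rem x v
good-rem     (inj₂ f) = inj₂ (flat-rem f)

sum-rem-≤ : ∀ x a → sum (rem x a) ≤ sum a
sum-rem-≤ zero    []       = z≤n
sum-rem-≤ (suc x) []       = z≤n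
sum-rem-≤ zero    (a ∷ as) = ℕₚ.+-monoˡ-≤ (sum as) ℕₚ.pred[n]≤n
sum-rem-≤ (suc x) (a ∷ as) = ℕₚ.+-monoʳ-≤ a (sum-rem-≤ x as)

sum-rem : ∀ {x a} → Valid a → x < length a → suc (sum (rem x a)) ≡ sum a
sum-rem {zero}  (_∷_ {suc a} h v) _        = refl
sum-rem {suc x} (_∷_ {a} {as} h v) (s≤s l) = trans (sym (ℕₚ.+-suc a _)) (cong (_+_ a) (sum-rem v l))

-- Functions of the row removed last and of the remaining shape.
Fn : Set
Fn = ℕ → Shape → ℚ

above : Fn → Fn
above h x a = Σ< x (λ y → h y (rem y a))

-- odds h x a and evens h x a sum h over the ways to remove an odd, respectively
-- a positive even, number of boxes from distinct rows above row x, going upwards.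
odds evens : Fn → Fn
odds h zero    a = 0ℚ
odds h (suc x) a = odds h x a +ℚ (h x (rem x a) +ℚ evens h x (rem x a))
evens h zero    a = 0ℚ
evens h (suc x) a = evens h x a +ℚ odds h x (rem x a)

private
  shuffle : ∀ a b c d → (a +ℚ b) +ℚ (c +ℚ d) ≡ (a +ℚ c) +ℚ (b +ℚ d)
  shuffle = solve-∀ ringℚ

-- Splits off the box removed last, the topmost one. Before it comes an even strip if the total is
-- odd and an odd strip if it is even; as `evens` excludes the empty strip, that case is the
-- separate term `above h x a`.
odds-above  : ∀ h x a → odds h x a ≡ above h x a +ℚ evens (above h) x a
evens-above : ∀ h x a → evens h x a ≡ odds (above h) x a
odds-above h zero    a = refl
odds-above h (suc x) a = trans (cong₂ (λ u v → u +ℚ (h x (rem x a) +ℚ v)) (odds-above h x a) (evens-above h x (rem x a)))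
  (shuffle (above h x a) (evens (above h) x a) (h x (rem x a)) (odds (above h) x (rem x a)))
evens-above h zero    a = refl
evens-above h (suc x) a = cong₂ _+ℚ_ (evens-above h x a) (odds-above h x (rem x a))

AgreeOnGood : Fn → Fn → Set
AgreeOnGood h k = ∀ x a → Good x a → h x a ≡ k x a

odds-cong  : ∀ {h k} → AgreeOnGood h k → AgreeOnGood (odds h) (odds k)
evens-cong : ∀ {h k} → AgreeOnGood h k → AgreeOnGood (evens h) (evens k)
odds-cong e zero    a g = refl
odds-cong e (suc x) a g = cong₂ _+ℚ_ (odds-cong e x a (good-pred g))
  (cong₂ _+ℚ_ (e x (rem x a) (good-rem g)) (evens-cong e x (rem x a) (good-rem g)))
evens-cong e zero    a g = refl
evens-cong e (suc x) a g = cong₂ _+ℚ_ (evens-cong e x a (good-pred g)) (odds-cong e x (rem x a) (good-rem g))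

odds-+  : ∀ h k x a → odds (λ x a → h x a +ℚ k x a) x a ≡ odds h x a +ℚ odds k x a
evens-+ : ∀ h k x a → evens (λ x a → h x a +ℚ k x a) x a ≡ evens h x a +ℚ evens k x a
odds-+ h k zero    a = refl
odds-+ h k (suc x) a = trans (cong₂ (λ u v → u +ℚ ((h x (rem x a) +ℚ k x (rem x a)) +ℚ v)) (odds-+ h k x a) (evens-+ h k x (rem x a)))
  (lemma (odds h x a) (odds k x a) (h x (rem x a)) (k x (rem x a)) (evens h x (rem x a)) (evens k x (rem x a)))
  where
  lemma : ∀ a b c d e f → (a +ℚ b) +ℚ ((c +ℚ d) +ℚ (e +ℚ f)) ≡ (a +ℚ (c +ℚ e)) +ℚ (b +ℚ (d +ℚ f))
  lemma = solve-∀ ringℚ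
evens-+ h k zero    a = refl
evens-+ h k (suc x) a = trans (cong₂ _+ℚ_ (evens-+ h k x a) (odds-+ h k x (rem x a)))
  (shuffle (evens h x a) (evens k x a) (odds h x (rem x a)) (odds k x (rem x a)))

odds-*  : ∀ c h x a → odds (λ x a → c *ℚ h x a) x a ≡ c *ℚ odds h x a
evens-* : ∀ c h x a → evens (λ x a → c *ℚ h x a) x a ≡ c *ℚ evens h x a
odds-* c h zero    a = sym (ℚₚ.*-zeroʳ c)
odds-* c h (suc x) a = trans (cong₂ (λ u v → u +ℚ (c *ℚ h x (rem x a) +ℚ v)) (odds-* c h x a) (evens-* c h x (rem x a)))
  (lemma c (odds h x a) (h x (rem x a)) (evens h x (rem x a)))
  where
  lemma : ∀ c a b d → c *ℚ a +ℚ (c *ℚ b +ℚ c *ℚ d) ≡ c *ℚ (a +ℚ (b +ℚ d))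
  lemma = solve-∀ ringℚ
evens-* c h zero    a = sym (ℚₚ.*-zeroʳ c)
evens-* c h (suc x) a = trans (cong₂ _+ℚ_ (evens-* c h x a) (odds-* c h x (rem x a)))
  (sym (ℚₚ.*-distribˡ-+ c (evens h x a) (odds h x (rem x a))))

check : Shape → ℚ → ℚ
check a q = if does (valid? a) then q else 0ℚ

check-valid : ∀ {a} q → Valid a → check a q ≡ q
check-valid {a} q v with valid? a
... | yes _ = refl
... | no ¬v = ⊥-elim (¬v v)

check-invalid : ∀ {a} q → ¬ Valid a → check a q ≡ 0ℚ
check-invalid {a} q ¬v with valid? a
... | yes v = ⊥-elim (¬v v)
... | no _  = refl

checked : Fn → Fn
checked h x a = check a (h x a)

VanishesOnFlat : Fn → Set
VanishesOnFlat h = ∀ x a → Flat x a → h x a ≡ 0ℚ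

-- Invalid good shapes are flat, so the cut-off is invisible to strip sums of a function that
-- vanishes on flat shapes.
checked-agree : ∀ {h} → VanishesOnFlat h → AgreeOnGood (checked h) h
checked-agree {h} z x a (inj₁ v) = check-valid (h x a) v
checked-agree {h} z x a (inj₂ f) = trans (check-invalid (h x a) (flat⇒¬valid f)) (sym (z x a f))

checked-vanishes : ∀ h → VanishesOnFlat (checked h)
checked-vanishes h x a f = check-invalid (h x a) (flat⇒¬valid f)

flat-above : ∀ {x y a} → Flat x a → y < x → Flat y (rem y a)
flat-above {suc x} f (s≤s y≤x) with ℕₚ.m≤n⇒m<n∨m≡n y≤x
... | inj₁ y<x  = flat-above (flat-pred f) y<x
... | inj₂ refl = flat-rem f

above-vanishes : ∀ {h} → VanishesOnFlat h → VanishesOnFlat (above h)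
above-vanishes z x a f = Σ<-zero x (λ y y<x → z y (rem y a) (flat-above f y<x))

-- A strip counted by `evens` has at least two boxes, so the relation expresses `f a` through shapes
-- of smaller sum, where `f` is zero by induction if they are valid and by assumption if they are
-- flat. The bound `N` is there because the Abel sums satisfy the relation only up to a truncation
-- order.
vanishing-unique : ∀ p N (f : Shape → ℚ) → (∀ a → Flat zero a → f a ≡ 0ℚ) →
  (∀ a → sum a < N → length a ≡ p → Valid a → f a +ℚ evens (λ _ → f) p a ≡ 0ℚ) →
  ∀ n → n ≤ N → ∀ a → sum a < n → length a ≡ p → Valid a → f a ≡ 0ℚ
vanishing-unique p N f flat eqn (suc n) n<N a (s≤s sum≤n) refl v = begin
  f a ≡⟨ ℚₚ.+-identityʳ (f a) ⟨
  f a +ℚ 0ℚ ≡⟨ cong (f a +ℚ_) (evens0 p a (inj₁ v) ℕₚ.≤-refl refl sum≤n) ⟨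
  f a +ℚ evens (λ _ → f) p a ≡⟨ eqn a (ℕₚ.≤-<-trans sum≤n n<N) refl v ⟩
  0ℚ ∎
  where
  smaller : ∀ b → length b ≡ p → sum b < n → Good zero b → f b ≡ 0ℚ
  smaller b l s (inj₁ v) = vanishing-unique p N f flat eqn n (ℕₚ.<⇒≤ n<N) b s l v
  smaller b l s (inj₂ g) = flat b g
  good-zero : ∀ {x b} → Good x b → Good zero b
  good-zero (inj₁ v) = inj₁ v
  good-zero (inj₂ g) = inj₂ (flat-zero g)
  odds0′  : ∀ x b → Good x b → length b ≡ p → sum b < n → odds (λ _ → f) x b ≡ 0ℚ
  evens0′ : ∀ x b → Good x b → length b ≡ p → sum b < n → evens (λ _ → f) x b ≡ 0ℚ
  odds0′ zero    b g l s = refl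
  odds0′ (suc x) b g l s = cong₂ _+ℚ_ (odds0′ x b (good-pred g) l s)
    (cong₂ _+ℚ_ (smaller (rem x b) l′ s′ (good-zero (good-rem g))) (evens0′ x (rem x b) (good-rem g) l′ s′))
    where
    l′ = trans (length-rem x b) l
    s′ = ℕₚ.≤-<-trans (sum-rem-≤ x b) s
  evens0′ zero    b g l s = refl
  evens0′ (suc x) b g l s = cong₂ _+ℚ_ (evens0′ x b (good-pred g) l s)
    (odds0′ x (rem x b) (good-rem g) (trans (length-rem x b) l) (ℕₚ.≤-<-trans (sum-rem-≤ x b) s))
  -- Until the first removal the shape is still `a`; after it the sum is below `n` and the primed
  -- versions apply.
  evens0 : ∀ x b → Good x b → x ≤ length b → b ≡ a → sum b ≤ n → evens (λ _ → f) x b ≡ 0ℚ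
  evens0 zero    b g x≤ refl s = refl
  evens0 (suc x) b g x≤ refl s = cong₂ _+ℚ_ (evens0 x b (good-pred g) (ℕₚ.<⇒≤ x≤) refl s)
    (odds0′ x (rem x b) (good-rem g) (length-rem x b) (subst (_≤ n) (sym (sum-rem v x≤)) s))

-- The empty partition and the signed count of alternating words

eqStair : ℕ → Shape → Bool
eqStair zero    []       = true
eqStair zero    (_ ∷ _)  = false
eqStair (suc p) []       = false
eqStair (suc p) (a ∷ as) = (a ≡ᵇ suc p) ∧ eqStair p as

-- The encoding of the empty partition: λᵢ = 0 gives aᵢ = p - i.
stair : ℕ → Shape
stair zero    = []
stair (suc p) = suc p ∷ stair p

ι : Bool → ℚ
ι b = if b then 1ℚ else 0ℚ

δ : ℕ → Shape → ℚ
δ p a = ι (eqStair p a)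

eqStair-sound : ∀ p a → eqStair p a ≡ true → a ≡ stair p
eqStair-sound zero    []       e = refl
eqStair-sound (suc p) (a ∷ as) e with a ≡ᵇ suc p in q
... | true = cong₂ _∷_ (ℕₚ.≡ᵇ⇒≡ a (suc p) (subst T (sym q) tt)) (eqStair-sound p as e)

hd-stair : ∀ p → hd (stair p) ≡ p
hd-stair zero    = refl
hd-stair (suc p) = refl

valid-stair : ∀ p → Valid (stair p)
valid-stair zero    = []
valid-stair (suc p) = s≤s (ℕₚ.≤-reflexive (hd-stair p)) ∷ valid-stair p

δ-zero : ∀ p a → a ≢ stair p → δ p a ≡ 0ℚ
δ-zero p a ≢ with eqStair p a in e
... | false = refl
... | true  = ⊥-elim (≢ (eqStair-sound p a e))

δ-flat : ∀ p → VanishesOnFlat (λ _ → δ p)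
δ-flat p x a f = δ-zero p a (λ { refl → flat⇒¬valid f (valid-stair p) })

module Alternating (p : ℕ) where

  anywhere : Fn → Fn
  anywhere h x a = Σ< p (λ y → h y (rem y a))

  belowEq : Fn → Fn
  belowEq h x a = anywhere h x a -ℚ above h x a

  -- Each step removes two boxes, one strictly above the previous row and one at or below the new
  -- row, so the phase of the alternating pattern is the same before every step. `tails j` counts
  -- the ways to reach the empty shape with 2j boxes.
  tails : ℕ → Fn
  tails zero    = λ _ → δ p
  tails (suc j) = checked (above (checked (belowEq (tails j))))

  words : ℕ → Shape → ℚ
  words j a = checked (anywhere (tails j)) 0 a

  tails-flat : ∀ j → VanishesOnFlat (tails j)
  tails-flat zero    = δ-flat p
  tails-flat (suc j) = checked-vanishes _

  -- The first letter of the word is compared with the last row of the strip. If it lies above, it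
  -- prolongs the strip to an odd one, followed by `tails j`. If not, the last box of the strip and
  -- this letter form the first step of `tails (suc j)`, and an odd strip remains.
  evens-words : ∀ j a → Valid a →
    words j a +ℚ evens (λ _ → words j) p a ≡ odds (tails j) p a +ℚ odds (tails (suc j)) p a
  evens-words j a v = begin
    words j a +ℚ evens (λ _ → words j) p a
      ≡⟨ cong₂ _+ℚ_ (split p a (inj₁ v)) (trans (evens-cong split p a (inj₁ v)) (evens-+ (above g) k p a)) ⟩
    (above g p a +ℚ k p a) +ℚ (evens (above g) p a +ℚ evens k p a)
      ≡⟨ shuffle (above g p a) (k p a) (evens (above g) p a) (evens k p a) ⟩
    (above g p a +ℚ evens (above g) p a) +ℚ (k p a +ℚ evens k p a)
      ≡⟨ cong₂ _+ℚ_ (sym (odds-above g p a)) (cong₂ _+ℚ_ k0 (evens-above k p a)) ⟩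
    odds g p a +ℚ (0ℚ +ℚ odds (above k) p a)
      ≡⟨ cong (odds g p a +ℚ_) (ℚₚ.+-identityˡ _) ⟩
    odds g p a +ℚ odds (above k) p a
      ≡⟨ cong (odds g p a +ℚ_) (odds-cong (checked-agree (above-vanishes (checked-vanishes (belowEq g)))) p a (inj₁ v)) ⟨
    odds g p a +ℚ odds (tails (suc j)) p a ∎
    where
    g = tails j
    k = checked (belowEq g)
    -- For the empty strip the comparison is with the fictitious row `p`, which every letter lies
    -- above.
    k0 : k p a ≡ 0ℚ
    k0 = trans (check-valid _ v) (ℚₚ.+-inverseʳ (above g p a))
    cancel : ∀ x y → x ≡ y +ℚ (x -ℚ y)
    cancel = solve-∀ ringℚ
    split : AgreeOnGood (λ _ → words j) (λ x a → above g x a +ℚ k x a)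
    split x b (inj₁ v) = trans (check-valid _ v) (trans (cancel (anywhere g x b) (above g x b)) (cong (above g x b +ℚ_) (sym (check-valid _ v))))
    split x b (inj₂ f) = trans (check-invalid _ (flat⇒¬valid f))
      (sym (cong₂ _+ℚ_ (above-vanishes (tails-flat j) x b f) (checked-vanishes (belowEq g) x b f)))

  -- The alternating signs make neighbouring right-hand sides of `evens-words` cancel. On a shape of
  -- length `p` at most one summand is nonzero, since the number of boxes fixes the length of the
  -- word.
  signedWords : ℕ → Shape → ℚ
  signedWords zero    a = 0ℚ
  signedWords (suc J) a = signedWords J a +ℚ (-ℚ signℚ J) *ℚ words J a

  evens-signedWords : ∀ J a → Valid a →
    signedWords J a +ℚ evens (λ _ → signedWords J) p a ≡ (-ℚ odds (tails 0) p a) +ℚ signℚ J *ℚ odds (tails J) p a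
  evens-signedWords zero    a v = trans (cong (0ℚ +ℚ_) (evens-zero p a)) (lemma (odds (tails 0) p a))
    where
    evens-zero : ∀ x a → evens (λ _ _ → 0ℚ) x a ≡ 0ℚ
    odds-zero : ∀ x a → odds (λ _ _ → 0ℚ) x a ≡ 0ℚ
    evens-zero zero    a = refl
    evens-zero (suc x) a = cong₂ _+ℚ_ (evens-zero x a) (odds-zero x (rem x a))
    odds-zero zero    a = refl
    odds-zero (suc x) a = cong₂ (λ u v → u +ℚ (0ℚ +ℚ v)) (odds-zero x a) (evens-zero x (rem x a))
    lemma : ∀ x → 0ℚ +ℚ 0ℚ ≡ (-ℚ x) +ℚ 1ℚ *ℚ x
    lemma = solve-∀ ringℚ
  evens-signedWords (suc J) a v = begin
    (signedWords J a +ℚ c *ℚ words J a) +ℚ evens (λ _ → signedWords (suc J)) p a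
      ≡⟨ cong ((signedWords J a +ℚ c *ℚ words J a) +ℚ_) (trans (evens-+ (λ _ → signedWords J) (λ _ a → c *ℚ words J a) p a)
           (cong (evens (λ _ → signedWords J) p a +ℚ_) (evens-* c (λ _ → words J) p a))) ⟩
    (signedWords J a +ℚ c *ℚ words J a) +ℚ (evens (λ _ → signedWords J) p a +ℚ c *ℚ evens (λ _ → words J) p a)
      ≡⟨ lemma₁ (signedWords J a) c (words J a) (evens (λ _ → signedWords J) p a) (evens (λ _ → words J) p a) ⟩
    (signedWords J a +ℚ evens (λ _ → signedWords J) p a) +ℚ c *ℚ (words J a +ℚ evens (λ _ → words J) p a)
      ≡⟨ cong₂ (λ u w → u +ℚ c *ℚ w) (evens-signedWords J a v) (evens-words J a v) ⟩
    ((-ℚ odds (tails 0) p a) +ℚ signℚ J *ℚ odds (tails J) p a) +ℚ c *ℚ (odds (tails J) p a +ℚ odds (tails (suc J)) p a)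
      ≡⟨ lemma₂ (odds (tails 0) p a) (signℚ J) (odds (tails J) p a) (odds (tails (suc J)) p a) ⟩
    (-ℚ odds (tails 0) p a) +ℚ c *ℚ odds (tails (suc J)) p a ∎
    where
    c = -ℚ signℚ J
    lemma₁ : ∀ s c w e f → (s +ℚ c *ℚ w) +ℚ (e +ℚ c *ℚ f) ≡ (s +ℚ e) +ℚ c *ℚ (w +ℚ f)
    lemma₁ = solve-∀ ringℚ
    lemma₂ : ∀ o s x y → ((-ℚ o) +ℚ s *ℚ x) +ℚ (-ℚ s) *ℚ (x +ℚ y) ≡ (-ℚ o) +ℚ (-ℚ s) *ℚ y
    lemma₂ = solve-∀ ringℚ

  tails-size : ∀ j x b → x ≤ p → length b ≡ p → sum b ≢ j + j + sum (stair p) → tails j x b ≡ 0ℚ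
  tails-size zero    x b x≤ l s = δ-zero p b (λ { refl → s refl })
  tails-size (suc j) x b x≤ l s with valid? b
  ... | no _  = refl
  ... | yes v = Σ<-zero x inner
    where
    inner : ∀ y → y < x → checked (belowEq (tails j)) y (rem y b) ≡ 0ℚ
    inner y y<x with valid? (rem y b)
    ... | no _   = refl
    ... | yes v′ = trans (cong₂ _-ℚ_ (Σ<-zero p (λ z z<p → rest z z<p)) (Σ<-zero y (λ z z<y → rest z (ℕₚ.<-trans z<y y<p)))) refl
      where
      y<p = ℕₚ.<-≤-trans y<x x≤
      l′ = trans (length-rem y b) l
      rest : ∀ z → z < p → tails j z (rem z (rem y b)) ≡ 0ℚ
      rest z z<p = tails-size j z _ (ℕₚ.<⇒≤ z<p) (trans (length-rem z (rem y b)) l′)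
        (λ e → s (trans (sym (sum-rem v (subst (y <_) (sym l) y<p)))
          (trans (cong suc (sym (sum-rem v′ (subst (z <_) (sym l′) z<p))))
          (trans (cong (suc ∘ suc) e) (cong (λ t → suc (t + sum (stair p))) (sym (ℕₚ.+-suc j j)))))))

  words-size : ∀ j a → length a ≡ p → sum a ≢ suc (j + j + sum (stair p)) → words j a ≡ 0ℚ
  words-size j a l s with valid? a
  ... | no _  = refl
  ... | yes v = Σ<-zero p (λ x x<p → tails-size j x (rem x a) (ℕₚ.<⇒≤ x<p) (trans (length-rem x a) l)
    (λ e → s (trans (sym (sum-rem v (subst (x <_) (sym l) x<p))) (cong suc e))))

  -- `tails J` needs 2J boxes, more than the sum of the entries allows. This removes the remainder
  -- of the telescoping sum.
  odds-tails-size : ∀ J a → length a ≡ p → sum a < J → odds (tails J) p a ≡ 0ℚ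
  odds-tails-size J a l s = o p a ℕₚ.≤-refl l s
    where
    o : ∀ x a → x ≤ p → length a ≡ p → sum a < J → odds (tails J) x a ≡ 0ℚ
    e : ∀ x a → x ≤ p → length a ≡ p → sum a < J → evens (tails J) x a ≡ 0ℚ
    small : ∀ a → sum a < J → sum a ≢ J + J + sum (stair p)
    small a s eq = ℕₚ.<⇒≱ s (subst (J ≤_) (sym eq) (ℕₚ.≤-trans (ℕₚ.m≤m+n J J) (ℕₚ.m≤m+n (J + J) _)))
    o zero    a x≤ l s = refl
    o (suc x) a x≤ l s = cong₂ _+ℚ_ (o x a (ℕₚ.<⇒≤ x≤) l s)
      (cong₂ _+ℚ_ (tails-size J x (rem x a) (ℕₚ.<⇒≤ x≤) l′ (small (rem x a) s′)) (e x (rem x a) (ℕₚ.<⇒≤ x≤) l′ s′))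
      where
      l′ = trans (length-rem x a) l
      s′ = ℕₚ.≤-<-trans (sum-rem-≤ x a) s
    e zero    a x≤ l s = refl
    e (suc x) a x≤ l s = cong₂ _+ℚ_ (e x a (ℕₚ.<⇒≤ x≤) l s)
      (o x (rem x a) (ℕₚ.<⇒≤ x≤) (trans (length-rem x a) l) (ℕₚ.≤-<-trans (sum-rem-≤ x a) s))

  signedWords-flat : ∀ J a → Flat zero a → signedWords J a ≡ 0ℚ
  signedWords-flat zero    a f = refl
  signedWords-flat (suc J) a f = cong₂ _+ℚ_ (signedWords-flat J a f)
    (trans (cong ((-ℚ signℚ J) *ℚ_) (checked-vanishes (anywhere (tails J)) 0 a f)) (ℚₚ.*-zeroʳ (-ℚ signℚ J)))

  -- The words counted have at least one letter, so `δ` supplies the value at the empty shape. The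
  -- difference of the two sides satisfies the homogeneous relation and falls to `vanishing-unique`.
  signedWords-unique : ∀ J (f : Shape → ℚ) → (∀ a → Flat zero a → f a ≡ 0ℚ) →
    (∀ a → sum a < J → length a ≡ p → Valid a →
      f a +ℚ evens (λ _ → f) p a ≡ (δ p a +ℚ evens (λ _ → δ p) p a) -ℚ odds (λ _ → δ p) p a) →
    ∀ a → sum a < J → length a ≡ p → Valid a → f a ≡ δ p a +ℚ signedWords J a
  signedWords-unique J f flat eqn a s l v = begin
    f a ≡⟨ cancel (f a) (δ p a) (signedWords J a) ⟩
    diff a +ℚ (δ p a +ℚ signedWords J a) ≡⟨ cong (λ t → t +ℚ (δ p a +ℚ signedWords J a)) diff0 ⟩
    0ℚ +ℚ (δ p a +ℚ signedWords J a) ≡⟨ ℚₚ.+-identityˡ _ ⟩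
    δ p a +ℚ signedWords J a ∎
    where
    diff : Shape → ℚ
    diff a = f a +ℚ (-ℚ 1ℚ) *ℚ (δ p a +ℚ signedWords J a)
    cancel : ∀ x y z → x ≡ (x +ℚ (-ℚ 1ℚ) *ℚ (y +ℚ z)) +ℚ (y +ℚ z)
    cancel = solve-∀ ringℚ
    rearrange : ∀ f e d ed s es → (f +ℚ (-ℚ 1ℚ) *ℚ (d +ℚ s)) +ℚ (e +ℚ (-ℚ 1ℚ) *ℚ (ed +ℚ es))
      ≡ (f +ℚ e) -ℚ ((d +ℚ ed) +ℚ (s +ℚ es))
    rearrange = solve-∀ ringℚ
    vanish : ∀ x o c → (x -ℚ o) -ℚ (x +ℚ ((-ℚ o) +ℚ c *ℚ 0ℚ)) ≡ 0ℚ
    vanish = solve-∀ ringℚ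
    E : (Shape → ℚ) → Shape → ℚ
    E h a = evens (λ _ → h) p a
    diff-eqn : ∀ a → sum a < J → length a ≡ p → Valid a → diff a +ℚ E diff a ≡ 0ℚ
    diff-eqn a s l v = begin
      diff a +ℚ E diff a
        ≡⟨ cong (diff a +ℚ_) (trans (evens-+ (λ _ → f) _ p a) (cong (E f a +ℚ_) (trans (evens-* (-ℚ 1ℚ) _ p a)
             (cong ((-ℚ 1ℚ) *ℚ_) (evens-+ (λ _ → δ p) (λ _ → signedWords J) p a))))) ⟩
      diff a +ℚ (E f a +ℚ (-ℚ 1ℚ) *ℚ (E (δ p) a +ℚ E (signedWords J) a))
        ≡⟨ rearrange (f a) (E f a) (δ p a) (E (δ p) a) (signedWords J a) (E (signedWords J) a) ⟩
      (f a +ℚ E f a) -ℚ ((δ p a +ℚ E (δ p) a) +ℚ (signedWords J a +ℚ E (signedWords J) a))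
        ≡⟨ cong₂ (λ x y → x -ℚ ((δ p a +ℚ E (δ p) a) +ℚ y)) (eqn a s l v) (evens-signedWords J a v) ⟩
      _ ≡⟨ cong (λ t → ((δ p a +ℚ E (δ p) a) -ℚ odds (tails 0) p a) -ℚ ((δ p a +ℚ E (δ p) a) +ℚ ((-ℚ odds (tails 0) p a) +ℚ signℚ J *ℚ t)))
             (odds-tails-size J a l s) ⟩
      _ ≡⟨ vanish (δ p a +ℚ E (δ p) a) (odds (tails 0) p a) (signℚ J) ⟩
      0ℚ ∎
    diff-flat : ∀ a → Flat zero a → diff a ≡ 0ℚ
    diff-flat a g = cong₂ (λ x y → x +ℚ (-ℚ 1ℚ) *ℚ y) (flat a g) (cong₂ _+ℚ_ (δ-flat p zero a g) (signedWords-flat J a g))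
    diff0 : diff a ≡ 0ℚ
    diff0 = vanishing-unique p J diff diff-flat diff-eqn J ℕₚ.≤-refl a s l v

-- Determinants

Row : Set
Row = ℕ → ℚ

tail : Row → Row
tail r n = r (suc n)

infixl 6 _⊞_·_
_⊞_·_ : Row → ℚ → Row → Row
(r ⊞ c · s) n = r n +ℚ c *ℚ s n

-- The continuation `g` receives the rows left after deleting one. Rows already passed are absorbed
-- into it, so the laws below are proved by induction for arbitrary `g`.
expand : (List Row → ℚ) → List Row → ℚ
expand g []       = 0ℚ
expand g (r ∷ rs) = r 0 *ℚ g rs -ℚ expand (λ xs → g (r ∷ xs)) rs

-- The determinant of the first n columns, by expansion along the first column.
-- It is 0 on lists of rows of any other length than n.
det : ℕ → List Row → ℚ
det zero    []      = 1ℚ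
det zero    (_ ∷ _) = 0ℚ
det (suc n) rs      = expand (λ xs → det n (map tail xs)) rs

expand-cong : ∀ {g h} rs → (∀ xs → g xs ≡ h xs) → expand g rs ≡ expand h rs
expand-cong []       e = refl
expand-cong (r ∷ rs) e = cong₂ (λ x y → r 0 *ℚ x -ℚ y) (e rs) (expand-cong rs (λ xs → e (r ∷ xs)))

expand-zero : ∀ {g} rs → (∀ xs → g xs ≡ 0ℚ) → expand g rs ≡ 0ℚ
expand-zero []       e = refl
expand-zero (r ∷ rs) e = trans (cong₂ (λ x y → r 0 *ℚ x -ℚ y) (e rs) (expand-zero rs (λ xs → e (r ∷ xs)))) (x*0-0 (r 0))

expand-linear : ∀ g c h rs → expand (λ xs → g xs +ℚ c *ℚ h xs) rs ≡ expand g rs +ℚ c *ℚ expand h rs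
expand-linear g c h []       = sym (0+x*0 c)
expand-linear g c h (r ∷ rs) = trans (cong (λ y → r 0 *ℚ (g rs +ℚ c *ℚ h rs) -ℚ y) (expand-linear (λ xs → g (r ∷ xs)) c (λ xs → h (r ∷ xs)) rs))
  (lemma (r 0) (g rs) c (h rs) (expand (λ xs → g (r ∷ xs)) rs) (expand (λ xs → h (r ∷ xs)) rs))
  where
  lemma : ∀ r g c h x y → r *ℚ (g +ℚ c *ℚ h) -ℚ (x +ℚ c *ℚ y) ≡ (r *ℚ g -ℚ x) +ℚ c *ℚ (r *ℚ h -ℚ y)
  lemma = solve-∀ ringℚ

Rows≗ : List Row → List Row → Set
Rows≗ = Pointwise (λ r s → ∀ k → r k ≡ s k)

≗-refl : ∀ xs → Rows≗ xs xs
≗-refl []       = []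
≗-refl (x ∷ xs) = (λ _ → refl) ∷ ≗-refl xs

-- The arbitrary prefix makes these properties stable under fixing the first row, which is what the
-- recursion of `expand` does. Equality is asked of adjacent rows only; `swap` recovers the general
-- case.
Linear Alternate : (List Row → ℚ) → Set
Linear g = ∀ pre r c s post → g (pre ++ (r ⊞ c · s) ∷ post) ≡ g (pre ++ r ∷ post) +ℚ c *ℚ g (pre ++ s ∷ post)
Alternate g = ∀ pre r post → g (pre ++ r ∷ r ∷ post) ≡ 0ℚ

NullRow : ℕ → (List Row → ℚ) → Set
NullRow n g = ∀ pre r post → (∀ k → k < n → r k ≡ 0ℚ) → g (pre ++ r ∷ post) ≡ 0ℚ

Extensional : (List Row → ℚ) → Set
Extensional g = ∀ {rs ss} → Rows≗ rs ss → g rs ≡ g ss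

expand-Linear : ∀ g → Linear g → Linear (expand g)
expand-Linear g lin [] r c s post = trans (cong (λ y → (r 0 +ℚ c *ℚ s 0) *ℚ g post -ℚ y)
    (trans (expand-cong post (λ xs → lin [] r c s xs)) (expand-linear (λ xs → g (r ∷ xs)) c (λ xs → g (s ∷ xs)) post)))
  (lemma (r 0) c (s 0) (g post) _ _)
  where
  lemma : ∀ r c s g x y → (r +ℚ c *ℚ s) *ℚ g -ℚ (x +ℚ c *ℚ y) ≡ (r *ℚ g -ℚ x) +ℚ c *ℚ (s *ℚ g -ℚ y)
  lemma = solve-∀ ringℚ
expand-Linear g lin (x ∷ pre) r c s post = trans
  (cong₂ (λ u v → x 0 *ℚ u -ℚ v) (lin pre r c s post) (expand-Linear (λ xs → g (x ∷ xs)) (λ pre → lin (x ∷ pre)) pre r c s post))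
  (lemma (x 0) _ c _ _ _)
  where
  lemma : ∀ r g c h x y → r *ℚ (g +ℚ c *ℚ h) -ℚ (x +ℚ c *ℚ y) ≡ (r *ℚ g -ℚ x) +ℚ c *ℚ (r *ℚ h -ℚ y)
  lemma = solve-∀ ringℚ

-- Deleting either copy leaves the same rows with opposite signs; deleting any other row leaves both
-- copies in place.
expand-Alternate : ∀ g → Alternate g → Alternate (expand g)
expand-Alternate g alt [] r post = trans
  (cong (λ y → r 0 *ℚ g (r ∷ post) -ℚ (r 0 *ℚ g (r ∷ post) -ℚ y)) (expand-zero post (λ xs → alt [] r xs))) (lemma (r 0) (g (r ∷ post)))
  where
  lemma : ∀ x y → x *ℚ y -ℚ (x *ℚ y -ℚ 0ℚ) ≡ 0ℚ
  lemma = solve-∀ ringℚ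
expand-Alternate g alt (x ∷ pre) r post = trans
  (cong₂ (λ u v → x 0 *ℚ u -ℚ v) (alt pre r post) (expand-Alternate (λ xs → g (x ∷ xs)) (λ pre → alt (x ∷ pre)) pre r post)) (x*0-0 (x 0))

expand-NullRow : ∀ {n} g → (∀ pre r post → (∀ k → k < n → r (suc k) ≡ 0ℚ) → g (pre ++ r ∷ post) ≡ 0ℚ) →
  NullRow (suc n) (expand g)
expand-NullRow {n} g null [] r post z = trans
  (cong₂ (λ u v → u *ℚ g post -ℚ v) (z 0 (s≤s z≤n)) (expand-zero post (λ xs → null [] r xs (λ k k<n → z (suc k) (s≤s k<n))))) (0*x-0 (g post))
expand-NullRow g null (x ∷ pre) r post z = trans
  (cong₂ (λ u v → x 0 *ℚ u -ℚ v) (null pre r post (λ k k<n → z (suc k) (s≤s k<n))) (expand-NullRow (λ xs → g (x ∷ xs)) (λ pre → null (x ∷ pre)) pre r post z)) (x*0-0 (x 0))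

expand-Extensional : ∀ g → Extensional g → Extensional (expand g)
expand-Extensional g ext []       = refl
expand-Extensional g ext {r ∷ rs} {s ∷ ss} (e ∷ es) = cong₂ _-ℚ_ (cong₂ _*ℚ_ (e 0) (ext es))
  (trans (expand-cong rs (λ xs → ext (e ∷ ≗-refl xs))) (expand-Extensional (λ xs → g (s ∷ xs)) (λ es → ext ((λ _ → refl) ∷ es)) es))

expand-column0 : ∀ g rs → All (λ r → r 0 ≡ 0ℚ) rs → expand g rs ≡ 0ℚ
expand-column0 g []       []       = refl
expand-column0 g (r ∷ rs) (z ∷ zs) = trans (cong₂ (λ u v → u *ℚ g rs -ℚ v) z (expand-column0 (λ xs → g (r ∷ xs)) rs zs)) (0*x-0 (g rs))

det-Linear : ∀ n → Linear (det n)
det-Linear zero [] r c s post = sym (0+x*0 c)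
det-Linear zero (_ ∷ _) r c s post = sym (0+x*0 c)
det-Linear (suc n) = expand-Linear _ λ pre r c s post →
  trans (cong (det n) (map-++ tail pre _)) (trans (det-Linear n (map tail pre) (tail r) c (tail s) (map tail post))
    (sym (cong₂ (λ x y → det n x +ℚ c *ℚ det n y) (map-++ tail pre _) (map-++ tail pre _))))

det-Alternate : ∀ n → Alternate (det n)
det-Alternate zero    []      r post = refl
det-Alternate zero    (_ ∷ _) r post = refl
det-Alternate (suc n) = expand-Alternate _ λ pre r post →
  trans (cong (det n) (map-++ tail pre _)) (det-Alternate n (map tail pre) (tail r) (map tail post))

det-NullRow : ∀ n → NullRow n (det n)
det-NullRow zero    []      r post z = refl
det-NullRow zero    (_ ∷ _) r post z = refl
det-NullRow (suc n) = expand-NullRow _ λ pre r post z →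
  trans (cong (det n) (map-++ tail pre _)) (det-NullRow n (map tail pre) (tail r) (map tail post) z)

det-Extensional : ∀ n → Extensional (det n)
det-Extensional zero    []      = refl
det-Extensional zero    (_ ∷ _) = refl
det-Extensional (suc n) = expand-Extensional _ (λ es → det-Extensional n (tails es))
  where
  tails : ∀ {rs ss} → Rows≗ rs ss →
    Rows≗ (map tail rs) (map tail ss)
  tails []       = []
  tails (e ∷ es) = (λ k → e (suc k)) ∷ tails es

-- Vertical strips acting on Jacobi-Trudi determinants

module Strips (row : ℕ → Row) (c : ℚ) (c² : c *ℚ c ≡ 1ℚ) where

  shifted : ℕ → Row
  shifted a = row a ⊞ c · row (pred a)

  shiftTo : ℕ → Shape → List Row
  shiftTo zero    as       = map row as
  shiftTo (suc x) []       = []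
  shiftTo (suc x) (a ∷ as) = shifted a ∷ shiftTo x as

  shiftTo-all : ∀ as → shiftTo (length as) as ≡ map shifted as
  shiftTo-all []       = refl
  shiftTo-all (a ∷ as) = cong (shifted a ∷_) (shiftTo-all as)

  shiftTo-step : ∀ g → Linear g → ∀ x a → x < length a →
    g (shiftTo (suc x) a) ≡ g (shiftTo x a) +ℚ c *ℚ g (shiftTo x (rem x a))
  shiftTo-step g lin zero    (a ∷ as) _       = lin [] (row a) c (row (pred a)) (map row as)
  shiftTo-step g lin (suc x) (a ∷ as) (s≤s l) = shiftTo-step (λ xs → g (shifted a ∷ xs)) (λ pre → lin (shifted a ∷ pre)) x as l

  -- Multilinear expansion of the rows `row a + c row (a − 1)`. A choice of second summands is a set
  -- of boxes in distinct rows and has weight c to the number of boxes, which by c² = 1 depends on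
  -- the parity alone.
  strips : ∀ g → Linear g → ∀ x a → x ≤ length a →
    let f = λ (_ : ℕ) a → g (map row a) in
    (f 0 a +ℚ evens f x a) +ℚ c *ℚ odds f x a ≡ g (shiftTo x a)
  strips g lin zero a x≤ = lemma c (g (map row a))
    where
    lemma : ∀ c x → (x +ℚ 0ℚ) +ℚ c *ℚ 0ℚ ≡ x
    lemma = solve-∀ ringℚ
  strips g lin (suc x) a x< = begin
    (f a +ℚ (ev a +ℚ od a′)) +ℚ c *ℚ (od a +ℚ (f a′ +ℚ ev a′))
      ≡⟨ lemma₁ (f a) (ev a) (od a′) c (od a) (f a′) (ev a′) ⟩
    ((f a +ℚ ev a) +ℚ c *ℚ od a) +ℚ (c *ℚ (f a′ +ℚ ev a′) +ℚ 1ℚ *ℚ od a′)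
      ≡⟨ cong (λ t → ((f a +ℚ ev a) +ℚ c *ℚ od a) +ℚ (c *ℚ (f a′ +ℚ ev a′) +ℚ t *ℚ od a′)) c² ⟨
    ((f a +ℚ ev a) +ℚ c *ℚ od a) +ℚ (c *ℚ (f a′ +ℚ ev a′) +ℚ (c *ℚ c) *ℚ od a′)
      ≡⟨ lemma₂ ((f a +ℚ ev a) +ℚ c *ℚ od a) c (f a′ +ℚ ev a′) (od a′) ⟩
    ((f a +ℚ ev a) +ℚ c *ℚ od a) +ℚ c *ℚ ((f a′ +ℚ ev a′) +ℚ c *ℚ od a′)
      ≡⟨ cong₂ (λ u v → u +ℚ c *ℚ v) (strips g lin x a (ℕₚ.<⇒≤ x<)) (strips g lin x a′ (subst (x ≤_) (sym (length-rem x a)) (ℕₚ.<⇒≤ x<))) ⟩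
    g (shiftTo x a) +ℚ c *ℚ g (shiftTo x a′)
      ≡⟨ shiftTo-step g lin x a x< ⟨
    g (shiftTo (suc x) a) ∎
    where
    a′ = rem x a
    f ev od : Shape → ℚ
    f a = g (map row a)
    ev a = evens (λ _ → f) x a
    od a = odds (λ _ → f) x a
    lemma₁ : ∀ f e o′ c o f′ e′ → (f +ℚ (e +ℚ o′)) +ℚ c *ℚ (o +ℚ (f′ +ℚ e′)) ≡ ((f +ℚ e) +ℚ c *ℚ o) +ℚ (c *ℚ (f′ +ℚ e′) +ℚ 1ℚ *ℚ o′)
    lemma₁ = solve-∀ ringℚ
    lemma₂ : ∀ u c v o → u +ℚ (c *ℚ v +ℚ (c *ℚ c) *ℚ o) ≡ u +ℚ c *ℚ (v +ℚ c *ℚ o)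
    lemma₂ = solve-∀ ringℚ

-- Delannoy numbers: Σₙ q m n tⁿ = ((1 + t) / (1 − t))ᵐ.
q : ℕ → ℕ → ℚ
q m       zero    = 1ℚ
q zero    (suc n) = 0ℚ
q (suc m) (suc n) = (q (suc m) n +ℚ q m (suc n)) +ℚ q m n

-- qShift m p k = q m (k − p), which is 0 for k < p.
qShift : ℕ → ℕ → ℕ → ℚ
qShift m zero    k       = q m k
qShift m (suc p) zero    = 0ℚ
qShift m (suc p) (suc k) = qShift m p k

qShift-step : ∀ m p k → qShift (suc m) p (suc k) +ℚ (-ℚ 1ℚ) *ℚ qShift (suc m) p k ≡ qShift m p (suc k) +ℚ 1ℚ *ℚ qShift m p k
qShift-step m zero k = lemma (q (suc m) k) (q m (suc k)) (q m k)
  where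
  lemma : ∀ x y z → ((x +ℚ y) +ℚ z) +ℚ (-ℚ 1ℚ) *ℚ x ≡ y +ℚ 1ℚ *ℚ z
  lemma = solve-∀ ringℚ
qShift-step m (suc zero)    zero    = refl
qShift-step m (suc (suc p)) zero    = refl
qShift-step m (suc p)       (suc k) = qShift-step m p k

qShift-small : ∀ m p k → k < p → qShift m p k ≡ 0ℚ
qShift-small m (suc p) zero    _       = refl
qShift-small m (suc p) (suc k) (s≤s l) = qShift-small m p k l

row : ℕ → ℕ → ℕ → Row
row p m a n = qShift m p (a + n)

-- The Jacobi–Trudi determinant det (q m (λᵢ − i + j)).
F : ℕ → ℕ → Shape → ℚ
F p m a = det p (map (row p m) a)

-- Equal consecutive entries give equal rows, and a last entry 0 gives a row that vanishes in the
-- first `p` columns.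
F-flat : ∀ p m a → Flat zero a → F p m a ≡ 0ℚ
F-flat p m a f = go (det p) (det-Alternate p) (det-NullRow p) f
  where
  go : ∀ g {a} → Alternate g → NullRow p g → Flat zero a → g (map (row p m) a) ≡ 0ℚ
  go g {_ ∷ []}      alt null (here refl) = null [] (row p m 0) [] (qShift-small m p)
  go g {b ∷ _ ∷ as}  alt null (here refl) = alt [] (row p m b) (map (row p m) as)
  go g {b ∷ _}       alt null (skip f)    = go (λ xs → g (row p m b ∷ xs)) (λ pre → alt (row p m b ∷ pre)) (λ pre → null (row p m b ∷ pre)) f

F-step : ∀ p m a → length a ≡ p → Valid a →
  (F p (suc m) a +ℚ evens (λ _ → F p (suc m)) p a) +ℚ (-ℚ 1ℚ) *ℚ odds (λ _ → F p (suc m)) p a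
    ≡ (F p m a +ℚ evens (λ _ → F p m) p a) +ℚ 1ℚ *ℚ odds (λ _ → F p m) p a
F-step p m a refl v = begin
  _ ≡⟨ M.strips (det p) (det-Linear p) p a ℕₚ.≤-refl ⟩
  det p (M.shiftTo p a) ≡⟨ cong (det p) (M.shiftTo-all a) ⟩
  det p (map M.shifted a) ≡⟨ det-Extensional p {_} {_} (rows v) ⟩
  det p (map P.shifted a) ≡⟨ cong (det p) (P.shiftTo-all a) ⟨
  det p (P.shiftTo p a) ≡⟨ P.strips (det p) (det-Linear p) p a ℕₚ.≤-refl ⟨
  _ ∎
  where
  module M = Strips (row p (suc m)) (-ℚ 1ℚ) refl
  module P = Strips (row p m) 1ℚ refl
  rows : ∀ {a} → Valid a → Rows≗ (map M.shifted a) (map P.shifted a)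
  rows []                       = []
  -- Entries of a valid shape are positive, so `pred` is a genuine decrement here.
  rows (_∷_ {suc a} (s≤s _) v)  = (λ n → qShift-step m p (a + n)) ∷ rows v

length≤hd : ∀ {a} → Valid a → length a ≤ hd a
length≤hd []      = z≤n
length≤hd (h ∷ v) = ℕₚ.≤-<-trans (length≤hd v) h

qShift0-one : ∀ p → qShift 0 p p ≡ 1ℚ
qShift0-one zero    = refl
qShift0-one (suc p) = qShift0-one p

qShift0-large : ∀ p k → p < k → qShift 0 p k ≡ 0ℚ
qShift0-large zero    (suc k) _       = refl
qShift0-large (suc p) (suc k) (s≤s l) = qShift0-large p k l

≡ᵇ-refl : ∀ n → (n ≡ᵇ n) ≡ true
≡ᵇ-refl zero    = refl
≡ᵇ-refl (suc n) = ≡ᵇ-refl n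

≢⇒≡ᵇ-false : ∀ m n → m ≢ n → (m ≡ᵇ n) ≡ false
≢⇒≡ᵇ-false m n m≢n with m ≡ᵇ n in e
... | false = refl
... | true  = ⊥-elim (m≢n (ℕₚ.≡ᵇ⇒≡ m n (subst T (sym e) tt)))

expand-length : ∀ n g → (∀ rs → length rs ≢ n → g rs ≡ 0ℚ) → ∀ rs → length rs ≢ suc n → expand g rs ≡ 0ℚ
expand-length n       g z []           l = refl
expand-length zero    g z (r ∷ [])     l = ⊥-elim (l refl)
expand-length zero    g z (r ∷ s ∷ rs) l = trans
  (cong₂ (λ u v → r 0 *ℚ u -ℚ v) (z (s ∷ rs) (λ ())) (expand-zero (s ∷ rs) (λ xs → z (r ∷ xs) (λ ())))) (x*0-0 (r 0))
expand-length (suc n) g z (r ∷ rs) l = trans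
  (cong₂ (λ u v → r 0 *ℚ u -ℚ v) (z rs (λ e → l (cong suc e)))
    (expand-length n (λ xs → g (r ∷ xs)) (λ xs l → z (r ∷ xs) (λ e → l (ℕₚ.suc-injective e))) rs (λ e → l (cong suc e)))) (x*0-0 (r 0))

det-length : ∀ n rs → length rs ≢ n → det n rs ≡ 0ℚ
det-length zero    []       l = ⊥-elim (l refl)
det-length zero    (r ∷ rs) l = refl
det-length (suc n) = expand-length n _ (λ rs l → det-length n (map tail rs) (λ e → l (trans (sym (length-map tail rs)) e)))

length-stair : ∀ p → length (stair p) ≡ p
length-stair zero    = refl
length-stair (suc p) = cong suc (length-stair p)

-- At m = 0 the series is the constant 1. The first entry of a valid shape is at least the number of
-- rows: equality makes the first column a unit vector and leaves the same problem with one row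
-- less, and a larger entry makes the first row zero.
F-zero : ∀ p a → length a ≡ p → Valid a → F p 0 a ≡ δ p a
F-zero zero    []       l v = refl
F-zero (suc p) (a ∷ as) l (h ∷ v) with a ℕₚ.≟ suc p
... | yes refl = begin
  row (suc p) 0 (suc p) 0 *ℚ det p (map tail (map (row (suc p) 0) as)) -ℚ expand _ (map (row (suc p) 0) as)
    ≡⟨ cong₂ (λ u w → u *ℚ det p (map tail (map (row (suc p) 0) as)) -ℚ w)
         (trans (cong (qShift 0 p) (ℕₚ.+-identityʳ p)) (qShift0-one p)) (expand-column0 _ _ (column0 h v)) ⟩
  1ℚ *ℚ det p (map tail (map (row (suc p) 0) as)) -ℚ 0ℚ
    ≡⟨ lemma _ ⟩
  det p (map tail (map (row (suc p) 0) as))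
    ≡⟨ det-Extensional p {_} {_} (shift as) ⟩
  F p 0 as
    ≡⟨ F-zero p as (ℕₚ.suc-injective l) v ⟩
  δ p as
    ≡⟨ cong (λ b → ι (b ∧ eqStair p as)) (≡ᵇ-refl p) ⟨
  δ (suc p) (suc p ∷ as) ∎
  where
  lemma : ∀ x → 1ℚ *ℚ x -ℚ 0ℚ ≡ x
  lemma = solve-∀ ringℚ
  column0 : ∀ {as k} → hd as < k → Valid as → {{k ≡ suc p}} → All (λ r → r 0 ≡ 0ℚ) (map (row (suc p) 0) as)
  column0 {[]}     h v = []
  column0 {b ∷ bs} h (h′ ∷ v) {{refl}} = qShift-small 0 (suc p) (b + 0) (subst (_< suc p) (sym (ℕₚ.+-identityʳ b)) h)
    ∷ column0 (ℕₚ.<-trans h′ h) v {{refl}}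
  shift : ∀ as → Rows≗ (map tail (map (row (suc p) 0) as)) (map (row p 0) as)
  shift []       = []
  shift (b ∷ bs) = (λ n → cong (qShift 0 (suc p)) (ℕₚ.+-suc b n)) ∷ shift bs
... | no a≢ = trans (det-NullRow (suc p) [] (row (suc p) 0 a) (map (row (suc p) 0) as)
    (λ k _ → qShift0-large (suc p) (a + k) (ℕₚ.<-≤-trans big (ℕₚ.m≤m+n a k))))
  (sym (cong (λ b → ι (b ∧ eqStair p as)) (≢⇒≡ᵇ-false a (suc p) a≢)))
  where
  big : suc p < a
  big = ℕₚ.≤∧≢⇒< (subst (_≤ a) l (length≤hd (h ∷ v))) (λ e → a≢ (sym e))

-- Strip sums compare functions on good shapes of every length; where the length differs from `p`,
-- both sides are 0.
F-zero-good : ∀ p → AgreeOnGood (λ _ → F p 0) (λ _ → δ p)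
F-zero-good p x a (inj₂ f) = trans (F-flat p 0 a (flat-zero f)) (sym (δ-flat p x a f))
F-zero-good p x a (inj₁ v) with length a ℕₚ.≟ p
... | yes l = F-zero p a l v
... | no ¬l = trans (det-length p _ (λ e → ¬l (trans (sym (length-map (row p 0) a)) e)))
  (sym (δ-zero p a (λ { refl → ¬l (length-stair p) })))

-- Abel summation of polynomial functions

Δ : (ℕ → ℚ) → ℕ → ℚ
Δ f m = f (suc m) -ℚ f m

-- DegBelow d f: f is a polynomial function of degree less than d.
DegBelow : ℕ → (ℕ → ℚ) → Set
DegBelow zero    f = ∀ m → f m ≡ 0ℚ
DegBelow (suc d) f = DegBelow d (Δ f)

-- The Abel sum Σₘ (−1)ᵐ f(m) of a polynomial function f of degree less than N,
-- as the Euler transform Σ_{k<N} (−1)ᵏ (Δᵏ f)(0) / 2ᵏ⁺¹.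
abel : ℕ → (ℕ → ℚ) → ℚ
abel zero    f = 0ℚ
abel (suc N) f = ½ *ℚ (f 0 -ℚ abel N (Δ f))

abel-cong : ∀ N {f g} → (∀ m → f m ≡ g m) → abel N f ≡ abel N g
abel-cong zero    e = refl
abel-cong (suc N) e = cong₂ (λ x y → ½ *ℚ (x -ℚ y)) (e 0) (abel-cong N (λ m → cong₂ _-ℚ_ (e (suc m)) (e m)))

abel-linear : ∀ N f c g → abel N (λ m → f m +ℚ c *ℚ g m) ≡ abel N f +ℚ c *ℚ abel N g
abel-linear zero    f c g = sym (0+x*0 c)
abel-linear (suc N) f c g = trans
  (cong (λ t → ½ *ℚ ((f 0 +ℚ c *ℚ g 0) -ℚ t)) (trans (abel-cong N (λ m → lemma₁ (f (suc m)) c (g (suc m)) (f m) (g m))) (abel-linear N (Δ f) c (Δ g))))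
  (lemma₂ (f 0) c (g 0) (abel N (Δ f)) (abel N (Δ g)))
  where
  lemma₁ : ∀ f c g f′ g′ → (f +ℚ c *ℚ g) -ℚ (f′ +ℚ c *ℚ g′) ≡ (f -ℚ f′) +ℚ c *ℚ (g -ℚ g′)
  lemma₁ = solve-∀ ringℚ
  lemma₂ : ∀ f c g x y → ½ *ℚ ((f +ℚ c *ℚ g) -ℚ (x +ℚ c *ℚ y)) ≡ ½ *ℚ (f -ℚ x) +ℚ c *ℚ (½ *ℚ (g -ℚ y))
  lemma₂ = solve-∀ ringℚ

abel-zero : ∀ N → abel N (λ _ → 0ℚ) ≡ 0ℚ
abel-zero zero    = refl
abel-zero (suc N) = cong (λ t → ½ *ℚ (0ℚ -ℚ t)) (abel-zero N)

abel-+ : ∀ N f g → abel N (λ m → f m +ℚ g m) ≡ abel N f +ℚ abel N g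
abel-+ N f g = trans (abel-cong N (λ m → cong (f m +ℚ_) (sym (ℚₚ.*-identityˡ (g m)))))
  (trans (abel-linear N f 1ℚ g) (cong (abel N f +ℚ_) (ℚₚ.*-identityˡ _)))

abel-* : ∀ N c g → abel N (λ m → c *ℚ g m) ≡ c *ℚ abel N g
abel-* N c g = trans (abel-cong N (λ m → sym (ℚₚ.+-identityˡ (c *ℚ g m))))
  (trans (abel-linear N (λ _ → 0ℚ) c g) (trans (cong (_+ℚ c *ℚ abel N g) (abel-zero N)) (ℚₚ.+-identityˡ _)))

-- For a convergent alternating series the two sums telescope to the first term. Here induction
-- applies because Δ commutes with the shift and lowers the degree.
abel-shift : ∀ N f → DegBelow N f → abel N f +ℚ abel N (λ m → f (suc m)) ≡ f 0
abel-shift zero    f d = sym (d 0)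
abel-shift (suc N) f d = trans (lemma₁ (f 0) (abel N (Δ f)) (f 1) (abel N (λ m → Δ f (suc m))))
  (trans (cong (λ t → ½ *ℚ ((f 0 +ℚ f 1) -ℚ t)) (abel-shift N (Δ f) d)) (lemma₂ (f 0) (f 1)))
  where
  lemma₁ : ∀ x a y b → ½ *ℚ (x -ℚ a) +ℚ ½ *ℚ (y -ℚ b) ≡ ½ *ℚ ((x +ℚ y) -ℚ (a +ℚ b))
  lemma₁ = solve-∀ ringℚ
  lemma₂ : ∀ x y → ½ *ℚ ((x +ℚ y) -ℚ (y -ℚ x)) ≡ x
  lemma₂ = solve-∀ ringℚ

deg-cong : ∀ d {f g} → (∀ m → f m ≡ g m) → DegBelow d f → DegBelow d g
deg-cong zero    e z m = trans (sym (e m)) (z m)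
deg-cong (suc d) e     = deg-cong d (λ m → cong₂ _-ℚ_ (e (suc m)) (e m))

deg-zero : ∀ d {f} → (∀ m → f m ≡ 0ℚ) → DegBelow d f
deg-zero zero    z = z
deg-zero (suc d) z = deg-zero d (λ m → cong₂ _-ℚ_ (z (suc m)) (z m))

deg-weaken : ∀ {d e} f → d ≤ e → DegBelow d f → DegBelow e f
deg-weaken {e = e} f z≤n z   = deg-zero e z
deg-weaken f (s≤s l) z = deg-weaken (Δ f) l z

deg-linear : ∀ d f c g → DegBelow d f → DegBelow d g → DegBelow d (λ m → f m +ℚ c *ℚ g m)
deg-linear zero f c g y z m = trans (cong₂ (λ u v → u +ℚ c *ℚ v) (y m) (z m)) (0+x*0 c)
deg-linear (suc d) f c g y z = deg-cong d (λ m → lemma (f (suc m)) c (g (suc m)) (f m) (g m)) (deg-linear d (Δ f) c (Δ g) y z)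
  where
  lemma : ∀ f c g f′ g′ → (f -ℚ f′) +ℚ c *ℚ (g -ℚ g′) ≡ (f +ℚ c *ℚ g) -ℚ (f′ +ℚ c *ℚ g′)
  lemma = solve-∀ ringℚ

deg-+ : ∀ d f g → DegBelow d f → DegBelow d g → DegBelow d (λ m → f m +ℚ g m)
deg-+ d f g y z = deg-cong d (λ m → cong (f m +ℚ_) (ℚₚ.*-identityˡ (g m))) (deg-linear d f 1ℚ g y z)

deg-suc : ∀ d f → DegBelow d f → DegBelow d (λ m → f (suc m))
deg-suc zero    f z m = z (suc m)
deg-suc (suc d) f z   = deg-suc d (Δ f) z

-- Discrete Leibniz rule: Δ(f g)(m) = Δf(m) g(m+1) + f(m) Δg(m).
deg-product : ∀ d e f g → DegBelow d f → DegBelow e g → DegBelow (d + e) (λ m → f m *ℚ g m)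
deg-product zero    e       f g y z = deg-zero e (λ m → trans (cong (_*ℚ g m) (y m)) (ℚₚ.*-zeroˡ (g m)))
deg-product (suc d) zero    f g y z = deg-zero (suc d + 0) (λ m → trans (cong (f m *ℚ_) (z m)) (ℚₚ.*-zeroʳ (f m)))
deg-product (suc d) (suc e) f g y z = deg-cong (d + suc e) (λ m → lemma (f (suc m)) (f m) (g (suc m)) (g m))
  (deg-+ (d + suc e) _ _ (deg-product d (suc e) (Δ f) (λ m → g (suc m)) y (deg-suc (suc e) g z))
    (subst (λ k → DegBelow k (λ m → f m *ℚ Δ g m)) (sym (ℕₚ.+-suc d e)) (deg-product (suc d) e f (Δ g) y z)))
  where
  lemma : ∀ f′ f g′ g → (f′ -ℚ f) *ℚ g′ +ℚ f *ℚ (g′ -ℚ g) ≡ f′ *ℚ g′ -ℚ f *ℚ g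
  lemma = solve-∀ ringℚ

-- By the recurrence Δ of the coefficient n + 1 is the sum of two shifts of the coefficient n, so
-- the degree grows by one.
deg-q : ∀ n → DegBelow (suc n) (λ m → q m n)
deg-q zero    m = refl
deg-q (suc n)   = deg-cong (suc n) (λ m → lemma (q (suc m) n) (q m (suc n)) (q m n))
  (deg-+ (suc n) (λ m → q (suc m) n) (λ m → q m n) (deg-suc (suc n) (λ m → q m n) (deg-q n)) (deg-q n))
  where
  lemma : ∀ x y z → x +ℚ z ≡ ((x +ℚ y) +ℚ z) -ℚ y
  lemma = solve-∀ ringℚ

deg-qShift : ∀ p k → DegBelow (suc k) (λ m → qShift m p k)
deg-qShift zero    k       = deg-q k
deg-qShift (suc p) zero    = deg-zero 1 (λ _ → refl)
deg-qShift (suc p) (suc k) = deg-weaken (λ m → qShift m p k) (ℕₚ.n≤1+n (suc k)) (deg-qShift p k)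

at : ℕ → List (ℕ → Row) → List Row
at m = map (λ ρ → ρ m)

DegRows : ℕ → ℕ → List (ℕ → Row) → Set
DegRows c K = All (λ ρ → ∀ n → n < c → DegBelow K (λ m → ρ m n))

deg-expand : ∀ c K L (G : ℕ → List Row → ℚ) → (∀ σs → DegRows (suc c) K σs → DegBelow L (λ m → G m (at m σs))) →
  ∀ ρs → DegRows (suc c) K ρs → DegBelow (K + L) (λ m → expand (G m) (at m ρs))
deg-expand c K L G h []       _        = deg-zero (K + L) (λ _ → refl)
deg-expand c K L G h (ρ ∷ ρs) (d ∷ ds) = deg-cong (K + L) (λ m → lemma (ρ m 0 *ℚ G m (at m ρs)) (expand (λ xs → G m (ρ m ∷ xs)) (at m ρs)))
  (deg-linear (K + L) (λ m → ρ m 0 *ℚ G m (at m ρs)) (-ℚ 1ℚ) (λ m → expand (λ xs → G m (ρ m ∷ xs)) (at m ρs))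
    (deg-product K L (λ m → ρ m 0) (λ m → G m (at m ρs)) (d 0 (s≤s z≤n)) (h ρs ds))
    (deg-expand c K L (λ m xs → G m (ρ m ∷ xs)) (λ σs e → h (ρ ∷ σs) (d ∷ e)) ρs ds))
  where
  lemma : ∀ x y → x +ℚ (-ℚ 1ℚ) *ℚ y ≡ x -ℚ y
  lemma = solve-∀ ringℚ

-- Each of the `c` expansions contributes one entry as a factor; the final 1 accounts for the
-- constant empty determinant.
deg-det : ∀ c K ρs → DegRows c K ρs → DegBelow (c * K + 1) (λ m → det c (at m ρs))
deg-det zero    K []       _ m = refl
deg-det zero    K (ρ ∷ ρs) _ m = refl
deg-det (suc c) K ρs ds = subst (λ k → DegBelow k (λ m → det (suc c) (at m ρs))) (sym (ℕₚ.+-assoc K (c * K) 1))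
  (deg-expand c K (c * K + 1) (λ m xs → det c (map tail xs))
    (λ σs e → deg-cong (c * K + 1) (λ m → cong (det c) (trans (sym (map-∘ σs)) (map-∘ σs)))
      (deg-det c K (map (λ ρ m → tail (ρ m)) σs) (tailed e)))
    ρs ds)
  where
  tailed : ∀ {σs} → DegRows (suc c) K σs → DegRows c K (map (λ ρ m → tail (ρ m)) σs)
  tailed []       = []
  tailed (e ∷ es) = (λ n n<c → e (suc n) (s≤s n<c)) ∷ tailed es

deg-F : ∀ p J a → All (_< J) a → DegBelow (p * (J + p) + 1) (λ m → F p m a)
deg-F p J a small = deg-cong (p * (J + p) + 1) (λ m → cong (det p) (sym (map-∘ a)))
  (deg-det p (J + p) (map (λ b m → row p m b) a) (rows small))
  where
  rows : ∀ {a} → All (_< J) a → DegRows p (J + p) (map (λ b m → row p m b) a)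
  rows []                    = []
  rows (_∷_ {b} b<J small) = (λ n n<p → deg-weaken (λ m → qShift m p (b + n)) (ℕₚ.+-mono-<-≤ b<J (ℕₚ.<⇒≤ n<p)) (deg-qShift p (b + n)))
    ∷ rows small

all-rem : ∀ {J} x {a} → All (_< J) a → All (_< J) (rem x a)
all-rem zero    []       = []
all-rem (suc x) []       = []
all-rem zero    (l ∷ ls) = ℕₚ.≤-<-trans ℕₚ.pred[n]≤n l ∷ ls
all-rem (suc x) (l ∷ ls) = l ∷ all-rem x ls

sum<⇒all< : ∀ {J} a → sum a < J → All (_< J) a
sum<⇒all< []       s = []
sum<⇒all< (a ∷ as) s = ℕₚ.≤-<-trans (ℕₚ.m≤m+n a (sum as)) s ∷ sum<⇒all< as (ℕₚ.≤-<-trans (ℕₚ.m≤n+m (sum as) a) s)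

deg-odds  : ∀ N J (φ : ℕ → Shape → ℚ) → (∀ a → All (_< J) a → DegBelow N (λ m → φ m a)) →
  ∀ x a → All (_< J) a → DegBelow N (λ m → odds (λ _ → φ m) x a)
deg-evens : ∀ N J (φ : ℕ → Shape → ℚ) → (∀ a → All (_< J) a → DegBelow N (λ m → φ m a)) →
  ∀ x a → All (_< J) a → DegBelow N (λ m → evens (λ _ → φ m) x a)
deg-odds N J φ d zero    a s = deg-zero N (λ _ → refl)
deg-odds N J φ d (suc x) a s = deg-+ N (λ m → odds (λ _ → φ m) x a) (λ m → φ m (rem x a) +ℚ evens (λ _ → φ m) x (rem x a))
  (deg-odds N J φ d x a s)
  (deg-+ N (λ m → φ m (rem x a)) (λ m → evens (λ _ → φ m) x (rem x a)) (d (rem x a) (all-rem x s)) (deg-evens N J φ d x (rem x a) (all-rem x s)))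
deg-evens N J φ d zero    a s = deg-zero N (λ _ → refl)
deg-evens N J φ d (suc x) a s = deg-+ N (λ m → evens (λ _ → φ m) x a) (λ m → odds (λ _ → φ m) x (rem x a))
  (deg-evens N J φ d x a s) (deg-odds N J φ d x (rem x a) (all-rem x s))

abel-odds  : ∀ N (φ : ℕ → Shape → ℚ) x a → abel N (λ m → odds (λ _ → φ m) x a) ≡ odds (λ _ a → abel N (λ m → φ m a)) x a
abel-evens : ∀ N (φ : ℕ → Shape → ℚ) x a → abel N (λ m → evens (λ _ → φ m) x a) ≡ evens (λ _ a → abel N (λ m → φ m a)) x a
abel-odds N φ zero    a = abel-zero N
abel-odds N φ (suc x) a = trans (abel-+ N (λ m → odds (λ _ → φ m) x a) (λ m → φ m (rem x a) +ℚ evens (λ _ → φ m) x (rem x a)))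
  (cong₂ _+ℚ_ (abel-odds N φ x a) (trans (abel-+ N (λ m → φ m (rem x a)) (λ m → evens (λ _ → φ m) x (rem x a)))
    (cong (abel N (λ m → φ m (rem x a)) +ℚ_) (abel-evens N φ x (rem x a)))))
abel-evens N φ zero    a = abel-zero N
abel-evens N φ (suc x) a = trans (abel-+ N (λ m → evens (λ _ → φ m) x a) (λ m → odds (λ _ → φ m) x (rem x a)))
  (cong₂ _+ℚ_ (abel-evens N φ x a) (abel-odds N φ x (rem x a)))

-- Twice the Abel sum of F satisfies the recurrence that characterises the signed count of words.
abel-F : ∀ p J a → sum a < J → length a ≡ p → Valid a →
  (1ℚ +ℚ 1ℚ) *ℚ abel (p * (J + p) + 1) (λ m → F p m a) ≡ δ p a +ℚ Alternating.signedWords p J a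
abel-F p J = Alternating.signedWords-unique p J (λ a → (1ℚ +ℚ 1ℚ) *ℚ AF a)
  (λ a f → trans (cong ((1ℚ +ℚ 1ℚ) *ℚ_) (trans (abel-cong N (λ m → F-flat p m a f)) (abel-zero N))) refl) eqn
  where
  N = p * (J + p) + 1
  AF : Shape → ℚ
  AF a = abel N (λ m → F p m a)
  side : ℚ → ℕ → Shape → ℚ
  side c m a = (F p m a +ℚ evens (λ _ → F p m) p a) +ℚ c *ℚ odds (λ _ → F p m) p a
  abel-side : ∀ c a → abel N (λ m → side c m a) ≡ (AF a +ℚ evens (λ _ → AF) p a) +ℚ c *ℚ odds (λ _ → AF) p a
  abel-side c a = trans (abel-linear N (λ m → F p m a +ℚ evens (λ _ → F p m) p a) c (λ m → odds (λ _ → F p m) p a))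
    (cong₂ (λ u v → u +ℚ c *ℚ v)
      (trans (abel-+ N (λ m → F p m a) (λ m → evens (λ _ → F p m) p a)) (cong (AF a +ℚ_) (abel-evens N (F p) p a)))
      (abel-odds N (F p) p a))
  deg-side : ∀ c a → All (_< J) a → DegBelow N (λ m → side c m a)
  deg-side c a s = deg-linear N (λ m → F p m a +ℚ evens (λ _ → F p m) p a) c (λ m → odds (λ _ → F p m) p a)
    (deg-+ N (λ m → F p m a) (λ m → evens (λ _ → F p m) p a) (deg-F p J a s) (deg-evens N J (F p) (deg-F p J) p a s))
    (deg-odds N J (F p) (deg-F p J) p a s)
  lemma : ∀ f e o → (1ℚ +ℚ 1ℚ) *ℚ f +ℚ (1ℚ +ℚ 1ℚ) *ℚ e ≡ ((f +ℚ e) +ℚ (-ℚ 1ℚ) *ℚ o) +ℚ ((f +ℚ e) +ℚ 1ℚ *ℚ o)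
  lemma = solve-∀ ringℚ
  minus : ∀ x y → x +ℚ (-ℚ 1ℚ) *ℚ y ≡ x -ℚ y
  minus = solve-∀ ringℚ
  eqn : ∀ a → sum a < J → length a ≡ p → Valid a →
    (1ℚ +ℚ 1ℚ) *ℚ AF a +ℚ evens (λ _ a → (1ℚ +ℚ 1ℚ) *ℚ AF a) p a ≡ (δ p a +ℚ evens (λ _ → δ p) p a) -ℚ odds (λ _ → δ p) p a
  eqn a s l v = begin
    (1ℚ +ℚ 1ℚ) *ℚ AF a +ℚ evens (λ _ a → (1ℚ +ℚ 1ℚ) *ℚ AF a) p a
      ≡⟨ cong ((1ℚ +ℚ 1ℚ) *ℚ AF a +ℚ_) (evens-* (1ℚ +ℚ 1ℚ) (λ _ → AF) p a) ⟩
    (1ℚ +ℚ 1ℚ) *ℚ AF a +ℚ (1ℚ +ℚ 1ℚ) *ℚ evens (λ _ → AF) p a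
      -- Adding the signed and the unsigned strip sum cancels the odd strips and doubles the rest;
      -- this is the origin of the factor 2.
      ≡⟨ lemma (AF a) (evens (λ _ → AF) p a) (odds (λ _ → AF) p a) ⟩
    _ ≡⟨ cong₂ _+ℚ_ (abel-side (-ℚ 1ℚ) a) (abel-side 1ℚ a) ⟨
    abel N (λ m → side (-ℚ 1ℚ) m a) +ℚ abel N (λ m → side 1ℚ m a)
      -- The unsigned sum at m becomes the signed sum at m + 1, so that only the term m = 0
      -- survives.
      ≡⟨ cong (abel N (λ m → side (-ℚ 1ℚ) m a) +ℚ_) (abel-cong N (λ m → F-step p m a l v)) ⟨
    abel N (λ m → side (-ℚ 1ℚ) m a) +ℚ abel N (λ m → side (-ℚ 1ℚ) (suc m) a)
      ≡⟨ abel-shift N (λ m → side (-ℚ 1ℚ) m a) (deg-side (-ℚ 1ℚ) a (sum<⇒all< a s)) ⟩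
    side (-ℚ 1ℚ) 0 a
      ≡⟨ minus (F p 0 a +ℚ evens (λ _ → F p 0) p a) (odds (λ _ → F p 0) p a) ⟩
    (F p 0 a +ℚ evens (λ _ → F p 0) p a) -ℚ odds (λ _ → F p 0) p a
      ≡⟨ cong₂ _-ℚ_ (cong₂ _+ℚ_ (F-zero-good p p a (inj₁ v)) (evens-cong (F-zero-good p) p a (inj₁ v))) (odds-cong (F-zero-good p) p a (inj₁ v)) ⟩
    (δ p a +ℚ evens (λ _ → δ p) p a) -ℚ odds (λ _ → δ p) p a ∎

-- Evaluation of the Hankel determinant

private
  ≃-ℕ : ∀ n → ℚᵘ._≃_ (ℚ.toℚᵘ (ℕtoℚ n)) (ℚᵘ.mkℚᵘ (+ n) 0)
  ≃-ℕ n = ℚₚ.toℚᵘ-fromℚᵘ (ℚᵘ.mkℚᵘ (+ n) 0)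

ℕtoℚ-+ : ∀ m n → ℕtoℚ (m + n) ≡ ℕtoℚ m +ℚ ℕtoℚ n
ℕtoℚ-+ m n = ℚₚ.toℚᵘ-injective (ℚᵘₚ.≃-trans (≃-ℕ (m + n)) (ℚᵘₚ.≃-trans (ℚᵘ.*≡* (cong₂ (λ x y → (x ℤ.+ y) ℤ.* ℤ.+ 1) (sym (ℤₚ.*-identityʳ (+ m))) (sym (ℤₚ.*-identityʳ (+ n)))))
  (ℚᵘₚ.≃-sym (ℚᵘₚ.≃-trans (ℚₚ.toℚᵘ-homo-+ (ℕtoℚ m) (ℕtoℚ n)) (ℚᵘₚ.+-cong (≃-ℕ m) (≃-ℕ n))))))

ℕtoℚ-* : ∀ m n → ℕtoℚ (m * n) ≡ ℕtoℚ m *ℚ ℕtoℚ n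
ℕtoℚ-* m n = ℚₚ.toℚᵘ-injective (ℚᵘₚ.≃-trans (≃-ℕ (m * n)) (ℚᵘₚ.≃-trans (ℚᵘ.*≡* (cong (ℤ._* ℤ.+ 1) (ℤₚ.pos-* m n)))
  (ℚᵘₚ.≃-sym (ℚᵘₚ.≃-trans (ℚₚ.toℚᵘ-homo-* (ℕtoℚ m) (ℕtoℚ n)) (ℚᵘₚ.*-cong (≃-ℕ m) (≃-ℕ n))))))

ℕtoℚ-inverse : ∀ n .{{_ : ℕ.NonZero n}} → ℕtoℚ n *ℚ (+ 1 / n) ≡ 1ℚ
ℕtoℚ-inverse (suc n) = ℚₚ.toℚᵘ-injective (ℚᵘₚ.≃-trans (ℚₚ.toℚᵘ-homo-* (ℕtoℚ (suc n)) (+ 1 / suc n))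
  (ℚᵘₚ.≃-trans (ℚᵘₚ.*-cong (≃-ℕ (suc n)) (ℚₚ.toℚᵘ-fromℚᵘ (ℚᵘ.mkℚᵘ (+ 1) n)))
    (ℚᵘ.*≡* (cong (λ k → + (suc k)) lemma))))
  where
  lemma : (n * 1) * 1 ≡ n + 0 * suc n + 0
  lemma = trans (ℕₚ.*-identityʳ (n * 1)) (trans (ℕₚ.*-identityʳ n) (sym (trans (ℕₚ.+-identityʳ (n + 0)) (ℕₚ.+-identityʳ n))))

ℕtoℚ-suc : ∀ n → ℕtoℚ (suc n) ≡ 1ℚ +ℚ ℕtoℚ n
ℕtoℚ-suc = ℕtoℚ-+ 1

2ℚ 3ℚ : ℚ
2ℚ = 1ℚ +ℚ 1ℚ
3ℚ = 1ℚ +ℚ 2ℚ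

-ℚ-cancel : ∀ x y → x -ℚ y ≡ 0ℚ → x ≡ y
-ℚ-cancel x y e = trans (lemma x y) (trans (cong (_+ℚ y) e) (ℚₚ.+-identityˡ y))
  where
  lemma : ∀ x y → x ≡ (x -ℚ y) +ℚ y
  lemma = solve-∀ ringℚ

ℕtoℚ-cancel : ∀ n x → ℕtoℚ (suc n) *ℚ x ≡ 0ℚ → x ≡ 0ℚ
ℕtoℚ-cancel n x e = begin
  x ≡⟨ ℚₚ.*-identityˡ x ⟨
  1ℚ *ℚ x ≡⟨ cong (_*ℚ x) (ℕtoℚ-inverse (suc n)) ⟨
  (ℕtoℚ (suc n) *ℚ (+ 1 / suc n)) *ℚ x ≡⟨ lemma (ℕtoℚ (suc n)) (+ 1 / suc n) x ⟩
  (+ 1 / suc n) *ℚ (ℕtoℚ (suc n) *ℚ x) ≡⟨ cong ((+ 1 / suc n) *ℚ_) e ⟩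
  (+ 1 / suc n) *ℚ 0ℚ ≡⟨ ℚₚ.*-zeroʳ (+ 1 / suc n) ⟩
  0ℚ ∎
  where
  lemma : ∀ a b x → (a *ℚ b) *ℚ x ≡ b *ℚ (a *ℚ x)
  lemma = solve-∀ ringℚ

q-one : ∀ m → q m 1 ≡ 2ℚ *ℚ ℕtoℚ m
q-one zero    = refl
q-one (suc m) = trans (cong (λ t → (1ℚ +ℚ t) +ℚ 1ℚ) (q-one m))
  (trans (lemma (ℕtoℚ m)) (cong (2ℚ *ℚ_) (sym (ℕtoℚ-suc m))))
  where
  lemma : ∀ x → (1ℚ +ℚ 2ℚ *ℚ x) +ℚ 1ℚ ≡ 2ℚ *ℚ (1ℚ +ℚ x)
  lemma = solve-∀ ringℚ

-- (1 − t²) Q′ = 2 m Q for Q = ((1 + t) / (1 − t))ᵐ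
q-recurrence : ∀ m n →
  (2ℚ +ℚ ℕtoℚ n) *ℚ q m (suc (suc n)) -ℚ (2ℚ *ℚ ℕtoℚ m *ℚ q m (suc n) +ℚ ℕtoℚ n *ℚ q m n) ≡ 0ℚ
q-recurrence zero zero    = refl
q-recurrence zero (suc n) = lemma (ℕtoℚ (suc n))
  where
  lemma : ∀ x → (2ℚ +ℚ x) *ℚ 0ℚ -ℚ (2ℚ *ℚ 0ℚ *ℚ 0ℚ +ℚ x *ℚ 0ℚ) ≡ 0ℚ
  lemma = solve-∀ ringℚ
q-recurrence (suc m) zero = begin
  (2ℚ +ℚ 0ℚ) *ℚ ((q (suc m) 1 +ℚ q m 2) +ℚ q m 1) -ℚ (2ℚ *ℚ ℕtoℚ (suc m) *ℚ q (suc m) 1 +ℚ 0ℚ *ℚ 1ℚ)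
    ≡⟨ cong (λ z → (2ℚ +ℚ 0ℚ) *ℚ ((q (suc m) 1 +ℚ q m 2) +ℚ q m 1) -ℚ (2ℚ *ℚ z *ℚ q (suc m) 1 +ℚ 0ℚ *ℚ 1ℚ)) (ℕtoℚ-suc m) ⟩
  _ ≡⟨ lemma (ℕtoℚ m) (q m 1) (q m 2) ⟩
  ((2ℚ +ℚ 0ℚ) *ℚ q m 2 -ℚ (2ℚ *ℚ ℕtoℚ m *ℚ q m 1 +ℚ 0ℚ *ℚ 1ℚ)) +ℚ 2ℚ *ℚ (q m 1 -ℚ 2ℚ *ℚ ℕtoℚ m)
    ≡⟨ cong₂ (λ u v → u +ℚ 2ℚ *ℚ (v -ℚ 2ℚ *ℚ ℕtoℚ m)) (q-recurrence m 0) (q-one m) ⟩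
  0ℚ +ℚ 2ℚ *ℚ (2ℚ *ℚ ℕtoℚ m -ℚ 2ℚ *ℚ ℕtoℚ m)
    ≡⟨ lemma′ (ℕtoℚ m) ⟩
  0ℚ ∎
  where
  lemma : ∀ z a b → (2ℚ +ℚ 0ℚ) *ℚ ((((1ℚ +ℚ a) +ℚ 1ℚ) +ℚ b) +ℚ a) -ℚ (2ℚ *ℚ (1ℚ +ℚ z) *ℚ ((1ℚ +ℚ a) +ℚ 1ℚ) +ℚ 0ℚ *ℚ 1ℚ)
    ≡ ((2ℚ +ℚ 0ℚ) *ℚ b -ℚ (2ℚ *ℚ z *ℚ a +ℚ 0ℚ *ℚ 1ℚ)) +ℚ 2ℚ *ℚ (a -ℚ 2ℚ *ℚ z)
  lemma = solve-∀ ringℚ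
  lemma′ : ∀ z → 0ℚ +ℚ 2ℚ *ℚ (2ℚ *ℚ z -ℚ 2ℚ *ℚ z) ≡ 0ℚ
  lemma′ = solve-∀ ringℚ
q-recurrence (suc m) (suc n) = begin
  (2ℚ +ℚ ℕtoℚ (suc n)) *ℚ q (suc m) (3 + n) -ℚ (2ℚ *ℚ ℕtoℚ (suc m) *ℚ q (suc m) (2 + n) +ℚ ℕtoℚ (suc n) *ℚ q (suc m) (1 + n))
    ≡⟨ cong₂ (λ y z → (2ℚ +ℚ y) *ℚ q (suc m) (3 + n) -ℚ (2ℚ *ℚ z *ℚ q (suc m) (2 + n) +ℚ y *ℚ q (suc m) (1 + n))) (ℕtoℚ-suc n) (ℕtoℚ-suc m) ⟩
  _ ≡⟨ lemma (ℕtoℚ m) (ℕtoℚ n) (q (suc m) n) (q m n) (q m (1 + n)) (q m (2 + n)) (q m (3 + n)) ⟩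
  _ ≡⟨ cong₂ (λ y z → ((2ℚ +ℚ ℕtoℚ n) *ℚ q (suc m) (2 + n) -ℚ (2ℚ *ℚ z *ℚ q (suc m) (1 + n) +ℚ ℕtoℚ n *ℚ q (suc m) n))
      +ℚ (((2ℚ +ℚ y) *ℚ q m (3 + n) -ℚ (2ℚ *ℚ ℕtoℚ m *ℚ q m (2 + n) +ℚ y *ℚ q m (1 + n)))
      +ℚ ((2ℚ +ℚ ℕtoℚ n) *ℚ q m (2 + n) -ℚ (2ℚ *ℚ ℕtoℚ m *ℚ q m (1 + n) +ℚ ℕtoℚ n *ℚ q m n)))) (ℕtoℚ-suc n) (ℕtoℚ-suc m) ⟨
  _ ≡⟨ cong₂ _+ℚ_ (q-recurrence (suc m) n) (cong₂ _+ℚ_ (q-recurrence m (suc n)) (q-recurrence m n)) ⟩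
  0ℚ ∎
  where
  lemma : ∀ m n x a b c d →
    let x₁ = (x +ℚ b) +ℚ a; x₂ = (x₁ +ℚ c) +ℚ b; x₃ = (x₂ +ℚ d) +ℚ c in
    (2ℚ +ℚ (1ℚ +ℚ n)) *ℚ x₃ -ℚ (2ℚ *ℚ (1ℚ +ℚ m) *ℚ x₂ +ℚ (1ℚ +ℚ n) *ℚ x₁)
    ≡ ((2ℚ +ℚ n) *ℚ x₂ -ℚ (2ℚ *ℚ (1ℚ +ℚ m) *ℚ x₁ +ℚ n *ℚ x))
      +ℚ (((2ℚ +ℚ (1ℚ +ℚ n)) *ℚ d -ℚ (2ℚ *ℚ m *ℚ c +ℚ (1ℚ +ℚ n) *ℚ b))
      +ℚ ((2ℚ +ℚ n) *ℚ c -ℚ (2ℚ *ℚ m *ℚ b +ℚ n *ℚ a)))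
  lemma = solve-∀ ringℚ

oddInv : ℕ → ℚ
oddInv k = + 1 / suc (k + k)

oddInv-inverse : ∀ k → (1ℚ +ℚ (ℕtoℚ k +ℚ ℕtoℚ k)) *ℚ oddInv k ≡ 1ℚ
oddInv-inverse k = trans (cong (_*ℚ oddInv k) (trans (cong (1ℚ +ℚ_) (sym (ℕtoℚ-+ k k))) (sym (ℕtoℚ-suc (k + k))))) (ℕtoℚ-inverse (suc (k + k)))

swap : ∀ g → Linear g → Alternate g → ∀ r s post → g (r ∷ s ∷ post) ≡ 0ℚ -ℚ g (s ∷ r ∷ post)
swap g lin alt r s post = -ℚ-cancel _ _ (begin
  g (r ∷ s ∷ post) -ℚ (0ℚ -ℚ g (s ∷ r ∷ post))
    ≡⟨ lemma (g (r ∷ s ∷ post)) (g (s ∷ r ∷ post)) ⟩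
  (0ℚ +ℚ 1ℚ *ℚ g (r ∷ s ∷ post)) +ℚ 1ℚ *ℚ (g (s ∷ r ∷ post) +ℚ 1ℚ *ℚ 0ℚ)
    ≡⟨ cong₂ (λ x y → (x +ℚ 1ℚ *ℚ g (r ∷ s ∷ post)) +ℚ 1ℚ *ℚ (g (s ∷ r ∷ post) +ℚ 1ℚ *ℚ y)) (sym (alt [] r post)) (sym (alt [] s post)) ⟩
  _ ≡⟨ cong₂ (λ x y → x +ℚ 1ℚ *ℚ y) (lin (r ∷ []) r 1ℚ s post) (lin (s ∷ []) r 1ℚ s post) ⟨
  g (r ∷ u ∷ post) +ℚ 1ℚ *ℚ g (s ∷ u ∷ post)
    ≡⟨ lin [] r 1ℚ s (u ∷ post) ⟨
  g (u ∷ u ∷ post)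
    ≡⟨ alt [] u post ⟩
  0ℚ ∎)
  where
  u = r ⊞ 1ℚ · s
  lemma : ∀ x y → x -ℚ (0ℚ -ℚ y) ≡ (0ℚ +ℚ 1ℚ *ℚ x) +ℚ 1ℚ *ℚ (y +ℚ 1ℚ *ℚ 0ℚ)
  lemma = solve-∀ ringℚ

squareShape : ℕ → Shape
squareShape p = map (_+_ p) (stair p)

module Hankel (m : ℕ) where

  z : ℚ
  z = ℕtoℚ m

  -- β k is the coefficient ((k+1)² − z²) / (4(k+1)² − 1) of the continued fraction of ((1 + t) / (1 − t))ᶻ.
  βnum β : ℕ → ℚ
  βnum k = ℕtoℚ (suc k) *ℚ ℕtoℚ (suc k) -ℚ z *ℚ z
  β k = βnum k *ℚ (oddInv k *ℚ oddInv (suc k))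

  -- The compatibility condition required by `down-step`. Together with 3 β₀ = 1 - z² it determines
  -- all the coefficients.
  β-step : ∀ k → 1ℚ +ℚ (1ℚ +ℚ (ℕtoℚ k +ℚ ℕtoℚ k)) *ℚ β k ≡ (3ℚ +ℚ (ℕtoℚ (suc k) +ℚ ℕtoℚ (suc k))) *ℚ β (suc k)
  β-step k = begin
    1ℚ +ℚ (1ℚ +ℚ (κ +ℚ κ)) *ℚ (βnum k *ℚ (a *ℚ b))
      ≡⟨ lemma₁ κ (βnum k) a b ⟩
    1ℚ +ℚ βnum k *ℚ (((1ℚ +ℚ (κ +ℚ κ)) *ℚ a) *ℚ b)
      ≡⟨ cong (λ t → 1ℚ +ℚ βnum k *ℚ (t *ℚ b)) (oddInv-inverse k) ⟩
    1ℚ +ℚ βnum k *ℚ (1ℚ *ℚ b)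
      ≡⟨ cong₂ (λ s t → s +ℚ (t *ℚ t -ℚ z *ℚ z) *ℚ (1ℚ *ℚ b)) (trans (sym (oddInv-inverse (suc k))) (cong (λ t → (1ℚ +ℚ (t +ℚ t)) *ℚ b) (ℕtoℚ-suc k))) (ℕtoℚ-suc k) ⟩
    (1ℚ +ℚ ((1ℚ +ℚ κ) +ℚ (1ℚ +ℚ κ))) *ℚ b +ℚ ((1ℚ +ℚ κ) *ℚ (1ℚ +ℚ κ) -ℚ z *ℚ z) *ℚ (1ℚ *ℚ b)
      ≡⟨ lemma₂ κ z b ⟩
    1ℚ *ℚ (((2ℚ +ℚ κ) *ℚ (2ℚ +ℚ κ) -ℚ z *ℚ z) *ℚ b)
      ≡⟨ cong₂ (λ s t → s *ℚ ((t *ℚ t -ℚ z *ℚ z) *ℚ b)) (sym (oddInv-inverse (suc (suc k)))) 2+κ ⟩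
    ((1ℚ +ℚ (ℕtoℚ (suc (suc k)) +ℚ ℕtoℚ (suc (suc k)))) *ℚ c) *ℚ (βnum (suc k) *ℚ b)
      ≡⟨ cong (λ t → ((1ℚ +ℚ (t +ℚ t)) *ℚ c) *ℚ (βnum (suc k) *ℚ b)) (ℕtoℚ-suc (suc k)) ⟩
    _ ≡⟨ lemma₃ (ℕtoℚ (suc k)) c (βnum (suc k)) b ⟩
    (3ℚ +ℚ (ℕtoℚ (suc k) +ℚ ℕtoℚ (suc k))) *ℚ β (suc k) ∎
    where
    κ = ℕtoℚ k
    a = oddInv k
    b = oddInv (suc k)
    c = oddInv (suc (suc k))
    2+κ : 2ℚ +ℚ κ ≡ ℕtoℚ (suc (suc k))
    2+κ = trans (ℚₚ.+-assoc 1ℚ 1ℚ κ) (trans (cong (1ℚ +ℚ_) (sym (ℕtoℚ-suc k))) (sym (ℕtoℚ-suc (suc k))))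
    lemma₁ : ∀ κ n a b → 1ℚ +ℚ (1ℚ +ℚ (κ +ℚ κ)) *ℚ (n *ℚ (a *ℚ b)) ≡ 1ℚ +ℚ n *ℚ (((1ℚ +ℚ (κ +ℚ κ)) *ℚ a) *ℚ b)
    lemma₁ = solve-∀ ringℚ
    lemma₂ : ∀ κ z b → (1ℚ +ℚ ((1ℚ +ℚ κ) +ℚ (1ℚ +ℚ κ))) *ℚ b +ℚ ((1ℚ +ℚ κ) *ℚ (1ℚ +ℚ κ) -ℚ z *ℚ z) *ℚ (1ℚ *ℚ b)
      ≡ 1ℚ *ℚ (((2ℚ +ℚ κ) *ℚ (2ℚ +ℚ κ) -ℚ z *ℚ z) *ℚ b)
    lemma₂ = solve-∀ ringℚ
    lemma₃ : ∀ κ c n b → ((1ℚ +ℚ ((1ℚ +ℚ κ) +ℚ (1ℚ +ℚ κ))) *ℚ c) *ℚ (n *ℚ b) ≡ (3ℚ +ℚ (κ +ℚ κ)) *ℚ (n *ℚ (b *ℚ c))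
    lemma₃ = solve-∀ ringℚ

  -- Let L be the functional on polynomials with moments q₁, q₂, .... Then `R k n` is L(xⁿ Pₖ) for
  -- the monic orthogonal polynomials P₀ = 1, P₁ = x - z, Pₖ₊₂ = x Pₖ₊₁ - βₖ Pₖ.
  R : ℕ → Row
  R zero          n = q m (suc n)
  R (suc zero)    n = R 0 (suc n) -ℚ z *ℚ R 0 n
  R (suc (suc k)) n = R (suc k) (suc n) -ℚ β k *ℚ R k n

  -- Contiguous relations that descend from (1 - t²) Q′ = 2 m Q: `Down` ties `R (suc k)` to the
  -- lower index and `Up` ties `R k` to the higher one. At n = 0 the term with `pred n` carries the
  -- factor 0.
  Down Up : ℕ → Set
  Down k = ∀ n → (3ℚ +ℚ (ℕtoℚ n +ℚ ℕtoℚ k)) *ℚ R (suc k) (suc n)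
    -ℚ (z *ℚ R (suc k) n +ℚ (ℕtoℚ n *ℚ R (suc k) (pred n) +ℚ (3ℚ +ℚ (ℕtoℚ k +ℚ ℕtoℚ k)) *ℚ β k *ℚ R k n)) ≡ 0ℚ
  Up k = ∀ n → (1ℚ +ℚ ℕtoℚ n -ℚ ℕtoℚ k) *ℚ R k (suc n)
    -ℚ (z *ℚ R k n +ℚ (ℕtoℚ n *ℚ R k (pred n) -ℚ (1ℚ +ℚ (ℕtoℚ k +ℚ ℕtoℚ k)) *ℚ R (suc k) n)) ≡ 0ℚ

  shift-pred : (X : Row) → ∀ n → ℕtoℚ n *ℚ X (suc (pred n)) ≡ ℕtoℚ n *ℚ X n
  shift-pred X zero    = trans (ℚₚ.*-zeroˡ (X 1)) (sym (ℚₚ.*-zeroˡ (X 0)))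
  shift-pred X (suc n) = refl

  up-zero : Up 0
  up-zero n = begin
    (1ℚ +ℚ ν -ℚ 0ℚ) *ℚ c -ℚ (z *ℚ b +ℚ (ν *ℚ q m (suc (pred n)) -ℚ (1ℚ +ℚ (0ℚ +ℚ 0ℚ)) *ℚ (c -ℚ z *ℚ b)))
      ≡⟨ cong (λ t → (1ℚ +ℚ ν -ℚ 0ℚ) *ℚ c -ℚ (z *ℚ b +ℚ (t -ℚ (1ℚ +ℚ (0ℚ +ℚ 0ℚ)) *ℚ (c -ℚ z *ℚ b)))) (shift-pred (q m) n) ⟩
    (1ℚ +ℚ ν -ℚ 0ℚ) *ℚ c -ℚ (z *ℚ b +ℚ (ν *ℚ q m n -ℚ (1ℚ +ℚ (0ℚ +ℚ 0ℚ)) *ℚ (c -ℚ z *ℚ b)))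
      ≡⟨ lemma ν z (q m n) b c ⟩
    (2ℚ +ℚ ν) *ℚ c -ℚ (2ℚ *ℚ z *ℚ b +ℚ ν *ℚ q m n)
      ≡⟨ q-recurrence m n ⟩
    0ℚ ∎
    where
    ν = ℕtoℚ n
    b = q m (suc n)
    c = q m (suc (suc n))
    lemma : ∀ ν z a b c → (1ℚ +ℚ ν -ℚ 0ℚ) *ℚ c -ℚ (z *ℚ b +ℚ (ν *ℚ a -ℚ (1ℚ +ℚ (0ℚ +ℚ 0ℚ)) *ℚ (c -ℚ z *ℚ b)))
      ≡ (2ℚ +ℚ ν) *ℚ c -ℚ (2ℚ *ℚ z *ℚ b +ℚ ν *ℚ a)
    lemma = solve-∀ ringℚ

  down-zero : Down 0
  down-zero n = begin
    (3ℚ +ℚ (ν +ℚ 0ℚ)) *ℚ (d -ℚ z *ℚ c) -ℚ (z *ℚ (c -ℚ z *ℚ b) +ℚ (ν *ℚ (q m (2 + pred n) -ℚ z *ℚ q m (suc (pred n))) +ℚ (3ℚ +ℚ (0ℚ +ℚ 0ℚ)) *ℚ β 0 *ℚ b))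
      ≡⟨ cong (λ t → (3ℚ +ℚ (ν +ℚ 0ℚ)) *ℚ (d -ℚ z *ℚ c) -ℚ (z *ℚ (c -ℚ z *ℚ b) +ℚ (t +ℚ (3ℚ +ℚ (0ℚ +ℚ 0ℚ)) *ℚ β 0 *ℚ b)))
           (shift-pred (λ k → q m (suc k) -ℚ z *ℚ q m k) n) ⟩
    (3ℚ +ℚ (ν +ℚ 0ℚ)) *ℚ (d -ℚ z *ℚ c) -ℚ (z *ℚ (c -ℚ z *ℚ b) +ℚ (ν *ℚ (b -ℚ z *ℚ a) +ℚ (3ℚ +ℚ (0ℚ +ℚ 0ℚ)) *ℚ β 0 *ℚ b))
      ≡⟨ lemma ν z a b c d ⟩
    ((2ℚ +ℚ (1ℚ +ℚ ν)) *ℚ d -ℚ (2ℚ *ℚ z *ℚ c +ℚ (1ℚ +ℚ ν) *ℚ b)) -ℚ z *ℚ ((2ℚ +ℚ ν) *ℚ c -ℚ (2ℚ *ℚ z *ℚ b +ℚ ν *ℚ a))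
      ≡⟨ cong₂ (λ s t → s -ℚ z *ℚ t) (trans (cong (λ s → (2ℚ +ℚ s) *ℚ d -ℚ (2ℚ *ℚ z *ℚ c +ℚ s *ℚ b)) (sym (ℕtoℚ-suc n))) (q-recurrence m (suc n))) (q-recurrence m n) ⟩
    0ℚ -ℚ z *ℚ 0ℚ
      ≡⟨ 0-x*0 z ⟩
    0ℚ ∎
    where
    ν = ℕtoℚ n
    a = q m n
    b = q m (1 + n)
    c = q m (2 + n)
    d = q m (3 + n)
    lemma : ∀ ν z a b c d →
      (3ℚ +ℚ (ν +ℚ 0ℚ)) *ℚ (d -ℚ z *ℚ c) -ℚ (z *ℚ (c -ℚ z *ℚ b) +ℚ (ν *ℚ (b -ℚ z *ℚ a) +ℚ (3ℚ +ℚ (0ℚ +ℚ 0ℚ)) *ℚ ((1ℚ *ℚ 1ℚ -ℚ z *ℚ z) *ℚ (1ℚ *ℚ (+ 1 / 3))) *ℚ b))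
      ≡ ((2ℚ +ℚ (1ℚ +ℚ ν)) *ℚ d -ℚ (2ℚ *ℚ z *ℚ c +ℚ (1ℚ +ℚ ν) *ℚ b)) -ℚ z *ℚ ((2ℚ +ℚ ν) *ℚ c -ℚ (2ℚ *ℚ z *ℚ b +ℚ ν *ℚ a))
    lemma = solve-∀ ringℚ

  -- Inserting the three-term recurrence for `R (suc (suc k))` turns the claim into `Down k`.
  up-step : ∀ k → Down k → Up (suc k)
  up-step k down n = trans
    (cong (λ s → (1ℚ +ℚ ν -ℚ s) *ℚ R (suc k) (suc n) -ℚ (z *ℚ R (suc k) n +ℚ (ν *ℚ R (suc k) (pred n) -ℚ (1ℚ +ℚ (s +ℚ s)) *ℚ R (suc (suc k)) n))) (ℕtoℚ-suc k))
    (trans (lemma ν (ℕtoℚ k) z (R (suc k) (suc n)) (R (suc k) n) (ν *ℚ R (suc k) (pred n)) (β k) (R k n)) (down n))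
    where
    ν = ℕtoℚ n
    lemma : ∀ ν κ z a′ a x β b → (1ℚ +ℚ ν -ℚ (1ℚ +ℚ κ)) *ℚ a′ -ℚ (z *ℚ a +ℚ (x -ℚ (1ℚ +ℚ ((1ℚ +ℚ κ) +ℚ (1ℚ +ℚ κ))) *ℚ (a′ -ℚ β *ℚ b)))
      ≡ (3ℚ +ℚ (ν +ℚ κ)) *ℚ a′ -ℚ (z *ℚ a +ℚ (x +ℚ (3ℚ +ℚ (κ +ℚ κ)) *ℚ β *ℚ b))
    lemma = solve-∀ ringℚ

  -- Up to `β-step`, the claim at `n` is `Down k` at `suc n` minus `β k` times `Up k` at `n`.
  down-step : ∀ k → Down k → Up k → Down (suc k)
  down-step k down up n = begin
    (3ℚ +ℚ (ν +ℚ ℕtoℚ (suc k))) *ℚ (a₂ -ℚ β k *ℚ b₁) -ℚ (z *ℚ (a₁ -ℚ β k *ℚ b) +ℚ (ν *ℚ (A (suc (pred n)) -ℚ β k *ℚ b₋) +ℚ (3ℚ +ℚ (ℕtoℚ (suc k) +ℚ ℕtoℚ (suc k))) *ℚ β (suc k) *ℚ a))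
      ≡⟨ cong₂ (λ s t → (3ℚ +ℚ (ν +ℚ s)) *ℚ (a₂ -ℚ β k *ℚ b₁) -ℚ (z *ℚ (a₁ -ℚ β k *ℚ b) +ℚ (ν *ℚ (A (suc (pred n)) -ℚ β k *ℚ b₋) +ℚ t *ℚ a))) (ℕtoℚ-suc k) (sym (β-step k)) ⟩
    _ ≡⟨ lemma₀ (3ℚ +ℚ (ν +ℚ (1ℚ +ℚ κ))) a₂ (β k) b₁ z a₁ b ν (A (suc (pred n))) b₋ (1ℚ +ℚ (1ℚ +ℚ (κ +ℚ κ)) *ℚ β k) a ⟩
    _ ≡⟨ cong (λ t → (3ℚ +ℚ (ν +ℚ (1ℚ +ℚ κ))) *ℚ (a₂ -ℚ β k *ℚ b₁) -ℚ (z *ℚ (a₁ -ℚ β k *ℚ b) +ℚ ((t -ℚ β k *ℚ (ν *ℚ b₋)) +ℚ (1ℚ +ℚ (1ℚ +ℚ (κ +ℚ κ)) *ℚ β k) *ℚ a))) (shift-pred A n) ⟩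
    _ ≡⟨ lemma ν κ z (β k) a a₁ a₂ b b₁ (ν *ℚ b₋) ⟩
    ((3ℚ +ℚ ((1ℚ +ℚ ν) +ℚ κ)) *ℚ a₂ -ℚ (z *ℚ a₁ +ℚ ((1ℚ +ℚ ν) *ℚ a +ℚ (3ℚ +ℚ (κ +ℚ κ)) *ℚ β k *ℚ b₁)))
      -ℚ β k *ℚ ((1ℚ +ℚ ν -ℚ κ) *ℚ b₁ -ℚ (z *ℚ b +ℚ (ν *ℚ b₋ -ℚ (1ℚ +ℚ (κ +ℚ κ)) *ℚ a)))
      ≡⟨ cong₂ (λ s t → s -ℚ β k *ℚ t) (trans (cong (λ s → (3ℚ +ℚ (s +ℚ κ)) *ℚ a₂ -ℚ (z *ℚ a₁ +ℚ (s *ℚ a +ℚ (3ℚ +ℚ (κ +ℚ κ)) *ℚ β k *ℚ b₁))) (sym (ℕtoℚ-suc n))) (down (suc n))) (up n) ⟩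
    0ℚ -ℚ β k *ℚ 0ℚ
      ≡⟨ 0-x*0 (β k) ⟩
    0ℚ ∎
    where
    ν = ℕtoℚ n
    κ = ℕtoℚ k
    A B : Row
    A = R (suc k)
    B = R k
    a = A n
    a₁ = A (suc n)
    a₂ = A (suc (suc n))
    b = B n
    b₁ = B (suc n)
    b₋ = B (pred n)
    lemma₀ : ∀ s a₂ β b₁ z a₁ b ν x b₋ t a → s *ℚ (a₂ -ℚ β *ℚ b₁) -ℚ (z *ℚ (a₁ -ℚ β *ℚ b) +ℚ (ν *ℚ (x -ℚ β *ℚ b₋) +ℚ t *ℚ a))
      ≡ s *ℚ (a₂ -ℚ β *ℚ b₁) -ℚ (z *ℚ (a₁ -ℚ β *ℚ b) +ℚ ((ν *ℚ x -ℚ β *ℚ (ν *ℚ b₋)) +ℚ t *ℚ a))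
    lemma₀ = solve-∀ ringℚ
    lemma : ∀ ν κ z β a a₁ a₂ b b₁ y →
      (3ℚ +ℚ (ν +ℚ (1ℚ +ℚ κ))) *ℚ (a₂ -ℚ β *ℚ b₁) -ℚ (z *ℚ (a₁ -ℚ β *ℚ b) +ℚ ((ν *ℚ a -ℚ β *ℚ y) +ℚ (1ℚ +ℚ (1ℚ +ℚ (κ +ℚ κ)) *ℚ β) *ℚ a))
      ≡ ((3ℚ +ℚ ((1ℚ +ℚ ν) +ℚ κ)) *ℚ a₂ -ℚ (z *ℚ a₁ +ℚ ((1ℚ +ℚ ν) *ℚ a +ℚ (3ℚ +ℚ (κ +ℚ κ)) *ℚ β *ℚ b₁)))
        -ℚ β *ℚ ((1ℚ +ℚ ν -ℚ κ) *ℚ b₁ -ℚ (z *ℚ b +ℚ (y -ℚ (1ℚ +ℚ (κ +ℚ κ)) *ℚ a)))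
    lemma = solve-∀ ringℚ

  down-up : ∀ k → Down k × Up k
  down-up zero    = down-zero , up-zero
  down-up (suc k) = let d , u = down-up k in down-step k d u , up-step k d

  3+n+k : ∀ n k → 3ℚ +ℚ (ℕtoℚ n +ℚ ℕtoℚ k) ≡ ℕtoℚ (3 + (n + k))
  3+n+k n k = sym (trans (ℕtoℚ-+ 3 (n + k)) (cong (3ℚ +ℚ_) (ℕtoℚ-+ n k)))

  -- Orthogonality. `Down` expresses an entry through two earlier entries of its row and one entry
  -- of the preceding row, all left of the diagonal; its leading factor 3 + n + k is a positive
  -- integer and cancels. Column 0 combines `Down` at 0 with the three-term recurrence.
  R-vanish : ∀ k n → n < k → R k n ≡ 0ℚ
  pred-vanish : ∀ k n → n < k → ℕtoℚ n *ℚ R k (pred n) ≡ 0ℚ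
  pred-vanish k zero    n<k = ℚₚ.*-zeroˡ (R k 0)
  pred-vanish k (suc n) n<k = trans (cong (ℕtoℚ (suc n) *ℚ_) (R-vanish k n (ℕₚ.<⇒≤ n<k))) (ℚₚ.*-zeroʳ (ℕtoℚ (suc n)))
  R-vanish (suc k) (suc n) (s≤s n<k) = ℕtoℚ-cancel (2 + (n + k)) _ (trans (cong (_*ℚ R (suc k) (suc n)) (sym (3+n+k n k)))
    (trans (-ℚ-cancel _ _ (proj₁ (down-up k) n))
    (trans (cong₂ (λ x y → z *ℚ x +ℚ y) (R-vanish (suc k) n (ℕₚ.m<n⇒m<1+n n<k))
        (cong₂ (λ x y → x +ℚ (3ℚ +ℚ (ℕtoℚ k +ℚ ℕtoℚ k)) *ℚ β k *ℚ y) (pred-vanish (suc k) n (ℕₚ.m<n⇒m<1+n n<k)) (R-vanish k n n<k)))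
      (lemma z ((3ℚ +ℚ (ℕtoℚ k +ℚ ℕtoℚ k)) *ℚ β k)))))
    where
    lemma : ∀ z b → z *ℚ 0ℚ +ℚ (0ℚ +ℚ b *ℚ 0ℚ) ≡ 0ℚ
    lemma = solve-∀ ringℚ
  R-vanish (suc zero) zero _ = ℕtoℚ-cancel 1 _ (trans (lemma z (q m 1) (q m 2)) (q-recurrence m 0))
    where
    lemma : ∀ z a b → 2ℚ *ℚ (b -ℚ z *ℚ a) ≡ (2ℚ +ℚ 0ℚ) *ℚ b -ℚ (2ℚ *ℚ z *ℚ a +ℚ 0ℚ *ℚ 1ℚ)
    lemma = solve-∀ ringℚ
  R-vanish (suc (suc k)) zero _ = ℕtoℚ-cancel (2 + k) _ (begin
    ℕtoℚ (3 + k) *ℚ (R (suc k) 1 -ℚ β k *ℚ R k 0)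
      ≡⟨ cong (_*ℚ (R (suc k) 1 -ℚ β k *ℚ R k 0)) (sym (3+n+k 0 k)) ⟩
    (3ℚ +ℚ (0ℚ +ℚ ℕtoℚ k)) *ℚ (R (suc k) 1 -ℚ β k *ℚ R k 0)
      ≡⟨ lemma (ℕtoℚ k) (R (suc k) 1) (β k) (R k 0) z (R (suc k) 0) ⟩
    ((3ℚ +ℚ (0ℚ +ℚ ℕtoℚ k)) *ℚ R (suc k) 1 -ℚ (z *ℚ R (suc k) 0 +ℚ (0ℚ *ℚ R (suc k) 0 +ℚ (3ℚ +ℚ (ℕtoℚ k +ℚ ℕtoℚ k)) *ℚ β k *ℚ R k 0)))
      +ℚ (z *ℚ R (suc k) 0 +ℚ β k *ℚ (ℕtoℚ k *ℚ R k 0))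
      ≡⟨ cong₂ _+ℚ_ (proj₁ (down-up k) 0) (cong₂ (λ x y → z *ℚ x +ℚ β k *ℚ y) (R-vanish (suc k) zero (s≤s z≤n)) (k-vanish k)) ⟩
    0ℚ +ℚ (z *ℚ 0ℚ +ℚ β k *ℚ 0ℚ)
      ≡⟨ lemma′ z (β k) ⟩
    0ℚ ∎)
    where
    k-vanish : ∀ k → ℕtoℚ k *ℚ R k 0 ≡ 0ℚ
    k-vanish zero    = ℚₚ.*-zeroˡ (R 0 0)
    k-vanish (suc k) = trans (cong (ℕtoℚ (suc k) *ℚ_) (R-vanish (suc k) zero (s≤s z≤n))) (ℚₚ.*-zeroʳ (ℕtoℚ (suc k)))
    lemma : ∀ κ a β b z a₀ → (3ℚ +ℚ (0ℚ +ℚ κ)) *ℚ (a -ℚ β *ℚ b)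
      ≡ ((3ℚ +ℚ (0ℚ +ℚ κ)) *ℚ a -ℚ (z *ℚ a₀ +ℚ (0ℚ *ℚ a₀ +ℚ (3ℚ +ℚ (κ +ℚ κ)) *ℚ β *ℚ b))) +ℚ (z *ℚ a₀ +ℚ β *ℚ (κ *ℚ b))
    lemma = solve-∀ ringℚ
    lemma′ : ∀ z b → 0ℚ +ℚ (z *ℚ 0ℚ +ℚ b *ℚ 0ℚ) ≡ 0ℚ
    lemma′ = solve-∀ ringℚ

  -- In `Down k` at `n = k` orthogonality leaves only the last term, and both sides carry the factor
  -- 3 + 2k.
  R-diagonal : ∀ k → R (suc k) (suc k) ≡ β k *ℚ R k k
  R-diagonal k = -ℚ-cancel _ _ (ℕtoℚ-cancel (2 + (k + k)) _ (begin
    ℕtoℚ (3 + (k + k)) *ℚ (R (suc k) (suc k) -ℚ β k *ℚ R k k)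
      ≡⟨ cong (_*ℚ (R (suc k) (suc k) -ℚ β k *ℚ R k k)) (sym (3+n+k k k)) ⟩
    (3ℚ +ℚ (κ +ℚ κ)) *ℚ (R (suc k) (suc k) -ℚ β k *ℚ R k k)
      ≡⟨ lemma κ (R (suc k) (suc k)) (β k) (R k k) z (R (suc k) k) (κ *ℚ R (suc k) (pred k)) ⟩
    ((3ℚ +ℚ (κ +ℚ κ)) *ℚ R (suc k) (suc k) -ℚ (z *ℚ R (suc k) k +ℚ (κ *ℚ R (suc k) (pred k) +ℚ (3ℚ +ℚ (κ +ℚ κ)) *ℚ β k *ℚ R k k)))
      +ℚ (z *ℚ R (suc k) k +ℚ κ *ℚ R (suc k) (pred k))
      ≡⟨ cong₂ _+ℚ_ (proj₁ (down-up k) k) (cong₂ (λ x y → z *ℚ x +ℚ κ *ℚ y) (R-vanish (suc k) k ℕₚ.≤-refl) (R-vanish (suc k) (pred k) (s≤s ℕₚ.pred[n]≤n))) ⟩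
    0ℚ +ℚ (z *ℚ 0ℚ +ℚ κ *ℚ 0ℚ)
      ≡⟨ lemma′ z κ ⟩
    0ℚ ∎))
    where
    κ = ℕtoℚ k
    lemma : ∀ κ a β b z x y → (3ℚ +ℚ (κ +ℚ κ)) *ℚ (a -ℚ β *ℚ b)
      ≡ ((3ℚ +ℚ (κ +ℚ κ)) *ℚ a -ℚ (z *ℚ x +ℚ (y +ℚ (3ℚ +ℚ (κ +ℚ κ)) *ℚ β *ℚ b))) +ℚ (z *ℚ x +ℚ y)
    lemma = solve-∀ ringℚ
    lemma′ : ∀ z b → 0ℚ +ℚ (z *ℚ 0ℚ +ℚ b *ℚ 0ℚ) ≡ 0ℚ
    lemma′ = solve-∀ ringℚ

  v : ℕ → Row
  v i n = q m (i + n)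

  v-suc : ∀ i n → v i (suc n) ≡ v (suc i) n
  v-suc i n = cong (q m) (ℕₚ.+-suc i n)

  -- Linear combinations of the Hankel rows v 1, ..., v k, recorded up to pointwise equality because
  -- rows are functions.
  data Span (k : ℕ) : Row → Set where
    null : ∀ {s} → (∀ n → s n ≡ 0ℚ) → Span k s
    plus : ∀ {s t} c i → i < k → Span k s → (∀ n → t n ≡ s n +ℚ c *ℚ v (suc i) n) → Span k t

  span-linear : ∀ {k s t} c → Span k s → Span k t → Span k (s ⊞ c · t)
  span-linear {s = s} c (null z) (null y) = null (λ n → trans (cong₂ (λ a b → a +ℚ c *ℚ b) (z n) (y n)) (0+x*0 c))
  span-linear {s = s} {t} c (plus {s₀} d i i<k p e) (null y) = plus d i i<k (span-linear c p (null y))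
    (λ n → trans (cong (_+ℚ c *ℚ t n) (e n)) (lemma (s₀ n) (d *ℚ v (suc i) n) (c *ℚ t n)))
    where
    lemma : ∀ a b c → (a +ℚ b) +ℚ c ≡ (a +ℚ c) +ℚ b
    lemma = solve-∀ ringℚ
  span-linear {s = s} c p (plus {t₀} d i i<k r e) = plus (c *ℚ d) i i<k (span-linear c p r)
    (λ n → trans (cong (λ x → s n +ℚ c *ℚ x) (e n)) (lemma (s n) c (t₀ n) d (v (suc i) n)))
    where
    lemma : ∀ s c t d x → s +ℚ c *ℚ (t +ℚ d *ℚ x) ≡ (s +ℚ c *ℚ t) +ℚ (c *ℚ d) *ℚ x
    lemma = solve-∀ ringℚ

  span-weaken : ∀ {k s} → Span k s → Span (suc k) s
  span-weaken (null z)           = null z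
  span-weaken (plus c i i<k p e) = plus c i (ℕₚ.m<n⇒m<1+n i<k) (span-weaken p) e

  span-shift : ∀ {k s} → Span k s → Span (suc k) (tail s)
  span-shift (null z)                = null (λ n → z (suc n))
  span-shift (plus {s} c i i<k p e) = plus c (suc i) (s≤s i<k) (span-shift p)
    (λ n → trans (e (suc n)) (cong (λ x → s (suc n) +ℚ c *ℚ x) (v-suc (suc i) n)))

  Monic : ℕ → Row → Set
  Monic k r = Σ Row λ s → Span k s × (∀ n → r n ≡ v (suc k) n +ℚ 1ℚ *ℚ s n)

  monic⇒span : ∀ {k r} → Monic k r → Span (suc k) r
  monic⇒span {k} (s , p , e) = plus 1ℚ k ℕₚ.≤-refl (span-weaken p) (λ n → trans (e n) (lemma (v (suc k) n) (s n)))
    where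
    lemma : ∀ a b → a +ℚ 1ℚ *ℚ b ≡ b +ℚ 1ℚ *ℚ a
    lemma = solve-∀ ringℚ

  R-monic : ∀ k → Monic k (R k)
  R-monic zero = (λ _ → 0ℚ) , null (λ _ → refl) , (λ n → sym (trans (cong (q m (suc n) +ℚ_) (ℚₚ.*-zeroʳ 1ℚ)) (ℚₚ.+-identityʳ _)))
  R-monic (suc zero) = ((λ _ → 0ℚ) ⊞ -ℚ z · R 0) , span-linear (-ℚ z) (null (λ _ → refl)) (monic⇒span (R-monic 0)) ,
    (λ n → lemma (q m (2 + n)) z (R 0 n))
    where
    lemma : ∀ a z b → a -ℚ z *ℚ b ≡ a +ℚ 1ℚ *ℚ (0ℚ +ℚ (-ℚ z) *ℚ b)
    lemma = solve-∀ ringℚ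
  R-monic (suc (suc k)) = let s , p , e = R-monic (suc k) in
    (tail s ⊞ -ℚ β k · R k) , span-linear (-ℚ β k) (span-shift p) (span-weaken (monic⇒span (R-monic k))) ,
    (λ n → trans (cong (_-ℚ β k *ℚ R k n) (trans (e (suc n)) (cong (_+ℚ 1ℚ *ℚ s (suc n)) (v-suc (2 + k) n))))
      (lemma (v (3 + k) n) (s (suc n)) (β k) (R k n)))
    where
    lemma : ∀ a s z b → (a +ℚ 1ℚ *ℚ s) -ℚ z *ℚ b ≡ a +ℚ 1ℚ *ℚ (s +ℚ (-ℚ z) *ℚ b)
    lemma = solve-∀ ringℚ

  -- The extra row is moved down by `swap` until it meets its copy.
  repeated : ∀ g → Linear g → Alternate g → ∀ k i → i < k → g (v (suc i) ∷ map v (stair k)) ≡ 0ℚ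
  repeated g lin alt (suc k) i (s≤s i≤k) with ℕₚ.m≤n⇒m<n∨m≡n i≤k
  ... | inj₂ refl = alt [] (v (suc k)) (map v (stair k))
  ... | inj₁ i<k  = trans (swap g lin alt (v (suc i)) (v (suc k)) (map v (stair k)))
    (cong (λ t → 0ℚ -ℚ t) (repeated (λ xs → g (v (suc k) ∷ xs)) (λ pre → lin (v (suc k) ∷ pre)) (λ pre → alt (v (suc k) ∷ pre)) k i i<k))

  span-vanish : ∀ g → Linear g → Alternate g → Extensional g → ∀ {k s} → Span k s → g (s ∷ map v (stair k)) ≡ 0ℚ
  span-vanish g lin alt ext {k} {s} (null y) = -ℚ-cancel _ _ (begin
    -- A zero row equals its own double, so by linearity the value of `g` equals its own double.
    g (s ∷ vs) -ℚ 0ℚ ≡⟨ lemma (g (s ∷ vs)) ⟩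
    (g (s ∷ vs) +ℚ 1ℚ *ℚ g (s ∷ vs)) -ℚ g (s ∷ vs) ≡⟨ cong (_-ℚ g (s ∷ vs)) (sym (lin [] s 1ℚ s vs)) ⟩
    g ((s ⊞ 1ℚ · s) ∷ vs) -ℚ g (s ∷ vs) ≡⟨ cong (_-ℚ g (s ∷ vs)) (ext ((λ n → cong₂ (λ x t → x +ℚ 1ℚ *ℚ t) (y n) (y n)) ∷ ≗-refl vs)) ⟩
    g ((λ _ → 0ℚ) ∷ vs) -ℚ g (s ∷ vs) ≡⟨ cong (_-ℚ g (s ∷ vs)) (ext ((λ n → sym (y n)) ∷ ≗-refl vs)) ⟩
    g (s ∷ vs) -ℚ g (s ∷ vs) ≡⟨ ℚₚ.+-inverseʳ (g (s ∷ vs)) ⟩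
    0ℚ ∎)
    where
    vs = map v (stair k)
    lemma : ∀ x → x -ℚ 0ℚ ≡ (x +ℚ 1ℚ *ℚ x) -ℚ x
    lemma = solve-∀ ringℚ
  span-vanish g lin alt ext {k} {t} (plus {s} c i i<k p e) = begin
    g (t ∷ vs) ≡⟨ ext (e ∷ ≗-refl vs) ⟩
    g ((s ⊞ c · v (suc i)) ∷ vs) ≡⟨ lin [] s c (v (suc i)) vs ⟩
    g (s ∷ vs) +ℚ c *ℚ g (v (suc i) ∷ vs) ≡⟨ cong₂ (λ x y → x +ℚ c *ℚ y) (span-vanish g lin alt ext p) (repeated g lin alt k i i<k) ⟩
    0ℚ +ℚ c *ℚ 0ℚ ≡⟨ 0+x*0 c ⟩
    0ℚ ∎
    where
    vs = map v (stair k)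

  rowsR : ℕ → List Row
  rowsR zero    = []
  rowsR (suc k) = R k ∷ rowsR k

  -- `R k` is the top row plus a combination of the rows under it, so the replacement does not
  -- change the value; the new top row is then absorbed into `g`.
  triangularize : ∀ g → Linear g → Alternate g → Extensional g → ∀ k → g (map v (stair k)) ≡ g (rowsR k)
  triangularize g lin alt ext zero    = refl
  triangularize g lin alt ext (suc k) = begin
    g (v (suc k) ∷ vs) ≡⟨ lemma (g (v (suc k) ∷ vs)) ⟩
    g (v (suc k) ∷ vs) +ℚ 1ℚ *ℚ 0ℚ ≡⟨ cong (λ t → g (v (suc k) ∷ vs) +ℚ 1ℚ *ℚ t) (span-vanish g lin alt ext p) ⟨
    g (v (suc k) ∷ vs) +ℚ 1ℚ *ℚ g (s ∷ vs) ≡⟨ lin [] (v (suc k)) 1ℚ s vs ⟨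
    g ((v (suc k) ⊞ 1ℚ · s) ∷ vs) ≡⟨ ext ((λ n → sym (e n)) ∷ ≗-refl vs) ⟩
    g (R k ∷ vs) ≡⟨ triangularize (λ xs → g (R k ∷ xs)) (λ pre → lin (R k ∷ pre)) (λ pre → alt (R k ∷ pre)) (λ es → ext ((λ _ → refl) ∷ es)) k ⟩
    g (R k ∷ rowsR k) ∎
    where
    vs = map v (stair k)
    s = proj₁ (R-monic k)
    p = proj₁ (proj₂ (R-monic k))
    e = proj₂ (proj₂ (R-monic k))
    lemma : ∀ x → x ≡ x +ℚ 1ℚ *ℚ 0ℚ
    lemma = solve-∀ ringℚ

  -- rows R (b + c − 1), …, R b with the first b columns removed
  cornerR : ℕ → ℕ → List Row
  cornerR zero    b = []
  cornerR (suc c) b = (λ n → R (c + b) (b + n)) ∷ cornerR c b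

  -- the product over b ≤ i < b + c of the diagonal entries R i i, with the sign of the reversal of c rows
  diagonal : ℕ → ℕ → ℚ
  diagonal zero    b = 1ℚ
  diagonal (suc c) b = signℚ c *ℚ (R b b *ℚ diagonal c (suc b))

  -- By orthogonality only the last row can have a nonzero entry in the first remaining column; it
  -- has `c` rows above it, whence the sign.
  expand-last : ∀ g b c →
    expand g (cornerR (suc c) b) ≡ signℚ c *ℚ (R b b *ℚ g (map (λ i n → R (i + b) (b + n)) (stair c)))
  expand-last g b zero = trans (cong (λ t → R b t *ℚ g [] -ℚ 0ℚ) (ℕₚ.+-identityʳ b)) (lemma (R b b) (g []))
    where
    lemma : ∀ x y → x *ℚ y -ℚ 0ℚ ≡ 1ℚ *ℚ (x *ℚ y)
    lemma = solve-∀ ringℚ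
  expand-last g b (suc c) = begin
    R (suc c + b) (b + 0) *ℚ g (cornerR (suc c) b) -ℚ expand (λ xs → g (r ∷ xs)) (cornerR (suc c) b)
      ≡⟨ cong₂ (λ x y → x *ℚ g (cornerR (suc c) b) -ℚ y)
           (R-vanish (suc c + b) (b + 0) (subst (_< suc c + b) (sym (ℕₚ.+-identityʳ b)) (s≤s (ℕₚ.m≤n+m b c))))
           (expand-last (λ xs → g (r ∷ xs)) b c) ⟩
    0ℚ *ℚ g (cornerR (suc c) b) -ℚ signℚ c *ℚ (R b b *ℚ g (r ∷ map (λ i n → R (i + b) (b + n)) (stair c)))
      ≡⟨ lemma (g (cornerR (suc c) b)) (signℚ c) (R b b *ℚ g (r ∷ map (λ i n → R (i + b) (b + n)) (stair c))) ⟩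
    (-ℚ signℚ c) *ℚ (R b b *ℚ g (r ∷ map (λ i n → R (i + b) (b + n)) (stair c))) ∎
    where
    r : Row
    r n = R (suc c + b) (b + n)
    lemma : ∀ x s y → 0ℚ *ℚ x -ℚ s *ℚ y ≡ (-ℚ s) *ℚ y
    lemma = solve-∀ ringℚ

  det-corner : ∀ c b → det c (cornerR c b) ≡ diagonal c b
  det-corner zero    b = refl
  det-corner (suc c) b = trans (expand-last (λ xs → det c (map tail xs)) b c)
    (cong (λ t → signℚ c *ℚ (R b b *ℚ t)) (trans (det-Extensional c (rows c)) (det-corner c (suc b))))
    where
    rows : ∀ c → Rows≗ (map tail (map (λ i n → R (i + b) (b + n)) (stair c))) (cornerR c (suc b))
    rows zero    = []
    rows (suc c) = (λ n → cong₂ R (sym (ℕₚ.+-suc c b)) (ℕₚ.+-suc b n)) ∷ rows c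

  F-square : ∀ p → F p m (squareShape p) ≡ diagonal p 0
  F-square p = begin
    det p (map (row p m) (map (_+_ p) (stair p))) ≡⟨ det-Extensional p (rows (stair p)) ⟩
    det p (map v (stair p)) ≡⟨ triangularize (det p) (det-Linear p) (det-Alternate p) (det-Extensional p) p ⟩
    det p (rowsR p) ≡⟨ det-Extensional p (corner p) ⟩
    det p (cornerR p 0) ≡⟨ det-corner p 0 ⟩
    diagonal p 0 ∎
    where
    qShift-+ : ∀ p k → qShift m p (p + k) ≡ q m k
    qShift-+ zero    k = refl
    qShift-+ (suc p) k = qShift-+ p k
    rows : ∀ as → Rows≗ (map (row p m) (map (_+_ p) as)) (map v as)
    rows []       = []
    rows (a ∷ as) = (λ n → trans (cong (qShift m p) (ℕₚ.+-assoc p a n)) (qShift-+ p (a + n))) ∷ rows as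
    corner : ∀ c → Rows≗ (rowsR c) (cornerR c 0)
    corner zero    = []
    corner (suc c) = (λ n → cong (λ i → R i n) (sym (ℕₚ.+-identityʳ c))) ∷ corner c

-- Formal power series

-- A structural form of `mulS` that admits induction on the degree; `mulS≡conv` identifies the two.
conv : Series → Series → Series
conv f g zero    = f 0 *ℚ g 0
conv f g (suc n) = f 0 *ℚ g (suc n) +ℚ conv (tail f) g n

conv-cong : ∀ {f f′ g g′} n → (∀ k → k ≤ n → f k ≡ f′ k) → (∀ k → k ≤ n → g k ≡ g′ k) → conv f g n ≡ conv f′ g′ n
conv-cong zero    e e′ = cong₂ _*ℚ_ (e 0 z≤n) (e′ 0 z≤n)
conv-cong (suc n) e e′ = cong₂ _+ℚ_ (cong₂ _*ℚ_ (e 0 z≤n) (e′ (suc n) ℕₚ.≤-refl))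
  (conv-cong n (λ k k≤n → e (suc k) (s≤s k≤n)) (λ k k≤n → e′ k (ℕₚ.m≤n⇒m≤1+n k≤n)))

conv-right : ∀ f g n → conv f g (suc n) ≡ conv f (tail g) n +ℚ f (suc n) *ℚ g 0
conv-right f g zero    = refl
conv-right f g (suc n) = trans (cong (f 0 *ℚ g (suc (suc n)) +ℚ_) (conv-right (tail f) g n))
  (sym (ℚₚ.+-assoc (f 0 *ℚ g (suc (suc n))) (conv (tail f) (tail g) n) (f (suc (suc n)) *ℚ g 0)))

conv-comm : ∀ f g n → conv f g n ≡ conv g f n
conv-comm f g zero    = ℚₚ.*-comm (f 0) (g 0)
conv-comm f g (suc n) = trans (cong (f 0 *ℚ g (suc n) +ℚ_) (conv-comm (tail f) g n))
  (trans (lemma (f 0) (g (suc n)) (conv g (tail f) n)) (sym (conv-right g f n)))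
  where
  lemma : ∀ a b c → a *ℚ b +ℚ c ≡ c +ℚ b *ℚ a
  lemma = solve-∀ ringℚ

conv-linearˡ : ∀ f c f′ g n → conv (f ⊞ c · f′) g n ≡ conv f g n +ℚ c *ℚ conv f′ g n
conv-linearˡ f c f′ g zero    = lemma (f 0) c (f′ 0) (g 0)
  where
  lemma : ∀ a c b g → (a +ℚ c *ℚ b) *ℚ g ≡ a *ℚ g +ℚ c *ℚ (b *ℚ g)
  lemma = solve-∀ ringℚ
conv-linearˡ f c f′ g (suc n) = trans (cong ((f 0 +ℚ c *ℚ f′ 0) *ℚ g (suc n) +ℚ_) (conv-linearˡ (tail f) c (tail f′) g n))
  (lemma (f 0) c (f′ 0) (g (suc n)) (conv (tail f) g n) (conv (tail f′) g n))
  where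
  lemma : ∀ a c b g x y → (a +ℚ c *ℚ b) *ℚ g +ℚ (x +ℚ c *ℚ y) ≡ (a *ℚ g +ℚ x) +ℚ c *ℚ (b *ℚ g +ℚ y)
  lemma = solve-∀ ringℚ

conv-zeroˡ : ∀ g n → conv (λ _ → 0ℚ) g n ≡ 0ℚ
conv-zeroˡ g zero    = ℚₚ.*-zeroˡ (g 0)
conv-zeroˡ g (suc n) = cong₂ _+ℚ_ (ℚₚ.*-zeroˡ (g (suc n))) (conv-zeroˡ g n)

conv-assoc : ∀ f g h n → conv (conv f g) h n ≡ conv f (conv g h) n
conv-assoc f g h zero    = ℚₚ.*-assoc (f 0) (g 0) (h 0)
conv-assoc f g h (suc n) = begin
  (f 0 *ℚ g 0) *ℚ h (suc n) +ℚ conv (λ k → f 0 *ℚ g (suc k) +ℚ conv (tail f) g k) h n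
    ≡⟨ cong ((f 0 *ℚ g 0) *ℚ h (suc n) +ℚ_) (trans (conv-cong n (λ k _ → ℚₚ.+-comm (f 0 *ℚ g (suc k)) (conv (tail f) g k)) (λ _ _ → refl))
         (conv-linearˡ (conv (tail f) g) (f 0) (tail g) h n)) ⟩
  (f 0 *ℚ g 0) *ℚ h (suc n) +ℚ (conv (conv (tail f) g) h n +ℚ f 0 *ℚ conv (tail g) h n)
    ≡⟨ cong (λ t → (f 0 *ℚ g 0) *ℚ h (suc n) +ℚ (t +ℚ f 0 *ℚ conv (tail g) h n)) (conv-assoc (tail f) g h n) ⟩
  (f 0 *ℚ g 0) *ℚ h (suc n) +ℚ (conv (tail f) (conv g h) n +ℚ f 0 *ℚ conv (tail g) h n)
    ≡⟨ lemma (f 0) (g 0) (h (suc n)) (conv (tail f) (conv g h) n) (conv (tail g) h n) ⟩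
  f 0 *ℚ (g 0 *ℚ h (suc n) +ℚ conv (tail g) h n) +ℚ conv (tail f) (conv g h) n ∎
  where
  lemma : ∀ f g h x y → (f *ℚ g) *ℚ h +ℚ (x +ℚ f *ℚ y) ≡ f *ℚ (g *ℚ h +ℚ y) +ℚ x
  lemma = solve-∀ ringℚ

-- Division by a series with constant term 1, one coefficient at a time. The bound `M` is carried
-- because truncated Abel moments satisfy their equation only in low degrees.
conv-cancel : ∀ M f f′ g → g 0 ≡ 1ℚ → (∀ n → n ≤ M → conv f g n ≡ conv f′ g n) → ∀ n → n ≤ M → ∀ k → k ≤ n → f k ≡ f′ k
conv-cancel M f f′ g g0 e zero n≤M zero z≤n = trans (lemma (f 0)) (trans (e 0 n≤M) (sym (lemma (f′ 0))))
  where
  lemma : ∀ x → x ≡ x *ℚ g 0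
  lemma x = trans (sym (ℚₚ.*-identityʳ x)) (cong (x *ℚ_) (sym g0))
conv-cancel M f f′ g g0 e (suc n) n<M k k≤ with ℕₚ.m≤n⇒m<n∨m≡n k≤
... | inj₁ (s≤s k≤n) = conv-cancel M f f′ g g0 e n (ℕₚ.<⇒≤ n<M) k k≤n
... | inj₂ refl = -ℚ-cancel _ _ (begin
  f (suc n) -ℚ f′ (suc n)
    ≡⟨ lemma (f (suc n)) (f′ (suc n)) (conv f (tail g) n) ⟩
  (conv f (tail g) n +ℚ f (suc n) *ℚ 1ℚ) -ℚ (conv f (tail g) n +ℚ f′ (suc n) *ℚ 1ℚ)
    ≡⟨ cong₂ (λ x y → (conv f (tail g) n +ℚ f (suc n) *ℚ x) -ℚ (y +ℚ f′ (suc n) *ℚ x)) (sym g0)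
         (conv-cong n (conv-cancel M f f′ g g0 e n (ℕₚ.<⇒≤ n<M)) (λ _ _ → refl)) ⟩
  (conv f (tail g) n +ℚ f (suc n) *ℚ g 0) -ℚ (conv f′ (tail g) n +ℚ f′ (suc n) *ℚ g 0)
    ≡⟨ cong₂ _-ℚ_ (conv-right f g n) (conv-right f′ g n) ⟨
  conv f g (suc n) -ℚ conv f′ g (suc n)
    ≡⟨ cong (_-ℚ conv f′ g (suc n)) (e (suc n) n<M) ⟩
  conv f′ g (suc n) -ℚ conv f′ g (suc n)
    ≡⟨ ℚₚ.+-inverseʳ (conv f′ g (suc n)) ⟩
  0ℚ ∎)
  where
  lemma : ∀ x y c → x -ℚ y ≡ (c +ℚ x *ℚ 1ℚ) -ℚ (c +ℚ y *ℚ 1ℚ)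
  lemma = solve-∀ ringℚ

mulS≡conv : ∀ f g n → mulS f g n ≡ conv f g n
mulS≡conv f g n = trans (cong sumℚ (map-upTo (λ k → f k *ℚ g (n ∸ k)) (suc n))) (go f n)
  where
  go : ∀ f n → sumℚ (applyUpTo (λ k → f k *ℚ g (n ∸ k)) (suc n)) ≡ conv f g n
  go f zero    = ℚₚ.+-identityʳ (f 0 *ℚ g 0)
  go f (suc n) = cong (f 0 *ℚ g (suc n) +ℚ_) (go (tail f) n)

invRev-∷ : ∀ a n → invRev a (suc n) ≡ invS a n ∷ invRev a n
invRev-∷ a zero    = refl
invRev-∷ a (suc n) = refl

invS-suc : ∀ a n → invS a (suc n) ≡ -ℚ conv (tail a) (invS a) n
invS-suc a n = cong -ℚ_ (trans (cong (λ l → sumℚ (zipWith _*ℚ_ l (invRev a (suc n)))) (trans (sym (map-∘ (upTo (suc n)))) (map-upTo (tail a) (suc n))))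
  (go (tail a) n))
  where
  go : ∀ c n → sumℚ (zipWith _*ℚ_ (applyUpTo c (suc n)) (invRev a (suc n))) ≡ conv c (invS a) n
  go c zero    = ℚₚ.+-identityʳ (c 0 *ℚ 1ℚ)
  go c (suc n) = trans (cong (λ l → sumℚ (zipWith _*ℚ_ (applyUpTo c (2 + n)) l)) (invRev-∷ a (suc n))) (cong (c 0 *ℚ invS a (suc n) +ℚ_) (go (tail c) n))

oneS : Series
oneS zero    = 1ℚ
oneS (suc n) = 0ℚ

conv-invS : ∀ a → a 0 ≡ 1ℚ → ∀ n → conv a (invS a) n ≡ oneS n
conv-invS a a0 zero    = cong (_*ℚ 1ℚ) a0
conv-invS a a0 (suc n) = trans (cong₂ (λ x y → x *ℚ y +ℚ conv (tail a) (invS a) n) a0 (invS-suc a n)) (lemma (conv (tail a) (invS a) n))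
  where
  lemma : ∀ x → 1ℚ *ℚ (-ℚ x) +ℚ x ≡ 0ℚ
  lemma = solve-∀ ringℚ

conv-oneS : ∀ f n → conv f oneS n ≡ f n
conv-oneS f n = trans (conv-comm f oneS n) (go n)
  where
  go : ∀ n → conv oneS f n ≡ f n
  go zero    = ℚₚ.*-identityˡ (f 0)
  go (suc n) = trans (cong₂ _+ℚ_ (ℚₚ.*-identityˡ (f (suc n))) (conv-zeroˡ f n)) (ℚₚ.+-identityʳ (f (suc n)))

secTan : Series
secTan n = secS n +ℚ tanS n

secTan-cos : ∀ n → conv secTan cosS n ≡ oneS n +ℚ sinS n
secTan-cos n = begin
  conv secTan cosS n
    ≡⟨ conv-cong n (λ k _ → cong (secS k +ℚ_) (trans (mulS≡conv sinS secS k) (sym (ℚₚ.*-identityˡ _)))) (λ _ _ → refl) ⟩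
  conv (secS ⊞ 1ℚ · conv sinS secS) cosS n
    ≡⟨ conv-linearˡ secS 1ℚ (conv sinS secS) cosS n ⟩
  conv secS cosS n +ℚ 1ℚ *ℚ conv (conv sinS secS) cosS n
    ≡⟨ cong₂ _+ℚ_ (sec-cos n) (trans (ℚₚ.*-identityˡ _) (trans (conv-assoc sinS secS cosS n)
         (trans (conv-cong n (λ _ _ → refl) (λ k _ → sec-cos k)) (conv-oneS sinS n)))) ⟩
  oneS n +ℚ sinS n ∎
  where
  sec-cos : ∀ n → conv secS cosS n ≡ oneS n
  sec-cos n = trans (conv-comm secS cosS n) (conv-invS cosS refl n)

-- Doubling by constructors, so that parities and alternating signs unfold two steps at a time.
dbl : ℕ → ℕ
dbl zero    = zero
dbl (suc n) = suc (suc (dbl n))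

conv-bisect : ∀ f g → (∀ i → g (suc (dbl i)) ≡ 0ℚ) → ∀ j →
  conv f g (suc (dbl j)) ≡ conv (λ i → f (suc (dbl i))) (λ i → g (dbl i)) j
conv-bisect f g z zero    = trans (cong (λ t → f 0 *ℚ t +ℚ f 1 *ℚ g 0) (z 0)) (lemma (f 0) (f 1 *ℚ g 0))
  where
  lemma : ∀ x y → x *ℚ 0ℚ +ℚ y ≡ y
  lemma = solve-∀ ringℚ
conv-bisect f g z (suc j) = trans (cong₂ (λ s t → f 0 *ℚ s +ℚ (f 1 *ℚ g (dbl (suc j)) +ℚ t)) (z (suc j)) (conv-bisect (tail (tail f)) g z j))
  (lemma (f 0) _)
  where
  lemma : ∀ x y → x *ℚ 0ℚ +ℚ y ≡ y
  lemma = solve-∀ ringℚ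

isEven-dbl : ∀ i → isEven (dbl i) ≡ true
isEven-dbl zero    = refl
isEven-dbl (suc i) = isEven-dbl i

isEven-suc-dbl : ∀ i → isEven (suc (dbl i)) ≡ false
isEven-suc-dbl zero    = refl
isEven-suc-dbl (suc i) = isEven-suc-dbl i

isOdd-suc-dbl : ∀ i → isOdd (suc (dbl i)) ≡ true
isOdd-suc-dbl zero    = refl
isOdd-suc-dbl (suc i) = isOdd-suc-dbl i

half-dbl : ∀ i → dbl i ℕ./ 2 ≡ i
half-dbl zero    = refl
half-dbl (suc i) = trans (m/n≡1+[m∸n]/n {dbl (suc i)} {2} (s≤s (s≤s z≤n))) (cong suc (half-dbl i))

half-suc-dbl : ∀ i → suc (dbl i) ℕ./ 2 ≡ i
half-suc-dbl zero    = refl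
half-suc-dbl (suc i) = trans (m/n≡1+[m∸n]/n {suc (dbl (suc i))} {2} (s≤s (s≤s z≤n))) (cong suc (half-suc-dbl i))

cosS-even : ∀ i → cosS (dbl i) ≡ signℚ i *ℚ invFact (dbl i)
cosS-even i = cong₂ (λ b k → if b then signℚ k *ℚ invFact (dbl i) else 0ℚ) (isEven-dbl i) (half-dbl i)

cosS-odd : ∀ i → cosS (suc (dbl i)) ≡ 0ℚ
cosS-odd i = cong (λ b → if b then signℚ (suc (dbl i) ℕ./ 2) *ℚ invFact (suc (dbl i)) else 0ℚ) (isEven-suc-dbl i)

sinS-odd : ∀ i → sinS (suc (dbl i)) ≡ signℚ i *ℚ invFact (suc (dbl i))
sinS-odd i = cong₂ (λ b k → if b then signℚ k *ℚ invFact (suc (dbl i)) else 0ℚ) (isOdd-suc-dbl i) (half-suc-dbl i)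

invFact-inverse : ∀ n → ℕtoℚ (fact n) *ℚ invFact n ≡ 1ℚ
invFact-inverse n = ℕtoℚ-inverse (fact n) {{n ℕₚ.!≢0}}

inverse-unique : ∀ a x y → a *ℚ x ≡ 1ℚ → a *ℚ y ≡ 1ℚ → x ≡ y
inverse-unique a x y ax ay = begin
  x ≡⟨ ℚₚ.*-identityʳ x ⟨
  x *ℚ 1ℚ ≡⟨ cong (x *ℚ_) ay ⟨
  x *ℚ (a *ℚ y) ≡⟨ lemma x a y ⟩
  (a *ℚ x) *ℚ y ≡⟨ cong (_*ℚ y) ax ⟩
  1ℚ *ℚ y ≡⟨ ℚₚ.*-identityˡ y ⟩
  y ∎
  where
  lemma : ∀ x a y → x *ℚ (a *ℚ y) ≡ (a *ℚ x) *ℚ y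
  lemma = solve-∀ ringℚ

recip : ℕ → ℚ
recip n = + 1 / suc n

invFact-suc : ∀ n → invFact (suc n) ≡ recip n *ℚ invFact n
invFact-suc n = inverse-unique (ℕtoℚ (fact (suc n))) _ _ (invFact-inverse (suc n))
  (trans (cong (_*ℚ (recip n *ℚ invFact n)) (ℕtoℚ-* (suc n) (fact n)))
    (trans (lemma (ℕtoℚ (suc n)) (ℕtoℚ (fact n)) (recip n) (invFact n))
      (cong₂ _*ℚ_ (ℕtoℚ-inverse (suc n)) (invFact-inverse n))))
  where
  lemma : ∀ a b c d → (a *ℚ b) *ℚ (c *ℚ d) ≡ (a *ℚ c) *ℚ (b *ℚ d)
  lemma = solve-∀ ringℚ

-- divided powers xⁿ / n!
dp : ℚ → Series
dp x zero    = 1ℚ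
dp x (suc n) = x *ℚ dp x n *ℚ recip n

dp-one : ∀ n → dp 1ℚ n ≡ invFact n
dp-one zero    = refl
dp-one (suc n) = trans (cong (λ t → 1ℚ *ℚ t *ℚ recip n) (dp-one n)) (trans (lemma (invFact n) (recip n)) (sym (invFact-suc n)))
  where
  lemma : ∀ a b → 1ℚ *ℚ a *ℚ b ≡ b *ℚ a
  lemma = solve-∀ ringℚ

dp-minusOne : ∀ n → dp (-ℚ 1ℚ) n ≡ signℚ n *ℚ invFact n
dp-minusOne zero    = refl
dp-minusOne (suc n) = trans (cong (λ t → (-ℚ 1ℚ) *ℚ t *ℚ recip n) (dp-minusOne n))
  (trans (lemma (signℚ n) (invFact n) (recip n)) (cong (signℚ (suc n) *ℚ_) (sym (invFact-suc n))))
  where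
  lemma : ∀ s a b → (-ℚ 1ℚ) *ℚ (s *ℚ a) *ℚ b ≡ (-ℚ s) *ℚ (b *ℚ a)
  lemma = solve-∀ ringℚ

-- The Euler operator t d/dt, a derivation for `conv` by `conv-θ`.
θ : Series → Series
θ f n = ℕtoℚ n *ℚ f n

conv-θ : ∀ f g n → ℕtoℚ n *ℚ conv f g n ≡ conv (θ f) g n +ℚ conv f (θ g) n
conv-θ f g zero    = lemma (f 0) (g 0)
  where
  lemma : ∀ f g → 0ℚ *ℚ (f *ℚ g) ≡ (0ℚ *ℚ f) *ℚ g +ℚ f *ℚ (0ℚ *ℚ g)
  lemma = solve-∀ ringℚ
conv-θ f g (suc n) = begin
  ℕtoℚ (suc n) *ℚ (f 0 *ℚ g (suc n) +ℚ conv (tail f) g n)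
    ≡⟨ ℚₚ.*-distribˡ-+ (ℕtoℚ (suc n)) (f 0 *ℚ g (suc n)) (conv (tail f) g n) ⟩
  ℕtoℚ (suc n) *ℚ (f 0 *ℚ g (suc n)) +ℚ ℕtoℚ (suc n) *ℚ conv (tail f) g n
    ≡⟨ cong (λ t → ℕtoℚ (suc n) *ℚ (f 0 *ℚ g (suc n)) +ℚ t *ℚ conv (tail f) g n) (ℕtoℚ-suc n) ⟩
  _ ≡⟨ lemma₁ (ℕtoℚ (suc n)) (f 0) (g (suc n)) (ℕtoℚ n) (conv (tail f) g n) ⟩
  (f 0 *ℚ (ℕtoℚ (suc n) *ℚ g (suc n)) +ℚ ℕtoℚ n *ℚ conv (tail f) g n) +ℚ 1ℚ *ℚ conv (tail f) g n
    ≡⟨ cong (λ t → (f 0 *ℚ (ℕtoℚ (suc n) *ℚ g (suc n)) +ℚ t) +ℚ 1ℚ *ℚ conv (tail f) g n) (conv-θ (tail f) g n) ⟩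
  _ ≡⟨ lemma₂ (f 0) (ℕtoℚ (suc n) *ℚ g (suc n)) (conv (θ (tail f)) g n) (conv (tail f) (θ g) n) (conv (tail f) g n) (g (suc n)) ⟩
  ((0ℚ *ℚ f 0) *ℚ g (suc n) +ℚ (conv (θ (tail f)) g n +ℚ 1ℚ *ℚ conv (tail f) g n)) +ℚ conv f (θ g) (suc n)
    ≡⟨ cong (λ t → ((0ℚ *ℚ f 0) *ℚ g (suc n) +ℚ t) +ℚ conv f (θ g) (suc n))
         (trans (sym (conv-linearˡ (θ (tail f)) 1ℚ (tail f) g n)) (conv-cong n (λ k _ → trans (lemma₃ (ℕtoℚ k) (f (suc k))) (cong (_*ℚ f (suc k)) (sym (ℕtoℚ-suc k)))) (λ _ _ → refl))) ⟩
  conv (θ f) g (suc n) +ℚ conv f (θ g) (suc n) ∎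
  where
  lemma₁ : ∀ s f g n c → s *ℚ (f *ℚ g) +ℚ (1ℚ +ℚ n) *ℚ c ≡ (f *ℚ (s *ℚ g) +ℚ n *ℚ c) +ℚ 1ℚ *ℚ c
  lemma₁ = solve-∀ ringℚ
  lemma₂ : ∀ f x a b c g → (f *ℚ x +ℚ (a +ℚ b)) +ℚ 1ℚ *ℚ c ≡ ((0ℚ *ℚ f) *ℚ g +ℚ (a +ℚ 1ℚ *ℚ c)) +ℚ (f *ℚ x +ℚ b)
  lemma₂ = solve-∀ ringℚ
  lemma₃ : ∀ k f → k *ℚ f +ℚ 1ℚ *ℚ f ≡ (1ℚ +ℚ k) *ℚ f
  lemma₃ = solve-∀ ringℚ

θ-dp : ∀ x n → θ (dp x) (suc n) ≡ x *ℚ dp x n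
θ-dp x n = trans (lemma (ℕtoℚ (suc n)) (x *ℚ dp x n) (recip n)) (trans (cong (_*ℚ (x *ℚ dp x n)) (ℕtoℚ-inverse (suc n))) (ℚₚ.*-identityˡ _))
  where
  lemma : ∀ a b c → a *ℚ (b *ℚ c) ≡ (a *ℚ c) *ℚ b
  lemma = solve-∀ ringℚ

conv-θ-dp : ∀ x g n → conv (θ (dp x)) g (suc n) ≡ x *ℚ conv (dp x) g n
conv-θ-dp x g n = begin
  (0ℚ *ℚ 1ℚ) *ℚ g (suc n) +ℚ conv (tail (θ (dp x))) g n
    ≡⟨ cong₂ _+ℚ_ (ℚₚ.*-zeroˡ (g (suc n))) (conv-cong n (λ k _ → trans (θ-dp x k) (sym (ℚₚ.+-identityˡ _))) (λ _ _ → refl)) ⟩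
  0ℚ +ℚ conv ((λ _ → 0ℚ) ⊞ x · dp x) g n
    ≡⟨ cong (0ℚ +ℚ_) (conv-linearˡ (λ _ → 0ℚ) x (dp x) g n) ⟩
  0ℚ +ℚ (conv (λ _ → 0ℚ) g n +ℚ x *ℚ conv (dp x) g n)
    ≡⟨ cong (λ t → 0ℚ +ℚ (t +ℚ x *ℚ conv (dp x) g n)) (conv-zeroˡ g n) ⟩
  0ℚ +ℚ (0ℚ +ℚ x *ℚ conv (dp x) g n)
    ≡⟨ lemma (x *ℚ conv (dp x) g n) ⟩
  x *ℚ conv (dp x) g n ∎
  where
  lemma : ∀ x → 0ℚ +ℚ (0ℚ +ℚ x) ≡ x
  lemma = solve-∀ ringℚ

-- This is exp((x + y) t) = exp(x t) exp(y t): under `θ` both sides obey the same first-order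
-- equation, and the factor n + 1 cancels.
dp-+ : ∀ x y n → dp (x +ℚ y) n ≡ conv (dp x) (dp y) n
dp-+ x y zero    = refl
dp-+ x y (suc n) = -ℚ-cancel _ _ (ℕtoℚ-cancel n _ (begin
  ℕtoℚ (suc n) *ℚ (dp (x +ℚ y) (suc n) -ℚ conv (dp x) (dp y) (suc n))
    ≡⟨ lemma₁ (ℕtoℚ (suc n)) (dp (x +ℚ y) (suc n)) (conv (dp x) (dp y) (suc n)) ⟩
  θ (dp (x +ℚ y)) (suc n) -ℚ ℕtoℚ (suc n) *ℚ conv (dp x) (dp y) (suc n)
    ≡⟨ cong₂ _-ℚ_ (θ-dp (x +ℚ y) n) (conv-θ (dp x) (dp y) (suc n)) ⟩
  (x +ℚ y) *ℚ dp (x +ℚ y) n -ℚ (conv (θ (dp x)) (dp y) (suc n) +ℚ conv (dp x) (θ (dp y)) (suc n))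
    ≡⟨ cong₂ (λ s t → (x +ℚ y) *ℚ dp (x +ℚ y) n -ℚ (s +ℚ t)) (conv-θ-dp x (dp y) n)
         (trans (conv-comm (dp x) (θ (dp y)) (suc n)) (trans (conv-θ-dp y (dp x) n) (cong (y *ℚ_) (conv-comm (dp y) (dp x) n)))) ⟩
  (x +ℚ y) *ℚ dp (x +ℚ y) n -ℚ (x *ℚ conv (dp x) (dp y) n +ℚ y *ℚ conv (dp x) (dp y) n)
    ≡⟨ cong (λ t → (x +ℚ y) *ℚ t -ℚ (x *ℚ conv (dp x) (dp y) n +ℚ y *ℚ conv (dp x) (dp y) n)) (dp-+ x y n) ⟩
  _ ≡⟨ lemma₂ x y (conv (dp x) (dp y) n) ⟩
  0ℚ ∎))
  where
  lemma₁ : ∀ a b c → a *ℚ (b -ℚ c) ≡ a *ℚ b -ℚ a *ℚ c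
  lemma₁ = solve-∀ ringℚ
  lemma₂ : ∀ x y c → (x +ℚ y) *ℚ c -ℚ (x *ℚ c +ℚ y *ℚ c) ≡ 0ℚ
  lemma₂ = solve-∀ ringℚ

sign-dbl : ∀ i → signℚ (dbl i) ≡ 1ℚ
sign-dbl zero    = refl
sign-dbl (suc i) = cong (λ t → -ℚ (-ℚ t)) (sign-dbl i)

coshS : Series
coshS n = ½ *ℚ (dp 1ℚ n +ℚ dp (-ℚ 1ℚ) n)

coshS-sign : ∀ n → coshS n ≡ ½ *ℚ ((1ℚ +ℚ signℚ n) *ℚ invFact n)
coshS-sign n = trans (cong₂ (λ x y → ½ *ℚ (x +ℚ y)) (dp-one n) (dp-minusOne n)) (lemma (invFact n) (signℚ n))
  where
  lemma : ∀ a s → ½ *ℚ (a +ℚ s *ℚ a) ≡ ½ *ℚ ((1ℚ +ℚ s) *ℚ a)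
  lemma = solve-∀ ringℚ

coshS-even : ∀ i → coshS (dbl i) ≡ invFact (dbl i)
coshS-even i = trans (coshS-sign (dbl i)) (trans (cong (λ t → ½ *ℚ ((1ℚ +ℚ t) *ℚ invFact (dbl i))) (sign-dbl i)) (lemma (invFact (dbl i))))
  where
  lemma : ∀ a → ½ *ℚ ((1ℚ +ℚ 1ℚ) *ℚ a) ≡ a
  lemma = solve-∀ ringℚ

coshS-odd : ∀ i → coshS (suc (dbl i)) ≡ 0ℚ
coshS-odd i = trans (coshS-sign (suc (dbl i))) (trans (cong (λ t → ½ *ℚ ((1ℚ +ℚ (-ℚ t)) *ℚ invFact (suc (dbl i)))) (sign-dbl i)) (lemma (invFact (suc (dbl i)))))
  where
  lemma : ∀ a → ½ *ℚ ((1ℚ +ℚ (-ℚ 1ℚ)) *ℚ a) ≡ 0ℚ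
  lemma = solve-∀ ringℚ

sign-square : ∀ i → signℚ i *ℚ signℚ i ≡ 1ℚ
sign-square zero    = refl
sign-square (suc i) = trans (lemma (signℚ i)) (sign-square i)
  where
  lemma : ∀ s → (-ℚ s) *ℚ (-ℚ s) ≡ s *ℚ s
  lemma = solve-∀ ringℚ

-- Moves the substitution t ↦ -t from one factor to the other.
conv-sign : ∀ f g n → conv (λ k → signℚ k *ℚ f k) g n ≡ signℚ n *ℚ conv f (λ k → signℚ k *ℚ g k) n
conv-sign f g zero    = lemma (f 0) (g 0)
  where
  lemma : ∀ f g → (1ℚ *ℚ f) *ℚ g ≡ 1ℚ *ℚ (f *ℚ (1ℚ *ℚ g))
  lemma = solve-∀ ringℚ
conv-sign f g (suc n) = begin
  (1ℚ *ℚ f 0) *ℚ g (suc n) +ℚ conv (λ k → signℚ (suc k) *ℚ f (suc k)) g n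
    ≡⟨ cong (_+ℚ conv (λ k → signℚ (suc k) *ℚ f (suc k)) g n) (ℚₚ.*-assoc 1ℚ (f 0) (g (suc n))) ⟩
  1ℚ *ℚ (f 0 *ℚ g (suc n)) +ℚ conv (λ k → signℚ (suc k) *ℚ f (suc k)) g n
    ≡⟨ cong₂ (λ s t → s *ℚ (f 0 *ℚ g (suc n)) +ℚ t) (sym (sign-square (suc n)))
         (trans (conv-cong n (λ k _ → lemma₁ (signℚ k) (f (suc k))) (λ _ _ → refl))
           (trans (conv-linearˡ (λ _ → 0ℚ) (-ℚ 1ℚ) (λ k → signℚ k *ℚ f (suc k)) g n) (cong₂ (λ a b → a +ℚ (-ℚ 1ℚ) *ℚ b) (conv-zeroˡ g n) (conv-sign (tail f) g n)))) ⟩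
  _ ≡⟨ lemma₂ (signℚ n) (f 0) (g (suc n)) (conv (tail f) (λ k → signℚ k *ℚ g k) n) ⟩
  signℚ (suc n) *ℚ (f 0 *ℚ (signℚ (suc n) *ℚ g (suc n)) +ℚ conv (tail f) (λ k → signℚ k *ℚ g k) n) ∎
  where
  lemma₁ : ∀ s f → (-ℚ s) *ℚ f ≡ 0ℚ +ℚ (-ℚ 1ℚ) *ℚ (s *ℚ f)
  lemma₁ = solve-∀ ringℚ
  lemma₂ : ∀ s f g c → ((-ℚ s) *ℚ (-ℚ s)) *ℚ (f *ℚ g) +ℚ (0ℚ +ℚ (-ℚ 1ℚ) *ℚ (s *ℚ c)) ≡ (-ℚ s) *ℚ (f *ℚ ((-ℚ s) *ℚ g) +ℚ c)
  lemma₂ = solve-∀ ringℚ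

-- Umbral evaluation as Abel summation

deg-scale : ∀ d c f → DegBelow d f → DegBelow d (λ m → c *ℚ f m)
deg-scale d c f y = deg-cong d (λ m → ℚₚ.+-identityˡ (c *ℚ f m)) (deg-linear d (λ _ → 0ℚ) c f (deg-zero d (λ _ → refl)) y)

X : ℕ → ℚ
X m = 2ℚ *ℚ ℕtoℚ m

X-suc : ∀ m → X (suc m) ≡ X m +ℚ 2ℚ
X-suc m = trans (cong (2ℚ *ℚ_) (ℕtoℚ-suc m)) (lemma (ℕtoℚ m))
  where
  lemma : ∀ x → 2ℚ *ℚ (1ℚ +ℚ x) ≡ 2ℚ *ℚ x +ℚ 2ℚ
  lemma = solve-∀ ringℚ

deg-X : ∀ c → DegBelow 2 (λ m → X m +ℚ c)
deg-X c = deg-cong 1 {λ _ → 2ℚ} (λ m → trans (lemma (X m) c) (cong (λ t → (t +ℚ c) -ℚ (X m +ℚ c)) (sym (X-suc m)))) (λ _ → refl)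
  where
  lemma : ∀ x c → 2ℚ ≡ ((x +ℚ 2ℚ) +ℚ c) -ℚ (x +ℚ c)
  lemma = solve-∀ ringℚ

deg-dp : ∀ c n → DegBelow (suc (n + n)) (λ m → dp (X m +ℚ c) n)
deg-dp c zero    = λ _ → refl
deg-dp c (suc n) = subst (λ d → DegBelow (suc (suc d)) (λ m → dp (X m +ℚ c) (suc n))) (sym (ℕₚ.+-suc n n))
  (deg-cong (2 + suc (n + n)) (λ m → ℚₚ.*-comm (recip n) _) (deg-scale (2 + suc (n + n)) (recip n) (λ m → (X m +ℚ c) *ℚ dp (X m +ℚ c) n)
    (deg-product 2 (suc (n + n)) (λ m → X m +ℚ c) (λ m → dp (X m +ℚ c) n) (deg-X c) (deg-dp c n))))

abel-conv : ∀ N (φ : ℕ → Series) g n → abel N (λ m → conv (φ m) g n) ≡ conv (λ k → abel N (λ m → φ m k)) g n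
abel-conv N φ g zero    = trans (abel-cong N (λ m → ℚₚ.*-comm (φ m 0) (g 0))) (trans (abel-* N (g 0) (λ m → φ m 0)) (ℚₚ.*-comm (g 0) _))
abel-conv N φ g (suc n) = trans (abel-+ N (λ m → φ m 0 *ℚ g (suc n)) (λ m → conv (tail (φ m)) g n))
  (cong₂ _+ℚ_ (trans (abel-cong N (λ m → ℚₚ.*-comm (φ m 0) (g (suc n)))) (trans (abel-* N (g (suc n)) (λ m → φ m 0)) (ℚₚ.*-comm (g (suc n)) _)))
    (abel-conv N (λ m → tail (φ m)) g n))

moment : ℕ → Series
moment N k = abel N (λ m → dp (X m) k)

-½ : ℚ
-½ = -ℚ ½

-- exp(2mt) cosh t is the mean of exp((2m - 1)t) and its successor in m. The alternating sum
-- therefore telescopes to exp(-t)/2, with odd coefficients -1/(2 n!).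
moment-cosh : ∀ N j → let n = suc (dbl j) in suc (n + n) ≤ N → conv (moment N) coshS n ≡ -½ *ℚ invFact n
moment-cosh N j n≤N = begin
  conv (moment N) coshS n
    ≡⟨ trans (conv-cong {moment N} {moment N} {coshS} {halves} n (λ _ _ → refl) (λ k _ → lemma₁ (dp 1ℚ k) (dp (-ℚ 1ℚ) k))) (conv-comm (moment N) halves n) ⟩
  conv halves (moment N) n
    ≡⟨ trans (conv-linearˡ (λ k → 0ℚ +ℚ ½ *ℚ dp 1ℚ k) ½ (dp (-ℚ 1ℚ)) (moment N) n)
         (cong (_+ℚ ½ *ℚ conv (dp (-ℚ 1ℚ)) (moment N) n) (conv-linearˡ (λ _ → 0ℚ) ½ (dp 1ℚ) (moment N) n)) ⟩
  (conv (λ _ → 0ℚ) (moment N) n +ℚ ½ *ℚ conv (dp 1ℚ) (moment N) n) +ℚ ½ *ℚ conv (dp (-ℚ 1ℚ)) (moment N) n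
    ≡⟨ lemma₂ (conv (λ _ → 0ℚ) (moment N) n) (conv (dp 1ℚ) (moment N) n) (conv (dp (-ℚ 1ℚ)) (moment N) n) (conv-zeroˡ (moment N) n) ⟩
  ½ *ℚ (conv (dp (-ℚ 1ℚ)) (moment N) n +ℚ conv (dp 1ℚ) (moment N) n)
    ≡⟨ cong (½ *ℚ_) (cong₂ _+ℚ_ (shifted (-ℚ 1ℚ)) (trans (shifted 1ℚ) (abel-cong N (λ m → cong (λ t → dp t n) (lemma₃ m))))) ⟩
  ½ *ℚ (abel N (λ m → dp (X m +ℚ (-ℚ 1ℚ)) n) +ℚ abel N (λ m → dp (X (suc m) +ℚ (-ℚ 1ℚ)) n))
    ≡⟨ cong (½ *ℚ_) (abel-shift N (λ m → dp (X m +ℚ (-ℚ 1ℚ)) n) (deg-weaken (λ m → dp (X m +ℚ (-ℚ 1ℚ)) n) n≤N (deg-dp (-ℚ 1ℚ) n))) ⟩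
  ½ *ℚ dp (-ℚ 1ℚ) n
    ≡⟨ cong (½ *ℚ_) (trans (dp-minusOne n) (cong (λ t → (-ℚ t) *ℚ invFact n) (sign-dbl j))) ⟩
  ½ *ℚ ((-ℚ 1ℚ) *ℚ invFact n)
    ≡⟨ lemma₄ (invFact n) ⟩
  -½ *ℚ invFact n ∎
  where
  n = suc (dbl j)
  halves : Series
  halves = (λ k → 0ℚ +ℚ ½ *ℚ dp 1ℚ k) ⊞ ½ · dp (-ℚ 1ℚ)
  shifted : ∀ c → conv (dp c) (moment N) n ≡ abel N (λ m → dp (X m +ℚ c) n)
  shifted c = trans (conv-comm (dp c) (moment N) n) (trans (sym (abel-conv N (λ m → dp (X m)) (dp c) n)) (abel-cong N (λ m → sym (dp-+ (X m) c n))))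
  lemma₁ : ∀ x y → ½ *ℚ (x +ℚ y) ≡ (0ℚ +ℚ ½ *ℚ x) +ℚ ½ *ℚ y
  lemma₁ = solve-∀ ringℚ
  lemma₂ : ∀ c x y → c ≡ 0ℚ → (c +ℚ ½ *ℚ x) +ℚ ½ *ℚ y ≡ ½ *ℚ (y +ℚ x)
  lemma₂ c x y refl = l x y
    where
    l : ∀ x y → (0ℚ +ℚ ½ *ℚ x) +ℚ ½ *ℚ y ≡ ½ *ℚ (y +ℚ x)
    l = solve-∀ ringℚ
  lemma₃ : ∀ m → X m +ℚ 1ℚ ≡ X (suc m) +ℚ (-ℚ 1ℚ)
  lemma₃ m = trans (l (X m)) (cong (_+ℚ (-ℚ 1ℚ)) (sym (X-suc m)))
    where
    l : ∀ x → x +ℚ 1ℚ ≡ (x +ℚ 2ℚ) +ℚ (-ℚ 1ℚ)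
    l = solve-∀ ringℚ
  lemma₄ : ∀ x → ½ *ℚ ((-ℚ 1ℚ) *ℚ x) ≡ -½ *ℚ x
  lemma₄ = solve-∀ ringℚ

-- The odd part of Σ (-1)ᵐ exp(2mt) is -½ tanh t. With alternating signs, the odd part of (sec +
-- tan) cos = 1 + sin is the same equation, and the even coefficients of cosh, a series with
-- constant term 1, can be divided out.
moment-odd : ∀ N M → let n = suc (dbl M) in suc (n + n) ≤ N →
  moment N (suc (dbl M)) ≡ -½ *ℚ (signℚ M *ℚ secTan (suc (dbl M)))
moment-odd N M n≤N = conv-cancel M a b ch refl eq M ℕₚ.≤-refl M ℕₚ.≤-refl
  where
  a b ch y : Series
  a i = moment N (suc (dbl i))
  y i = secTan (suc (dbl i))
  b i = -½ *ℚ (signℚ i *ℚ y i)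
  ch i = coshS (dbl i)
  dbl-mono : ∀ {i j} → i ≤ j → dbl i ≤ dbl j
  dbl-mono z≤n     = z≤n
  dbl-mono (s≤s l) = s≤s (s≤s (dbl-mono l))
  eq : ∀ j → j ≤ M → conv a ch j ≡ conv b ch j
  eq j j≤M = begin
    conv a ch j
      ≡⟨ conv-bisect (moment N) coshS coshS-odd j ⟨
    conv (moment N) coshS (suc (dbl j))
      ≡⟨ moment-cosh N j (ℕₚ.≤-trans (s≤s (ℕₚ.+-mono-≤ (s≤s (dbl-mono j≤M)) (s≤s (dbl-mono j≤M)))) n≤N) ⟩
    -½ *ℚ invFact (suc (dbl j))
      ≡⟨ cong (λ t → -½ *ℚ t) (trans (sym (ℚₚ.*-identityˡ (invFact (suc (dbl j))))) (cong (_*ℚ invFact (suc (dbl j))) (sym (sign-square j)))) ⟩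
    -½ *ℚ ((signℚ j *ℚ signℚ j) *ℚ invFact (suc (dbl j)))
      ≡⟨ lemma (signℚ j) (invFact (suc (dbl j))) ⟩
    0ℚ +ℚ -½ *ℚ (signℚ j *ℚ (0ℚ +ℚ signℚ j *ℚ invFact (suc (dbl j))))
      ≡⟨ cong (λ t → 0ℚ +ℚ -½ *ℚ (signℚ j *ℚ (0ℚ +ℚ t))) (sym (sinS-odd j)) ⟩
    0ℚ +ℚ -½ *ℚ (signℚ j *ℚ (0ℚ +ℚ sinS (suc (dbl j))))
      ≡⟨ cong (λ t → 0ℚ +ℚ -½ *ℚ (signℚ j *ℚ t)) (trans (sym (secTan-cos (suc (dbl j)))) (conv-bisect secTan cosS cosS-odd j)) ⟩
    0ℚ +ℚ -½ *ℚ (signℚ j *ℚ conv y (λ i → cosS (dbl i)) j)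
      ≡⟨ cong (λ t → 0ℚ +ℚ -½ *ℚ (signℚ j *ℚ t)) (conv-cong j (λ _ _ → refl) (λ k _ → trans (cosS-even k) (cong (signℚ k *ℚ_) (sym (coshS-even k))))) ⟩
    0ℚ +ℚ -½ *ℚ (signℚ j *ℚ conv y (λ i → signℚ i *ℚ ch i) j)
      ≡⟨ cong₂ (λ s t → s +ℚ -½ *ℚ t) (sym (conv-zeroˡ ch j)) (sym (conv-sign y ch j)) ⟩
    conv (λ _ → 0ℚ) ch j +ℚ -½ *ℚ conv (λ i → signℚ i *ℚ y i) ch j
      ≡⟨ conv-linearˡ (λ _ → 0ℚ) -½ (λ i → signℚ i *ℚ y i) ch j ⟨
    conv ((λ _ → 0ℚ) ⊞ -½ · (λ i → signℚ i *ℚ y i)) ch j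
      ≡⟨ conv-cong j (λ k _ → ℚₚ.+-identityˡ (b k)) (λ _ _ → refl) ⟩
    conv b ch j ∎
    where
    lemma : ∀ s x → -½ *ℚ ((s *ℚ s) *ℚ x) ≡ 0ℚ +ℚ -½ *ℚ (s *ℚ (0ℚ +ℚ s *ℚ x))
    lemma = solve-∀ ringℚ

pow : ℚ → ℕ → ℚ
pow x zero    = 1ℚ
pow x (suc k) = x *ℚ pow x k

pow-dp : ∀ x k → pow x k ≡ ℕtoℚ (fact k) *ℚ dp x k
pow-dp x zero    = refl
pow-dp x (suc k) = begin
  x *ℚ pow x k
    ≡⟨ cong (x *ℚ_) (pow-dp x k) ⟩
  x *ℚ (ℕtoℚ (fact k) *ℚ dp x k)
    ≡⟨ ℚₚ.*-identityˡ _ ⟨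
  1ℚ *ℚ (x *ℚ (ℕtoℚ (fact k) *ℚ dp x k))
    ≡⟨ cong (_*ℚ (x *ℚ (ℕtoℚ (fact k) *ℚ dp x k))) (ℕtoℚ-inverse (suc k)) ⟨
  (ℕtoℚ (suc k) *ℚ recip k) *ℚ (x *ℚ (ℕtoℚ (fact k) *ℚ dp x k))
    ≡⟨ lemma (ℕtoℚ (suc k)) (recip k) x (ℕtoℚ (fact k)) (dp x k) ⟩
  (ℕtoℚ (suc k) *ℚ ℕtoℚ (fact k)) *ℚ (x *ℚ dp x k *ℚ recip k)
    ≡⟨ cong (_*ℚ (x *ℚ dp x k *ℚ recip k)) (ℕtoℚ-* (suc k) (fact k)) ⟨
  ℕtoℚ (fact (suc k)) *ℚ dp x (suc k) ∎
  where
  lemma : ∀ n r x f d → (n *ℚ r) *ℚ (x *ℚ (f *ℚ d)) ≡ (n *ℚ f) *ℚ (x *ℚ d *ℚ r)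
  lemma = solve-∀ ringℚ

-- Σₘ (−1)ᵐ (2m)ᵏ = (−1)^{(k+1)/2} E_k / 2 for odd k, in the sense of Abel.
abel-pow : ∀ N j → let k = suc (dbl j) in suc (k + k) ≤ N → abel N (λ m → pow (X m) k) ≡ -½ *ℚ (signℚ j *ℚ euler k)
abel-pow N j k≤N = begin
  abel N (λ m → pow (X m) k) ≡⟨ abel-cong N (λ m → pow-dp (X m) k) ⟩
  abel N (λ m → ℕtoℚ (fact k) *ℚ dp (X m) k) ≡⟨ abel-* N (ℕtoℚ (fact k)) (λ m → dp (X m) k) ⟩
  ℕtoℚ (fact k) *ℚ moment N k ≡⟨ cong (ℕtoℚ (fact k) *ℚ_) (moment-odd N j k≤N) ⟩
  ℕtoℚ (fact k) *ℚ (-½ *ℚ (signℚ j *ℚ secTan k)) ≡⟨ lemma (ℕtoℚ (fact k)) (signℚ j) (secTan k) ⟩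
  -½ *ℚ (signℚ j *ℚ euler k) ∎
  where
  k = suc (dbl j)
  lemma : ∀ a s y → a *ℚ (-½ *ℚ (s *ℚ y)) ≡ -½ *ℚ (s *ℚ (a *ℚ y))
  lemma = solve-∀ ringℚ

-- Real and imaginary part of the value at E = i x.
re im : ℚ → Poly → ℚ
re x []       = 0ℚ
re x (c ∷ cs) = ℕtoℚ c -ℚ x *ℚ im x cs
im x []       = 0ℚ
im x (c ∷ cs) = x *ℚ re x cs

mutual
  data EvenP : Poly → Set where
    []  : EvenP []
    _∷_ : ∀ c {cs} → OddP cs → EvenP (c ∷ cs)
  data OddP : Poly → Set where
    []  : OddP []
    _∷_ : ∀ {c cs} → c ≡ 0 → EvenP cs → OddP (c ∷ cs)

umbralFrom : ℕ → Poly → ℚ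
umbralFrom k []       = 0ℚ
umbralFrom k (c ∷ cs) = ℕtoℚ c *ℚ euler k +ℚ umbralFrom (suc k) cs

umbral≡umbralFrom : ∀ cs → umbral cs ≡ umbralFrom 0 cs
umbral≡umbralFrom cs = go cs 0 id (λ _ → refl)
  where
  go : ∀ cs k g → (∀ i → g i ≡ k + i) →
    sumℚ (zipWith (λ c k → ℕtoℚ c *ℚ euler k) cs (applyUpTo g (length cs))) ≡ umbralFrom k cs
  go []       k g e = refl
  go (c ∷ cs) k g e = cong₂ (λ i t → ℕtoℚ c *ℚ euler i +ℚ t) (trans (e 0) (ℕₚ.+-identityʳ k))
    (go cs (suc k) (g ∘ suc) (λ i → trans (e (suc i)) (ℕₚ.+-suc k i)))

-- The accumulated power stands for E²ʲ, which takes the value (-1)ʲ x²ʲ at E = ix; the sign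
-- `signℚ j` records it. The parity predicates ensure that only odd powers reach `abel-pow`.
abel-im : ∀ N j cs → OddP cs → suc ((dbl j + length cs) + (dbl j + length cs)) ≤ N →
  abel N (λ m → pow (X m) (dbl j) *ℚ im (X m) cs) ≡ -½ *ℚ (signℚ j *ℚ umbralFrom (dbl j) cs)
abel-re : ∀ N j cs → EvenP cs → suc ((suc (dbl j) + length cs) + (suc (dbl j) + length cs)) ≤ N →
  abel N (λ m → pow (X m) (suc (dbl j)) *ℚ re (X m) cs) ≡ -½ *ℚ (signℚ j *ℚ umbralFrom (suc (dbl j)) cs)
abel-im N j [] [] l = trans (trans (abel-cong N (λ m → ℚₚ.*-zeroʳ (pow (X m) (dbl j)))) (abel-zero N)) (lemma (signℚ j))
  where
  lemma : ∀ s → 0ℚ ≡ -½ *ℚ (s *ℚ 0ℚ)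
  lemma = solve-∀ ringℚ
abel-im N j (.0 ∷ cs) (refl ∷ ev) l = begin
  abel N (λ m → pow (X m) (dbl j) *ℚ (X m *ℚ re (X m) cs))
    ≡⟨ abel-cong N (λ m → lemma (pow (X m) (dbl j)) (X m) (re (X m) cs)) ⟩
  abel N (λ m → pow (X m) (suc (dbl j)) *ℚ re (X m) cs)
    ≡⟨ abel-re N j cs ev (subst (λ t → suc (t + t) ≤ N) (ℕₚ.+-suc (dbl j) (length cs)) l) ⟩
  -½ *ℚ (signℚ j *ℚ umbralFrom (suc (dbl j)) cs)
    ≡⟨ lemma′ (signℚ j) (euler (dbl j)) (umbralFrom (suc (dbl j)) cs) ⟩
  -½ *ℚ (signℚ j *ℚ (0ℚ *ℚ euler (dbl j) +ℚ umbralFrom (suc (dbl j)) cs)) ∎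
  where
  lemma : ∀ a x b → a *ℚ (x *ℚ b) ≡ (x *ℚ a) *ℚ b
  lemma = solve-∀ ringℚ
  lemma′ : ∀ s e u → -½ *ℚ (s *ℚ u) ≡ -½ *ℚ (s *ℚ (0ℚ *ℚ e +ℚ u))
  lemma′ = solve-∀ ringℚ
abel-re N j [] [] l = trans (trans (abel-cong N (λ m → ℚₚ.*-zeroʳ (pow (X m) (suc (dbl j))))) (abel-zero N)) (lemma (signℚ j))
  where
  lemma : ∀ s → 0ℚ ≡ -½ *ℚ (s *ℚ 0ℚ)
  lemma = solve-∀ ringℚ
abel-re N j (c ∷ cs) (.c ∷ od) l = begin
  abel N (λ m → pow (X m) k *ℚ (ℕtoℚ c -ℚ X m *ℚ im (X m) cs))
    ≡⟨ abel-cong N (λ m → lemma (pow (X m) k) (ℕtoℚ c) (X m) (im (X m) cs)) ⟩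
  abel N (λ m → ℕtoℚ c *ℚ pow (X m) k +ℚ (-ℚ 1ℚ) *ℚ (pow (X m) (suc k) *ℚ im (X m) cs))
    ≡⟨ abel-linear N (λ m → ℕtoℚ c *ℚ pow (X m) k) (-ℚ 1ℚ) (λ m → pow (X m) (suc k) *ℚ im (X m) cs) ⟩
  abel N (λ m → ℕtoℚ c *ℚ pow (X m) k) +ℚ (-ℚ 1ℚ) *ℚ abel N (λ m → pow (X m) (suc k) *ℚ im (X m) cs)
    ≡⟨ cong₂ (λ s t → s +ℚ (-ℚ 1ℚ) *ℚ t)
         (trans (abel-* N (ℕtoℚ c) (λ m → pow (X m) k)) (cong (ℕtoℚ c *ℚ_) (abel-pow N j (ℕₚ.≤-trans (s≤s (ℕₚ.+-mono-≤ (ℕₚ.m≤m+n k (suc (length cs))) (ℕₚ.m≤m+n k (suc (length cs))))) l))))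
         (abel-im N (suc j) cs od (subst (λ t → suc (t + t) ≤ N) (cong suc (ℕₚ.+-suc (dbl j) (length cs))) l)) ⟩
  ℕtoℚ c *ℚ (-½ *ℚ (signℚ j *ℚ euler k)) +ℚ (-ℚ 1ℚ) *ℚ (-½ *ℚ ((-ℚ signℚ j) *ℚ umbralFrom (suc k) cs))
    ≡⟨ lemma′ (ℕtoℚ c) (signℚ j) (euler k) (umbralFrom (suc k) cs) ⟩
  -½ *ℚ (signℚ j *ℚ (ℕtoℚ c *ℚ euler k +ℚ umbralFrom (suc k) cs)) ∎
  where
  k = suc (dbl j)
  lemma : ∀ a c x b → a *ℚ (c -ℚ x *ℚ b) ≡ c *ℚ a +ℚ (-ℚ 1ℚ) *ℚ ((x *ℚ a) *ℚ b)
  lemma = solve-∀ ringℚ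
  lemma′ : ∀ c s e u → c *ℚ (-½ *ℚ (s *ℚ e)) +ℚ (-ℚ 1ℚ) *ℚ (-½ *ℚ ((-ℚ s) *ℚ u)) ≡ -½ *ℚ (s *ℚ (c *ℚ e +ℚ u))
  lemma′ = solve-∀ ringℚ

abel-umbral : ∀ N cs → OddP cs → suc (length cs + length cs) ≤ N → abel N (λ m → im (X m) cs) ≡ -½ *ℚ umbral cs
abel-umbral N cs od l = trans (abel-cong N (λ m → sym (ℚₚ.*-identityˡ (im (X m) cs))))
  (trans (abel-im N 0 cs od l) (cong (λ t → -½ *ℚ t) (trans (ℚₚ.*-identityˡ _) (sym (umbral≡umbralFrom cs)))))

even-add : ∀ {f g} → EvenP f → EvenP g → EvenP (addP f g)
odd-add  : ∀ {f g} → OddP f → OddP g → OddP (addP f g)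
even-add []      e        = e
even-add (c ∷ o) []       = c ∷ o
even-add (c ∷ o) (d ∷ o′) = _ ∷ odd-add o o′
odd-add []         o           = o
odd-add (z ∷ e)    []          = z ∷ e
odd-add (refl ∷ e) (refl ∷ e′) = refl ∷ even-add e e′

even-scale : ∀ c {f} → EvenP f → EvenP (scaleP c f)
odd-scale  : ∀ c {f} → OddP f → OddP (scaleP c f)
even-scale c []      = []
even-scale c (d ∷ o) = _ ∷ odd-scale c o
odd-scale c []         = []
odd-scale c (refl ∷ e) = ℕₚ.*-zeroʳ c ∷ even-scale c e

even-zero : ∀ f → EvenP (scaleP 0 f)
odd-zero  : ∀ f → OddP (scaleP 0 f)
even-zero []      = []
even-zero (c ∷ f) = 0 ∷ odd-zero f
odd-zero []      = []
odd-zero (c ∷ f) = refl ∷ even-zero f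

even*even : ∀ {f g} → EvenP f → EvenP g → EvenP (mulP f g)
odd*even  : ∀ {f g} → OddP f → EvenP g → OddP (mulP f g)
even*even []      e = []
even*even (c ∷ o) e = even-add (even-scale c e) (0 ∷ odd*even o e)
odd*even []                  e = []
odd*even {g = g} (refl ∷ e′) e = odd-add (odd-zero g) (refl ∷ even*even e′ e)

even*odd : ∀ {f g} → EvenP f → OddP g → OddP (mulP f g)
odd*odd  : ∀ {f g} → OddP f → OddP g → EvenP (mulP f g)
even*odd []      o′ = []
even*odd (c ∷ o) o′ = odd-add (odd-scale c o′) (refl ∷ odd*odd o o′)
odd*odd []                 o = []
odd*odd {g = g} (refl ∷ e) o = even-add (even-zero g) (0 ∷ even*odd e o)

varE-odd : OddP varE
varE-odd = refl ∷ (1 ∷ [])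

quadP-even : ∀ c → EvenP (quadP c)
quadP-even c = c ∷ (refl ∷ (1 ∷ []))

varE-even-power : ∀ j → EvenP (powP varE (dbl j))
varE-odd-power  : ∀ j → OddP (powP varE (suc (dbl j)))
varE-even-power zero    = 1 ∷ []
varE-even-power (suc j) = odd*odd varE-odd (varE-odd-power j)
varE-odd-power j = odd*even varE-odd (varE-even-power j)

even-power : ∀ {f} → EvenP f → ∀ k → EvenP (powP f k)
even-power e zero    = 1 ∷ []
even-power e (suc k) = even*even e (even-power e k)

even-product : ∀ {fs} → All EvenP fs → EvenP (prodP fs)
even-product []       = 1 ∷ []
even-product (e ∷ es) = even*even e (even-product es)

numerator-odd : ∀ j → OddP (numerator (suc (dbl j)))
numerator-odd j = odd*even (varE-odd-power j) (even-product (all (range1 (dbl j))))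
  where
  all : ∀ is → All EvenP (map (λ i → powP (quadP ((2 * i) ^ 2)) (suc (dbl j) ∸ i)) is)
  all []       = []
  all (i ∷ is) = even-power (quadP-even ((2 * i) ^ 2)) (suc (dbl j) ∸ i) ∷ all is

-- The numerator and the hook product

Π< : ℕ → (ℕ → ℚ) → ℚ
Π< zero    f = 1ℚ
Π< (suc n) f = Π< n f *ℚ f n

Π<-cong : ∀ n {f g} → (∀ i → f i ≡ g i) → Π< n f ≡ Π< n g
Π<-cong zero    e = refl
Π<-cong (suc n) e = cong₂ _*ℚ_ (Π<-cong n e) (e n)

Π<-front : ∀ n f → Π< (suc n) f ≡ f 0 *ℚ Π< n (f ∘ suc)
Π<-front zero    f = ℚₚ.*-comm 1ℚ (f 0)
Π<-front (suc n) f = trans (cong (_*ℚ f (suc n)) (Π<-front n f)) (ℚₚ.*-assoc (f 0) (Π< n (f ∘ suc)) (f (suc n)))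

Π<-* : ∀ n f g → Π< n (λ i → f i *ℚ g i) ≡ Π< n f *ℚ Π< n g
Π<-* zero    f g = refl
Π<-* (suc n) f g = trans (cong (_*ℚ (f n *ℚ g n)) (Π<-* n f g)) (lemma (Π< n f) (Π< n g) (f n) (g n))
  where
  lemma : ∀ a b c d → (a *ℚ b) *ℚ (c *ℚ d) ≡ (a *ℚ c) *ℚ (b *ℚ d)
  lemma = solve-∀ ringℚ

Π<-const : ∀ n x → Π< n (λ _ → x) ≡ pow x n
Π<-const zero    x = refl
Π<-const (suc n) x = trans (cong (_*ℚ x) (Π<-const n x)) (ℚₚ.*-comm (pow x n) x)

-- The product (s + 1)(s + 2)⋯(s + d): the hooks in a row of `d` cells of a rectangle with `s` rows
-- below it.
rise : ℕ → ℕ → ℕ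
rise s zero    = 1
rise s (suc d) = (suc d + s) * rise s d

rise-front : ∀ s d → rise s (suc d) ≡ suc s * rise (suc s) d
rise-front s zero    = refl
rise-front s (suc d) = trans (cong ((suc (suc d) + s) *_) (rise-front s d)) (lemma s d (rise (suc s) d))
  where
  lemma : ∀ s d r → (suc (suc d) + s) * (suc s * r) ≡ suc s * ((suc d + suc s) * r)
  lemma = solve-∀ℕ

-- The hook product of a rectangle with `c` rows and `d` columns, taken row by row.
hooks : ℕ → ℕ → ℕ
hooks zero    d = 1
hooks (suc c) d = rise c d * hooks c d

hooks-suc : ∀ c d → hooks c (suc d) ≡ hooks c d * rise d c
hooks-suc zero    d = refl
hooks-suc (suc c) d = trans (cong (rise c (suc d) *_) (hooks-suc c d)) (lemma c d (rise c d) (hooks c d) (rise d c))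
  where
  lemma : ∀ c d x h y → ((suc d + c) * x) * (h * y) ≡ (x * h) * ((suc c + d) * y)
  lemma = solve-∀ℕ

-- oddSquares b = Π_{k=1}^{b} 4 (2k − 1) (2k + 1)
oddSquares : ℕ → ℕ
oddSquares zero    = 1
oddSquares (suc k) = 4 * (suc (k + k) * suc (suc k + suc k)) * oddSquares k

rise-double : ∀ p → rise (suc p) (suc p) ≡ 2 * suc (p + p) * rise p p
rise-double p = ℕₚ.*-cancelˡ-≡ _ _ (suc p) (trans (sym (rise-front p (suc p))) (lemma p (rise p p)))
  where
  lemma : ∀ p r → (suc (suc p) + p) * ((suc p + p) * r) ≡ suc p * (2 * suc (p + p) * r)
  lemma = solve-∀ℕ

oddSquares-rise : ∀ p → oddSquares p ≡ suc (p + p) * (rise p p * rise p p)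
oddSquares-rise zero    = refl
oddSquares-rise (suc p) = trans (cong (4 * (suc (p + p) * suc (suc p + suc p)) *_) (oddSquares-rise p))
  (trans (lemma p (rise p p)) (cong (λ t → suc (suc p + suc p) * (t * t)) (sym (rise-double p))))
  where
  lemma : ∀ p r → 4 * (suc (p + p) * suc (suc p + suc p)) * (suc (p + p) * (r * r)) ≡ suc (suc p + suc p) * ((2 * suc (p + p) * r) * (2 * suc (p + p) * r))
  lemma = solve-∀ℕ

-- Enlarging the square adds a corner with hook 2p + 1 and two arms with hooks p + 1, ..., 2p. That
-- their product is `oddSquares p`, built from the denominators of `β`, is the link between hooks
-- and the continued fraction.
hooks-square : ∀ p → hooks (suc p) (suc p) ≡ oddSquares p * hooks p p
hooks-square p = trans (cong (rise p (suc p) *_) (hooks-suc p p)) (trans (lemma p (rise p p) (hooks p p)) (cong (_* hooks p p) (sym (oddSquares-rise p))))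
  where
  lemma : ∀ p r h → ((suc p + p) * r) * (h * r) ≡ (suc (p + p) * (r * r)) * h
  lemma = solve-∀ℕ

applyUpTo-cong : ∀ {A : Set} n {f g : ℕ → A} → (∀ i → i < n → f i ≡ g i) → applyUpTo f n ≡ applyUpTo g n
applyUpTo-cong zero    e = refl
applyUpTo-cong (suc n) e = cong₂ _∷_ (e 0 (s≤s z≤n)) (applyUpTo-cong n (λ i i<n → e (suc i) (s≤s i<n)))

product-concatMap : ∀ (f : ℕ → List ℕ) xs → product (concatMap f xs) ≡ product (map (product ∘ f) xs)
product-concatMap f []       = refl
product-concatMap f (x ∷ xs) = trans (product-++ (f x) (concatMap f xs)) (cong (product (f x) *_) (product-concatMap f xs))

nth-replicate : ∀ {i n} x → i < n → nth i (replicate n x) ≡ x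
nth-replicate {zero}  {suc n} x _       = refl
nth-replicate {suc i} {suc n} x (s≤s l) = nth-replicate x l

countB-all : ∀ {A : Set} (f : A → Bool) x n → f x ≡ true → countB f (replicate n x) ≡ n
countB-all f x zero    e = refl
countB-all f x (suc n) e with f x in eq
countB-all f x (suc n) refl | true = cong suc (countB-all f x n eq)

<⇒<ᵇ-true : ∀ {m n} → m < n → (m <ᵇ n) ≡ true
<⇒<ᵇ-true {m} {n} l with m <ᵇ n | ℕₚ.<⇒<ᵇ l
... | true | _ = refl

≤⇒<ᵇ-false : ∀ {m n} → n ≤ m → (m <ᵇ n) ≡ false
≤⇒<ᵇ-false {m} {n} l with m <ᵇ n in e
... | false = refl
... | true  = ⊥-elim (ℕₚ.<⇒≱ (ℕₚ.<ᵇ⇒< m n (subst T (sym e) tt)) l)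

hook-square : ∀ p i j → i < p → j < p → hook (square p) i j ≡ (p ∸ j) + (p ∸ suc i)
hook-square p i j i<p j<p = begin
  ((nth i (square p) ∸ j) + (conj (square p) j ∸ i)) ∸ 1
    ≡⟨ cong₂ (λ a b → ((a ∸ j) + (b ∸ i)) ∸ 1) (nth-replicate p i<p) (countB-all (j <ᵇ_) p p (<⇒<ᵇ-true j<p)) ⟩
  ((p ∸ j) + (p ∸ i)) ∸ 1
    ≡⟨ cong (λ t → ((p ∸ j) + t) ∸ 1) (p∸i i<p) ⟩
  ((p ∸ j) + suc (p ∸ suc i)) ∸ 1
    ≡⟨ cong (_∸ 1) (ℕₚ.+-suc (p ∸ j) (p ∸ suc i)) ⟩
  (p ∸ j) + (p ∸ suc i) ∎
  where
  p∸i : ∀ {p i} → i < p → p ∸ i ≡ suc (p ∸ suc i)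
  p∸i {suc p} {zero}  _       = refl
  p∸i {suc p} {suc i} (s≤s l) = p∸i l

hookProduct-square : ∀ p → hookProduct (square p) ≡ hooks p p
hookProduct-square p = begin
  hookProduct (square p)
    ≡⟨ cong (λ n → product (concatMap rowHooks (upTo n))) (length-replicate p) ⟩
  product (concatMap rowHooks (upTo p))
    ≡⟨ product-concatMap rowHooks (upTo p) ⟩
  product (map (product ∘ rowHooks) (upTo p))
    ≡⟨ cong product (map-upTo (product ∘ rowHooks) p) ⟩
  product (applyUpTo (product ∘ rowHooks) p)
    ≡⟨ cong product (applyUpTo-cong p rowProduct) ⟩
  product (applyUpTo (λ i → rise (p ∸ suc i) p) p)
    ≡⟨ outer p p ⟩
  hooks p p ∎
  where
  rowHooks : ℕ → List ℕ
  rowHooks i = map (λ j → hook (square p) i j) (upTo (nth i (square p)))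
  inner : ∀ s d → product (applyUpTo (λ j → (d ∸ j) + s) d) ≡ rise s d
  inner s zero    = refl
  inner s (suc d) = cong ((suc d + s) *_) (inner s d)
  outer : ∀ c d → product (applyUpTo (λ i → rise (c ∸ suc i) d) c) ≡ hooks c d
  outer zero    d = refl
  outer (suc c) d = cong (rise c d *_) (outer c d)
  rowProduct : ∀ i → i < p → product (rowHooks i) ≡ rise (p ∸ suc i) p
  rowProduct i i<p = begin
    product (map (λ j → hook (square p) i j) (upTo (nth i (square p))))
      ≡⟨ cong (λ n → product (map (λ j → hook (square p) i j) (upTo n))) (nth-replicate p i<p) ⟩
    product (map (λ j → hook (square p) i j) (upTo p))
      ≡⟨ cong product (trans (map-upTo (λ j → hook (square p) i j) p) (applyUpTo-cong p (λ j j<p → hook-square p i j i<p j<p))) ⟩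
    product (applyUpTo (λ j → (p ∸ j) + (p ∸ suc i)) p)
      ≡⟨ inner (p ∸ suc i) p ⟩
    rise (p ∸ suc i) p ∎

-- Values of the numerator on the imaginary axis

re-add : ∀ x f g → re x (addP f g) ≡ re x f +ℚ re x g
im-add : ∀ x f g → im x (addP f g) ≡ im x f +ℚ im x g
re-add x []      g       = sym (ℚₚ.+-identityˡ (re x g))
re-add x (c ∷ f) []      = sym (ℚₚ.+-identityʳ (re x (c ∷ f)))
re-add x (c ∷ f) (d ∷ g) = trans (cong₂ (λ a b → a -ℚ x *ℚ b) (ℕtoℚ-+ c d) (im-add x f g)) (lemma (ℕtoℚ c) (ℕtoℚ d) x (im x f) (im x g))
  where
  lemma : ∀ c d x a b → (c +ℚ d) -ℚ x *ℚ (a +ℚ b) ≡ (c -ℚ x *ℚ a) +ℚ (d -ℚ x *ℚ b)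
  lemma = solve-∀ ringℚ
im-add x []      g       = sym (ℚₚ.+-identityˡ (im x g))
im-add x (c ∷ f) []      = sym (ℚₚ.+-identityʳ (im x (c ∷ f)))
im-add x (c ∷ f) (d ∷ g) = trans (cong (x *ℚ_) (re-add x f g)) (ℚₚ.*-distribˡ-+ x (re x f) (re x g))

re-scale : ∀ x c f → re x (scaleP c f) ≡ ℕtoℚ c *ℚ re x f
im-scale : ∀ x c f → im x (scaleP c f) ≡ ℕtoℚ c *ℚ im x f
re-scale x c []      = sym (ℚₚ.*-zeroʳ (ℕtoℚ c))
re-scale x c (d ∷ f) = trans (cong₂ (λ a b → a -ℚ x *ℚ b) (ℕtoℚ-* c d) (im-scale x c f)) (lemma (ℕtoℚ c) (ℕtoℚ d) x (im x f))
  where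
  lemma : ∀ c d x a → c *ℚ d -ℚ x *ℚ (c *ℚ a) ≡ c *ℚ (d -ℚ x *ℚ a)
  lemma = solve-∀ ringℚ
im-scale x c []      = sym (ℚₚ.*-zeroʳ (ℕtoℚ c))
im-scale x c (d ∷ f) = trans (cong (x *ℚ_) (re-scale x c f)) (lemma (ℕtoℚ c) x (re x f))
  where
  lemma : ∀ c x a → x *ℚ (c *ℚ a) ≡ c *ℚ (x *ℚ a)
  lemma = solve-∀ ringℚ

re-mul : ∀ x f g → re x (mulP f g) ≡ re x f *ℚ re x g -ℚ im x f *ℚ im x g
im-mul : ∀ x f g → im x (mulP f g) ≡ re x f *ℚ im x g +ℚ im x f *ℚ re x g
re-mul x []      g = lemma (re x g) (im x g)
  where
  lemma : ∀ a b → 0ℚ ≡ 0ℚ *ℚ a -ℚ 0ℚ *ℚ b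
  lemma = solve-∀ ringℚ
re-mul x (c ∷ f) g = trans (re-add x (scaleP c g) (0 ∷ mulP f g))
  (trans (cong₂ (λ a b → a +ℚ (0ℚ -ℚ x *ℚ b)) (re-scale x c g) (im-mul x f g)) (lemma (ℕtoℚ c) x (re x f) (im x f) (re x g) (im x g)))
  where
  lemma : ∀ c x a b a′ b′ → c *ℚ a′ +ℚ (0ℚ -ℚ x *ℚ (a *ℚ b′ +ℚ b *ℚ a′)) ≡ (c -ℚ x *ℚ b) *ℚ a′ -ℚ (x *ℚ a) *ℚ b′
  lemma = solve-∀ ringℚ
im-mul x []      g = lemma (re x g) (im x g)
  where
  lemma : ∀ a b → 0ℚ ≡ 0ℚ *ℚ b +ℚ 0ℚ *ℚ a
  lemma = solve-∀ ringℚ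
im-mul x (c ∷ f) g = trans (im-add x (scaleP c g) (0 ∷ mulP f g))
  (trans (cong₂ (λ a b → a +ℚ x *ℚ b) (im-scale x c g) (re-mul x f g)) (lemma (ℕtoℚ c) x (re x f) (im x f) (re x g) (im x g)))
  where
  lemma : ∀ c x a b a′ b′ → c *ℚ b′ +ℚ x *ℚ (a *ℚ a′ -ℚ b *ℚ b′) ≡ (c -ℚ x *ℚ b) *ℚ b′ +ℚ (x *ℚ a) *ℚ a′
  lemma = solve-∀ ringℚ

record RealAt (x : ℚ) (f : Poly) (r : ℚ) : Set where
  constructor real
  field
    re≡ : re x f ≡ r
    im≡ : im x f ≡ 0ℚ
open RealAt

real-one : ∀ x → RealAt x (1 ∷ []) 1ℚ
real-one x = real (lemma x) (ℚₚ.*-zeroʳ x)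
  where
  lemma : ∀ x → 1ℚ -ℚ x *ℚ 0ℚ ≡ 1ℚ
  lemma = solve-∀ ringℚ

real-mul : ∀ {x f g r s} → RealAt x f r → RealAt x g s → RealAt x (mulP f g) (r *ℚ s)
real-mul {x} {f} {g} {r} {s} (real a b) (real c d) = real
  (trans (re-mul x f g) (trans (cong₂ _-ℚ_ (cong₂ _*ℚ_ a c) (cong₂ _*ℚ_ b d)) (lemma₁ r s)))
  (trans (im-mul x f g) (trans (cong₂ _+ℚ_ (cong₂ _*ℚ_ a d) (cong₂ _*ℚ_ b c)) (lemma₂ r s)))
  where
  lemma₁ : ∀ r s → r *ℚ s -ℚ 0ℚ *ℚ 0ℚ ≡ r *ℚ s
  lemma₁ = solve-∀ ringℚ
  lemma₂ : ∀ r s → r *ℚ 0ℚ +ℚ 0ℚ *ℚ s ≡ 0ℚ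
  lemma₂ = solve-∀ ringℚ

real-pow : ∀ {x f r} → RealAt x f r → ∀ k → RealAt x (powP f k) (pow r k)
real-pow {x} ra zero    = real-one x
real-pow     ra (suc k) = real-mul ra (real-pow ra k)

real-quad : ∀ x c → RealAt x (quadP c) (ℕtoℚ c -ℚ x *ℚ x)
real-quad x c = real (lemma₁ (ℕtoℚ c) x) (lemma₂ x)
  where
  lemma₁ : ∀ c x → c -ℚ x *ℚ (x *ℚ (1ℚ -ℚ x *ℚ 0ℚ)) ≡ c -ℚ x *ℚ x
  lemma₁ = solve-∀ ringℚ
  lemma₂ : ∀ x → x *ℚ (0ℚ -ℚ x *ℚ (x *ℚ 0ℚ)) ≡ 0ℚ
  lemma₂ = solve-∀ ringℚ

powers : ℕ → (ℕ → ℚ) → ℚ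
powers zero    f = 1ℚ
powers (suc n) f = pow (f 0) (suc n) *ℚ powers n (f ∘ suc)

real-powers : ∀ x n (c : ℕ → ℕ) →
  RealAt x (prodP (applyUpTo (λ i → powP (quadP (c i)) (n ∸ i)) n)) (powers n (λ i → ℕtoℚ (c i) -ℚ x *ℚ x))
real-powers x zero    c = real-one x
real-powers x (suc n) c = real-mul (real-pow (real-quad x (c 0)) (suc n)) (real-powers x n (c ∘ suc))

powers-snoc : ∀ n f → powers (suc n) f ≡ powers n f *ℚ Π< (suc n) f
powers-snoc zero    f = lemma (f 0)
  where
  lemma : ∀ x → (x *ℚ 1ℚ) *ℚ 1ℚ ≡ 1ℚ *ℚ (1ℚ *ℚ x)
  lemma = solve-∀ ringℚ
powers-snoc (suc n) f = begin
  pow (f 0) (2 + n) *ℚ powers (suc n) (f ∘ suc)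
    ≡⟨ cong (pow (f 0) (2 + n) *ℚ_) (powers-snoc n (f ∘ suc)) ⟩
  (f 0 *ℚ pow (f 0) (suc n)) *ℚ (powers n (f ∘ suc) *ℚ Π< (suc n) (f ∘ suc))
    ≡⟨ lemma (f 0) (pow (f 0) (suc n)) (powers n (f ∘ suc)) (Π< (suc n) (f ∘ suc)) ⟩
  (pow (f 0) (suc n) *ℚ powers n (f ∘ suc)) *ℚ (f 0 *ℚ Π< (suc n) (f ∘ suc))
    ≡⟨ cong (powers (suc n) f *ℚ_) (Π<-front (suc n) f) ⟨
  powers (suc n) f *ℚ Π< (2 + n) f ∎
  where
  lemma : ∀ a b c d → (a *ℚ b) *ℚ (c *ℚ d) ≡ (b *ℚ c) *ℚ (a *ℚ d)
  lemma = solve-∀ ringℚ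

-- The factor f i occurs in the inner products with i < b ≤ n, that is n - i times, which is its
-- exponent in `powers`.
powers≡Π : ∀ n f → powers n f ≡ Π< (suc n) (λ b → Π< b f)
powers≡Π zero    f = refl
powers≡Π (suc n) f = trans (powers-snoc n f) (cong (_*ℚ Π< (suc n) f) (powers≡Π n f))

varE-powers : ∀ x j → let k = suc (dbl j) in
  (re x (powP varE k) ≡ 0ℚ) × (im x (powP varE k) ≡ signℚ j *ℚ pow x k)
varE-powers x j = go j
  where
  re-varE : re x varE ≡ 0ℚ
  re-varE = lemma x
    where
    lemma : ∀ x → 0ℚ -ℚ x *ℚ (x *ℚ 0ℚ) ≡ 0ℚ
    lemma = solve-∀ ringℚ
  im-varE : im x varE ≡ x
  im-varE = lemma x
    where
    lemma : ∀ x → x *ℚ (1ℚ -ℚ x *ℚ 0ℚ) ≡ x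
    lemma = solve-∀ ringℚ
  re-step : ∀ f → re x (mulP varE f) ≡ (-ℚ x) *ℚ im x f
  re-step f = trans (re-mul x varE f) (trans (cong₂ (λ a b → a *ℚ re x f -ℚ b *ℚ im x f) re-varE im-varE) (lemma x (re x f) (im x f)))
    where
    lemma : ∀ x a b → 0ℚ *ℚ a -ℚ x *ℚ b ≡ (-ℚ x) *ℚ b
    lemma = solve-∀ ringℚ
  im-step : ∀ f → im x (mulP varE f) ≡ x *ℚ re x f
  im-step f = trans (im-mul x varE f) (trans (cong₂ (λ a b → a *ℚ im x f +ℚ b *ℚ re x f) re-varE im-varE) (lemma x (re x f) (im x f)))
    where
    lemma : ∀ x a b → 0ℚ *ℚ b +ℚ x *ℚ a ≡ x *ℚ a
    lemma = solve-∀ ringℚ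
  go : ∀ j → let k = suc (dbl j) in (re x (powP varE k) ≡ 0ℚ) × (im x (powP varE k) ≡ signℚ j *ℚ pow x k)
  go zero    = trans (re-step (1 ∷ [])) (lemma₁ x) , trans (im-step (1 ∷ [])) (lemma₂ x)
    where
    lemma₁ : ∀ x → (-ℚ x) *ℚ (x *ℚ 0ℚ) ≡ 0ℚ
    lemma₁ = solve-∀ ringℚ
    lemma₂ : ∀ x → x *ℚ (1ℚ -ℚ x *ℚ 0ℚ) ≡ 1ℚ *ℚ (x *ℚ 1ℚ)
    lemma₂ = solve-∀ ringℚ
  go (suc j) =
    trans (re-step (powP varE (2 + dbl j))) (trans (cong ((-ℚ x) *ℚ_) (trans (im-step (powP varE k)) (cong (x *ℚ_) (proj₁ (go j))))) (lemma₁ x)) ,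
    trans (im-step (powP varE (2 + dbl j))) (trans (cong (x *ℚ_) (trans (re-step (powP varE k)) (cong ((-ℚ x) *ℚ_) (proj₂ (go j))))) (lemma₂ x (signℚ j) (pow x k)))
    where
    k = suc (dbl j)
    lemma₁ : ∀ x → (-ℚ x) *ℚ (x *ℚ 0ℚ) ≡ 0ℚ
    lemma₁ = solve-∀ ringℚ
    lemma₂ : ∀ x s y → x *ℚ ((-ℚ x) *ℚ (s *ℚ y)) ≡ (-ℚ s) *ℚ (x *ℚ (x *ℚ y))
    lemma₂ = solve-∀ ringℚ

quadValue : ℚ → ℕ → ℚ
quadValue x i = ℕtoℚ ((2 * suc i) ^ 2) -ℚ x *ℚ x

-- At E = ix the factors E² + c are real, so the imaginary part comes from the odd power of E alone.
im-numerator : ∀ x j → let p = suc (dbl j) in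
  im x (numerator p) ≡ (signℚ j *ℚ pow x p) *ℚ Π< p (λ b → Π< b (quadValue x))
im-numerator x j = begin
  im x (mulP (powP varE p) Q)
    ≡⟨ im-mul x (powP varE p) Q ⟩
  re x (powP varE p) *ℚ im x Q +ℚ im x (powP varE p) *ℚ re x Q
    ≡⟨ cong₂ _+ℚ_ (cong₂ _*ℚ_ (proj₁ (varE-powers x j)) (im≡ Q-real)) (cong₂ _*ℚ_ (proj₂ (varE-powers x j)) (trans (re≡ Q-real) (powers≡Π (dbl j) (quadValue x)))) ⟩
  0ℚ *ℚ 0ℚ +ℚ (signℚ j *ℚ pow x p) *ℚ Π< p (λ b → Π< b (quadValue x))
    ≡⟨ ℚₚ.+-identityˡ _ ⟩
  (signℚ j *ℚ pow x p) *ℚ Π< p (λ b → Π< b (quadValue x)) ∎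
  where
  p = suc (dbl j)
  Q : Poly
  Q = prodP (map (λ i → powP (quadP ((2 * i) ^ 2)) (p ∸ i)) (range1 (dbl j)))
  Q-real : RealAt x Q (powers (dbl j) (quadValue x))
  Q-real = subst (λ fs → RealAt x (prodP fs) (powers (dbl j) (quadValue x)))
    (sym (trans (sym (map-∘ (upTo (dbl j)))) (map-upTo (λ i → powP (quadP ((2 * suc i) ^ 2)) (dbl j ∸ i)) (dbl j))))
    (real-powers x (dbl j) (λ i → (2 * suc i) ^ 2))

-- The sign of reversing `c` rows, -1 to the power c(c - 1)/2. For c = 2j + 1 it agrees with the
-- sign in i²ʲ⁺¹ = (-1)ʲ i.
reversalSign : ℕ → ℚ
reversalSign zero    = 1ℚ
reversalSign (suc c) = signℚ c *ℚ reversalSign c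

reversalSign-odd : ∀ j → reversalSign (suc (dbl j)) ≡ signℚ j
reversalSign-odd zero    = refl
reversalSign-odd (suc j) = trans (cong₂ (λ s t → (-ℚ (-ℚ s)) *ℚ ((-ℚ s) *ℚ t)) (sign-dbl j) (reversalSign-odd j)) (lemma (signℚ j))
  where
  lemma : ∀ t → (-ℚ (-ℚ 1ℚ)) *ℚ ((-ℚ 1ℚ) *ℚ t) ≡ -ℚ t
  lemma = solve-∀ ringℚ

hooks≡Π : ∀ p → ℕtoℚ (hooks p p) ≡ Π< p (λ b → ℕtoℚ (oddSquares b))
hooks≡Π zero    = refl
hooks≡Π (suc p) = trans (cong ℕtoℚ (trans (hooks-square p) (ℕₚ.*-comm (oddSquares p) (hooks p p))))
  (trans (ℕtoℚ-* (hooks p p) (oddSquares p)) (cong (_*ℚ ℕtoℚ (oddSquares p)) (hooks≡Π p)))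

module Evaluate (m : ℕ) where
  open Hankel m

  diagonal≡Π : ∀ c b → diagonal c b ≡ reversalSign c *ℚ Π< c (λ i → R (i + b) (i + b))
  diagonal≡Π zero    b = refl
  diagonal≡Π (suc c) b = begin
    signℚ c *ℚ (R b b *ℚ diagonal c (suc b))
      ≡⟨ cong (λ t → signℚ c *ℚ (R b b *ℚ t)) (trans (diagonal≡Π c (suc b)) (cong (reversalSign c *ℚ_) (Π<-cong c (λ i → cong (λ k → R k k) (ℕₚ.+-suc i b))))) ⟩
    signℚ c *ℚ (R b b *ℚ (reversalSign c *ℚ Π< c (λ i → R (suc i + b) (suc i + b))))
      ≡⟨ lemma (signℚ c) (R b b) (reversalSign c) (Π< c (λ i → R (suc i + b) (suc i + b))) ⟩
    (signℚ c *ℚ reversalSign c) *ℚ (R b b *ℚ Π< c (λ i → R (suc i + b) (suc i + b)))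
      ≡⟨ cong (reversalSign (suc c) *ℚ_) (Π<-front c (λ i → R (i + b) (i + b))) ⟨
    reversalSign (suc c) *ℚ Π< (suc c) (λ i → R (i + b) (i + b)) ∎
    where
    lemma : ∀ s r t y → s *ℚ (r *ℚ (t *ℚ y)) ≡ (s *ℚ t) *ℚ (r *ℚ y)
    lemma = solve-∀ ringℚ

  quadValue-βnum : ∀ k → quadValue (X m) k ≡ ℕtoℚ 4 *ℚ βnum k
  quadValue-βnum k = trans (cong (_-ℚ X m *ℚ X m) (trans (ℕtoℚ-* (2 * suc k) (2 * suc k * 1)) (cong₂ _*ℚ_ (ℕtoℚ-* 2 (suc k)) (trans (cong ℕtoℚ (ℕₚ.*-identityʳ (2 * suc k))) (ℕtoℚ-* 2 (suc k))))))
    (lemma (ℕtoℚ (suc k)) z)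
    where
    lemma : ∀ k z → (2ℚ *ℚ k) *ℚ (2ℚ *ℚ k) -ℚ (2ℚ *ℚ z) *ℚ (2ℚ *ℚ z) ≡ (2ℚ +ℚ 2ℚ) *ℚ (k *ℚ k -ℚ z *ℚ z)
    lemma = solve-∀ ringℚ

  -- Each diagonal step contributes `β k`. The factor 4 (2k + 1)(2k + 3) of `oddSquares` clears its
  -- denominator and turns its numerator into (2k + 2)² - (2m)².
  R-oddSquares : ∀ b → R b b *ℚ ℕtoℚ (oddSquares b) ≡ X m *ℚ Π< b (quadValue (X m))
  R-oddSquares zero    = cong (_*ℚ 1ℚ) (q-one m)
  R-oddSquares (suc k) = begin
    R (suc k) (suc k) *ℚ ℕtoℚ (4 * (a * b) * oddSquares k)
      ≡⟨ cong₂ _*ℚ_ (R-diagonal k) (trans (ℕtoℚ-* (4 * (a * b)) (oddSquares k)) (cong (_*ℚ ℕtoℚ (oddSquares k)) (trans (ℕtoℚ-* 4 (a * b)) (cong (ℕtoℚ 4 *ℚ_) (ℕtoℚ-* a b))))) ⟩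
    ((βnum k *ℚ (oddInv k *ℚ oddInv (suc k))) *ℚ R k k) *ℚ ((ℕtoℚ 4 *ℚ (ℕtoℚ a *ℚ ℕtoℚ b)) *ℚ ℕtoℚ (oddSquares k))
      ≡⟨ lemma (βnum k) (oddInv k) (oddInv (suc k)) (R k k) (ℕtoℚ 4) (ℕtoℚ a) (ℕtoℚ b) (ℕtoℚ (oddSquares k)) ⟩
    ((ℕtoℚ a *ℚ oddInv k) *ℚ (ℕtoℚ b *ℚ oddInv (suc k))) *ℚ ((R k k *ℚ ℕtoℚ (oddSquares k)) *ℚ (ℕtoℚ 4 *ℚ βnum k))
      ≡⟨ cong₂ _*ℚ_ (cong₂ _*ℚ_ (ℕtoℚ-inverse a) (ℕtoℚ-inverse b)) (cong₂ _*ℚ_ (R-oddSquares k) (sym (quadValue-βnum k))) ⟩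
    (1ℚ *ℚ 1ℚ) *ℚ ((X m *ℚ Π< k (quadValue (X m))) *ℚ quadValue (X m) k)
      ≡⟨ lemma′ (X m) (Π< k (quadValue (X m))) (quadValue (X m) k) ⟩
    X m *ℚ (Π< k (quadValue (X m)) *ℚ quadValue (X m) k) ∎
    where
    a = suc (k + k)
    b = suc (suc k + suc k)
    lemma : ∀ β u v r f a b o → ((β *ℚ (u *ℚ v)) *ℚ r) *ℚ ((f *ℚ (a *ℚ b)) *ℚ o) ≡ ((a *ℚ u) *ℚ (b *ℚ v)) *ℚ ((r *ℚ o) *ℚ (f *ℚ β))
    lemma = solve-∀ ringℚ
    lemma′ : ∀ x p f → (1ℚ *ℚ 1ℚ) *ℚ ((x *ℚ p) *ℚ f) ≡ x *ℚ (p *ℚ f)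
    lemma′ = solve-∀ ringℚ

  F-square-hooks : ∀ j → let p = suc (dbl j) in
    F p m (squareShape p) *ℚ ℕtoℚ (hookProduct (square p)) ≡ im (X m) (numerator p)
  F-square-hooks j = begin
    F p m (squareShape p) *ℚ ℕtoℚ (hookProduct (square p))
      ≡⟨ cong₂ _*ℚ_ (trans (F-square p) (trans (diagonal≡Π p 0) (cong₂ _*ℚ_ (reversalSign-odd j) (Π<-cong p (λ i → cong (λ k → R k k) (ℕₚ.+-identityʳ i))))))
           (trans (cong ℕtoℚ (hookProduct-square p)) (hooks≡Π p)) ⟩
    (signℚ j *ℚ Π< p (λ i → R i i)) *ℚ Π< p (λ b → ℕtoℚ (oddSquares b))
      ≡⟨ trans (ℚₚ.*-assoc (signℚ j) (Π< p (λ i → R i i)) (Π< p (λ b → ℕtoℚ (oddSquares b)))) (cong (signℚ j *ℚ_) (sym (Π<-* p (λ i → R i i) (λ b → ℕtoℚ (oddSquares b))))) ⟩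
    signℚ j *ℚ Π< p (λ b → R b b *ℚ ℕtoℚ (oddSquares b))
      ≡⟨ cong (signℚ j *ℚ_) (trans (Π<-cong p R-oddSquares) (trans (Π<-* p (λ _ → X m) (λ b → Π< b (quadValue (X m)))) (cong (_*ℚ Π< p (λ b → Π< b (quadValue (X m)))) (Π<-const p (X m))))) ⟩
    signℚ j *ℚ (pow (X m) p *ℚ Π< p (λ b → Π< b (quadValue (X m))))
      ≡⟨ ℚₚ.*-assoc (signℚ j) (pow (X m) p) (Π< p (λ b → Π< b (quadValue (X m)))) ⟨
    (signℚ j *ℚ pow (X m) p) *ℚ Π< p (λ b → Π< b (quadValue (X m)))
      ≡⟨ im-numerator (X m) j ⟨
    im (X m) (numerator p) ∎
    where
    p = suc (dbl j)

abel-square : ∀ N j → let p = suc (dbl j) in suc (length (numerator p) + length (numerator p)) ≤ N →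
  abel N (λ m → F p m (squareShape p)) *ℚ ℕtoℚ (hookProduct (square p)) ≡ -½ *ℚ umbral (numerator p)
abel-square N j l = begin
  abel N (λ m → F p m (squareShape p)) *ℚ H ≡⟨ ℚₚ.*-comm _ H ⟩
  H *ℚ abel N (λ m → F p m (squareShape p)) ≡⟨ abel-* N H (λ m → F p m (squareShape p)) ⟨
  abel N (λ m → H *ℚ F p m (squareShape p)) ≡⟨ abel-cong N (λ m → trans (ℚₚ.*-comm H _) (Evaluate.F-square-hooks m j)) ⟩
  abel N (λ m → im (X m) (numerator p)) ≡⟨ abel-umbral N (numerator p) (numerator-odd j) l ⟩
  -½ *ℚ umbral (numerator p) ∎
  where
  p = suc (dbl j)
  H = ℕtoℚ (hookProduct (square p))

-- Counting words

b→ℕ : Bool → ℕ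
b→ℕ b = if b then 1 else 0

countB-∷ : ∀ {A : Set} (f : A → Bool) x xs → countB f (x ∷ xs) ≡ b→ℕ (f x) + countB f xs
countB-∷ f x xs with f x
... | true  = refl
... | false = refl

countB-++ : ∀ {A : Set} (f : A → Bool) xs ys → countB f (xs ++ ys) ≡ countB f xs + countB f ys
countB-++ f []       ys = refl
countB-++ f (x ∷ xs) ys = begin
  countB f (x ∷ xs ++ ys) ≡⟨ countB-∷ f x (xs ++ ys) ⟩
  b→ℕ (f x) + countB f (xs ++ ys) ≡⟨ cong (_+_ (b→ℕ (f x))) (countB-++ f xs ys) ⟩
  b→ℕ (f x) + (countB f xs + countB f ys) ≡⟨ ℕₚ.+-assoc (b→ℕ (f x)) (countB f xs) (countB f ys) ⟨
  (b→ℕ (f x) + countB f xs) + countB f ys ≡⟨ cong (_+ countB f ys) (countB-∷ f x xs) ⟨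
  countB f (x ∷ xs) + countB f ys ∎

countB-map : ∀ {A B : Set} (f : B → Bool) (g : A → B) xs → countB f (map g xs) ≡ countB (f ∘ g) xs
countB-map f g []       = refl
countB-map f g (x ∷ xs) = trans (countB-∷ f (g x) (map g xs)) (trans (cong (_+_ (b→ℕ (f (g x)))) (countB-map f g xs)) (sym (countB-∷ (f ∘ g) x xs)))

countB-none : ∀ {A : Set} (xs : List A) → countB (λ _ → false) xs ≡ 0
countB-none []       = refl
countB-none (x ∷ xs) = countB-none xs

Σ<-front : ∀ n f → Σ< (suc n) f ≡ f 0 +ℚ Σ< n (f ∘ suc)
Σ<-front zero    f = ℚₚ.+-comm 0ℚ (f 0)
Σ<-front (suc n) f = trans (cong (_+ℚ f (suc n)) (Σ<-front n f)) (ℚₚ.+-assoc (f 0) (Σ< n (f ∘ suc)) (f (suc n)))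

countℚ : {A : Set} → (A → Bool) → List A → ℚ
countℚ f xs = ℕtoℚ (countB f xs)

countℚ-concatMap : ∀ {A : Set} (f : A → Bool) (F : ℕ → List A) g n →
  countℚ f (concatMap F (applyUpTo g n)) ≡ Σ< n (λ i → countℚ f (F (g i)))
countℚ-concatMap f F g zero    = refl
countℚ-concatMap f F g (suc n) = begin
  ℕtoℚ (countB f (F (g 0) ++ concatMap F (applyUpTo (g ∘ suc) n)))
    ≡⟨ cong ℕtoℚ (countB-++ f (F (g 0)) (concatMap F (applyUpTo (g ∘ suc) n))) ⟩
  ℕtoℚ (countB f (F (g 0)) + countB f (concatMap F (applyUpTo (g ∘ suc) n)))
    ≡⟨ ℕtoℚ-+ (countB f (F (g 0))) (countB f (concatMap F (applyUpTo (g ∘ suc) n))) ⟩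
  countℚ f (F (g 0)) +ℚ countℚ f (concatMap F (applyUpTo (g ∘ suc) n))
    ≡⟨ cong (countℚ f (F (g 0)) +ℚ_) (countℚ-concatMap f F (g ∘ suc) n) ⟩
  countℚ f (F (g 0)) +ℚ Σ< n (λ i → countℚ f (F (g (suc i))))
    ≡⟨ Σ<-front n (λ i → countℚ f (F (g i))) ⟨
  Σ< (suc n) (λ i → countℚ f (F (g i))) ∎

countℚ-∧ : ∀ {A : Set} b (g : A → Bool) xs → countℚ (λ x → b ∧ g x) xs ≡ (if b then countℚ g xs else 0ℚ)
countℚ-∧ true  g xs = refl
countℚ-∧ false g xs = cong ℕtoℚ (countB-none xs)

Σ<-below : ∀ p x G → x ≤ p → Σ< p (λ y → if y <ᵇ x then G y else 0ℚ) ≡ Σ< x G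
Σ<-below zero    zero    G x≤p = refl
Σ<-below (suc p) x       G x≤p with ℕₚ.m≤n⇒m<n∨m≡n x≤p
... | inj₁ (s≤s x≤p′) = trans (cong₂ _+ℚ_ (Σ<-below p x G x≤p′) (cong (λ b → if b then G p else 0ℚ) (≤⇒<ᵇ-false x≤p′))) (ℚₚ.+-identityʳ _)
... | inj₂ refl = trans (cong₂ _+ℚ_ (Σ<-cong p (λ i i<p → cong (λ b → if b then G i else 0ℚ) (<⇒<ᵇ-true (ℕₚ.m<n⇒m<1+n i<p)))) (cong (λ b → if b then G p else 0ℚ) (<⇒<ᵇ-true (ℕₚ.n<1+n p)))) refl

Σ<-aboveEq : ∀ p x G → x ≤ p → Σ< p (λ y → if not (y <ᵇ x) then G y else 0ℚ) ≡ Σ< p G -ℚ Σ< x G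
Σ<-aboveEq p x G x≤p = trans (split p) (cong (λ t → Σ< p G -ℚ t) (Σ<-below p x G x≤p))
  where
  split : ∀ p → Σ< p (λ y → if not (y <ᵇ x) then G y else 0ℚ) ≡ Σ< p G -ℚ Σ< p (λ y → if y <ᵇ x then G y else 0ℚ)
  split zero    = refl
  split (suc p) = trans (cong₂ _+ℚ_ (split p) (one (p <ᵇ x))) (lemma (Σ< p G) _ (G p) _)
    where
    one : ∀ b → (if not b then G p else 0ℚ) ≡ G p -ℚ (if b then G p else 0ℚ)
    one true  = sym (ℚₚ.+-inverseʳ (G p))
    one false = sym (ℚₚ.+-identityʳ (G p))
    lemma : ∀ a b c d → (a -ℚ b) +ℚ (c -ℚ d) ≡ (a +ℚ c) -ℚ (b +ℚ d)
    lemma = solve-∀ ringℚ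

module Words (p : ℕ) where
  open Alternating p

  follows : Bool → ℕ → ℕ → Bool
  follows b x y = if b then y <ᵇ x else not (y <ᵇ x)

  -- A word w lists the rows from which the boxes n, n − 1, …, 1 are removed; b tells whether
  -- the next row has to lie strictly above the row x removed last.
  okTail : Bool → ℕ → List ℕ → Shape → Bool
  okTail b x []      a = eqStair p a
  okTail b x (y ∷ w) a = does (valid? a) ∧ (follows b x y ∧ okTail (not b) y w (rem y a))

  okWord : Shape → List ℕ → Bool
  okWord a []      = false
  okWord a (y ∷ w) = does (valid? a) ∧ okTail true y w (rem y a)

  letters : ℕ → List (List ℕ)
  letters n = wordsOf n (upTo p)

  countTails : ℕ → Bool → ℕ → Shape → ℚ
  countTails n b x a = countℚ (λ w → okTail b x w a) (letters n)

  count-letters : ∀ n (f : List ℕ → Bool) → countℚ f (letters (suc n)) ≡ Σ< p (λ y → countℚ (λ w → f (y ∷ w)) (letters n))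
  count-letters n f = trans (countℚ-concatMap f (λ x → map (x ∷_) (letters n)) id p)
    (Σ<-cong p (λ y _ → cong ℕtoℚ (countB-map f (y ∷_) (letters n))))

  count-guarded : ∀ d (G : ℕ → List ℕ → Bool) n → Σ< p (λ y → countℚ (λ w → d ∧ G y w) (letters n))
    ≡ (if d then Σ< p (λ y → countℚ (G y) (letters n)) else 0ℚ)
  count-guarded true  G n = refl
  count-guarded false G n = Σ<-zero p (λ _ _ → cong ℕtoℚ (countB-none (letters n)))

  countTails-suc : ∀ n b x a → countTails (suc n) b x a ≡
    check a (Σ< p (λ y → if follows b x y then countTails n (not b) y (rem y a) else 0ℚ))
  countTails-suc n b x a = begin
    countTails (suc n) b x a
      ≡⟨ count-letters n (λ w → okTail b x w a) ⟩
    Σ< p (λ y → countℚ (λ w → okTail b x (y ∷ w) a) (letters n))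
      ≡⟨ count-guarded (does (valid? a)) (λ y w → follows b x y ∧ okTail (not b) y w (rem y a)) n ⟩
    check a (Σ< p (λ y → countℚ (λ w → follows b x y ∧ okTail (not b) y w (rem y a)) (letters n)))
      ≡⟨ cong (check a) (Σ<-cong p (λ y _ → countℚ-∧ (follows b x y) (λ w → okTail (not b) y w (rem y a)) (letters n))) ⟩
    check a (Σ< p (λ y → if follows b x y then countTails n (not b) y (rem y a) else 0ℚ)) ∎

  countTails≡tails : ∀ j x a → x ≤ p → countTails (dbl j) true x a ≡ tails j x a
  countTails≡tails zero    x a x≤p = trans (cong ℕtoℚ (countB-∷ (λ w → okTail true x w a) [] [])) (indicator (eqStair p a))
    where
    indicator : ∀ b → ℕtoℚ (b→ℕ b + 0) ≡ ι b
    indicator true  = refl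
    indicator false = refl
  countTails≡tails (suc j) x a x≤p = begin
    countTails (suc (suc (dbl j))) true x a
      ≡⟨ countTails-suc (suc (dbl j)) true x a ⟩
    check a (Σ< p (λ y → if y <ᵇ x then countTails (suc (dbl j)) false y (rem y a) else 0ℚ))
      ≡⟨ cong (check a) (trans (Σ<-below p x (λ y → countTails (suc (dbl j)) false y (rem y a)) x≤p)
           (Σ<-cong x (λ y y<x → inner y (ℕₚ.≤-trans (ℕₚ.<⇒≤ y<x) x≤p) (rem y a)))) ⟩
    tails (suc j) x a ∎
    where
    inner : ∀ y → y ≤ p → ∀ b → countTails (suc (dbl j)) false y b ≡ checked (belowEq (tails j)) y b
    inner y y≤p b = trans (countTails-suc (dbl j) false y b) (cong (check b)
      (trans (Σ<-aboveEq p y (λ z → countTails (dbl j) true z (rem z b)) y≤p)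
        (cong₂ _-ℚ_ (Σ<-cong p (λ z z<p → countTails≡tails j z (rem z b) (ℕₚ.<⇒≤ z<p)))
          (Σ<-cong y (λ z z<y → countTails≡tails j z (rem z b) (ℕₚ.≤-trans (ℕₚ.<⇒≤ z<y) y≤p))))))

  count≡words : ∀ j a → countℚ (okWord a) (letters (suc (dbl j))) ≡ words j a
  count≡words j a = begin
    countℚ (okWord a) (letters (suc (dbl j)))
      ≡⟨ count-letters (dbl j) (okWord a) ⟩
    Σ< p (λ y → countℚ (λ w → okWord a (y ∷ w)) (letters (dbl j)))
      ≡⟨ count-guarded (does (valid? a)) (λ y w → okTail true y w (rem y a)) (dbl j) ⟩
    check a (Σ< p (λ y → countTails (dbl j) true y (rem y a)))
      ≡⟨ cong (check a) (Σ<-cong p (λ y y<p → countTails≡tails j y (rem y a) (ℕₚ.<⇒≤ y<p))) ⟩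
    words j a ∎

-- Pigeonhole: the image of the head is deleted from the target list. Two such injections in
-- opposite directions give the equalities of counts below.
length-injection : ∀ {A B : Set} (f : A → B) {xs ys} → Unique xs → (∀ {x} → x ∈ xs → f x ∈ ys) →
  (∀ {x y} → x ∈ xs → y ∈ xs → f x ≡ f y → x ≡ y) → length xs ≤ length ys
length-injection f {[]}     {ys} u into inj = z≤n
length-injection f {x ∷ xs} {ys} (x∉ ∷ u) into inj with ∈-∃++ (into (here refl))
... | as , bs , refl = subst (suc (length xs) ≤_) (sym (trans (length-++ as) (trans (ℕₚ.+-suc (length as) (length bs)) (cong suc (sym (length-++ as))))))
  (s≤s (length-injection f u into′ (λ x∈ y∈ → inj (there x∈) (there y∈))))
  where
  into′ : ∀ {y} → y ∈ xs → f y ∈ as ++ bs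
  into′ y∈ with ∈-++⁻ as (into (there y∈))
  ... | inj₁ i = ∈-++⁺ˡ i
  ... | inj₂ (here e)  = ⊥-elim (lookup x∉ y∈ (inj (here refl) (there y∈) (sym e)))
  ... | inj₂ (there i) = ∈-++⁺ʳ as i

consAll : {A : Set} → List A → List (List A) → List (List A)
consAll xs yss = concatMap (λ x → map (x ∷_) yss) xs

unique-cons : ∀ {A : Set} {xs : List A} {yss : List (List A)} → Unique xs → Unique yss → Unique (consAll xs yss)
unique-cons {xs = xs} {yss} u v = Unq.concat⁺ (Allₚ.map⁺ (universal (λ x → Unq.map⁺ ∷-injectiveʳ v) xs))
  (APₚ.map⁺ (AP.map (λ {x} {y} x≢y {zs} (i , j) → x≢y (clash x y i j)) u))
  where
  clash : ∀ x y {zs} → zs ∈ map (x ∷_) yss → zs ∈ map (y ∷_) yss → x ≡ y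
  clash x y i j with ∈-map⁻ (x ∷_) i | ∈-map⁻ (y ∷_) j
  ... | _ , _ , refl | _ , _ , refl = refl

unique-wordsOf : ∀ {A : Set} n {xs : List A} → Unique xs → Unique (wordsOf n xs)
unique-wordsOf zero    u = [] ∷ []
unique-wordsOf (suc n) u = unique-cons u (unique-wordsOf n u)

unique-choices : ∀ {A : Set} {yss : List (List A)} → All Unique yss → Unique (choices yss)
unique-choices []       = [] ∷ []
unique-choices (u ∷ us) = unique-cons u (unique-choices us)

∈-cons⁺ : ∀ {A : Set} {x : A} {zs xs : List A} {yss : List (List A)} → x ∈ xs → zs ∈ yss → (x List.∷ zs) ∈ consAll xs yss
∈-cons⁺ {x = x} (here refl) i = ∈-++⁺ˡ (∈-map⁺ (x ∷_) i)
∈-cons⁺ {xs = y ∷ _} {yss} (there j) i = ∈-++⁺ʳ (map (y ∷_) yss) (∈-cons⁺ j i)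

∈-cons⁻ : ∀ {A : Set} {w : List A} xs {yss} → w ∈ consAll xs yss →
  ∃ λ x → ∃ λ zs → (w ≡ x List.∷ zs) × (x ∈ xs) × (zs ∈ yss)
∈-cons⁻ (x ∷ xs) {yss} i with ∈-++⁻ (map (x ∷_) yss) i
... | inj₁ j = let zs , k , e = ∈-map⁻ (x ∷_) j in x , zs , e , here refl , k
... | inj₂ j = let y , zs , e , k , l = ∈-cons⁻ xs j in y , zs , e , there k , l

∈-wordsOf⁺ : ∀ {A : Set} {xs : List A} w → All (_∈ xs) w → w ∈ wordsOf (length w) xs
∈-wordsOf⁺ []      []       = here refl
∈-wordsOf⁺ (x ∷ w) (i ∷ is) = ∈-cons⁺ i (∈-wordsOf⁺ w is)

∈-wordsOf⁻ : ∀ {A : Set} {xs : List A} n {w} → w ∈ wordsOf n xs → (length w ≡ n) × All (_∈ xs) w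
∈-wordsOf⁻ zero    (here refl) = refl , []
∈-wordsOf⁻ {xs = xs} (suc n) i with ∈-cons⁻ xs i
... | x , zs , refl , j , k = let e , a = ∈-wordsOf⁻ n k in cong suc e , j ∷ a

∈-choices⁺ : ∀ {A : Set} {w : List A} {yss} → Pointwise _∈_ w yss → w ∈ choices yss
∈-choices⁺ []       = here refl
∈-choices⁺ (i ∷ is) = ∈-cons⁺ i (∈-choices⁺ is)

∈-choices⁻ : ∀ {A : Set} {w : List A} yss → w ∈ choices yss → Pointwise _∈_ w yss
∈-choices⁻ []         (here refl) = []
∈-choices⁻ (ys ∷ yss) i with ∈-cons⁻ ys i
... | x , zs , refl , j , k = j ∷ ∈-choices⁻ yss k

-- Tableaux and words

Tableau : Set
Tableau = List (List ℕ)

∧-true : ∀ {a b} → a ∧ b ≡ true → (a ≡ true) × (b ≡ true)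
∧-true {true} {true} _ = refl , refl

filterB : {A : Set} → (A → Bool) → List A → List A
filterB f = filter (λ x → T? (f x))

≡true⇒T : ∀ {b} → b ≡ true → T b
≡true⇒T refl = tt

T⇒≡true : ∀ {b} → T b → b ≡ true
T⇒≡true {true} _ = refl

∈-filterB⁺ : ∀ {A : Set} (f : A → Bool) {x xs} → x ∈ xs → f x ≡ true → x ∈ filterB f xs
∈-filterB⁺ f i e = ∈-filter⁺ (λ x → T? (f x)) i (≡true⇒T e)

∈-filterB⁻ : ∀ {A : Set} (f : A → Bool) {x xs} → x ∈ filterB f xs → (x ∈ xs) × (f x ≡ true)
∈-filterB⁻ f i = let j , t = ∈-filter⁻ (λ x → T? (f x)) i in j , T⇒≡true t

filterB-cong : ∀ {A : Set} {f g : A → Bool} xs → (∀ x → x ∈ xs → f x ≡ g x) → filterB f xs ≡ filterB g xs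
filterB-cong []       e = refl
filterB-cong {f = f} {g} (x ∷ xs) e with f x | g x | e x (here refl)
... | true  | .true  | refl = cong (x ∷_) (filterB-cong xs (λ y i → e y (there i)))
... | false | .false | refl = filterB-cong xs (λ y i → e y (there i))

filterB-agree : ∀ {A : Set} (f g : A → Bool) xs → filterB f xs ≡ filterB g xs → ∀ x → x ∈ xs → f x ≡ g x
filterB-agree f g xs e x i with f x in ef | g x in eg
... | true  | true  = refl
... | false | false = refl
... | true  | false = trans (sym (proj₂ (∈-filterB⁻ g {xs = xs} (subst (x ∈_) e (∈-filterB⁺ f i ef))))) eg
... | false | true  = trans (sym ef) (proj₂ (∈-filterB⁻ f {xs = xs} (subst (x ∈_) (sym e) (∈-filterB⁺ g i eg))))

allB⁻ : ∀ {A : Set} (f : A → Bool) xs → allB f xs ≡ true → All (λ x → f x ≡ true) xs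
allB⁻ f []       e = []
allB⁻ f (x ∷ xs) e = let a , b = ∧-true e in a ∷ allB⁻ f xs b

allB⁺ : ∀ {A : Set} (f : A → Bool) {xs} → All (λ x → f x ≡ true) xs → allB f xs ≡ true
allB⁺ f []       = refl
allB⁺ f (e ∷ es) = cong₂ _∧_ e (allB⁺ f es)

eqList-sound : ∀ xs ys → eqList xs ys ≡ true → xs ≡ ys
eqList-sound []       []       e = refl
eqList-sound (x ∷ xs) (y ∷ ys) e = let a , b = ∧-true e in cong₂ _∷_ (ℕₚ.≡ᵇ⇒≡ x y (≡true⇒T a)) (eqList-sound xs ys b)

eqList-refl : ∀ xs → eqList xs xs ≡ true
eqList-refl []       = refl
eqList-refl (x ∷ xs) = cong₂ _∧_ (≡ᵇ-refl x) (eqList-refl xs)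

∈-range1⁺ : ∀ {n k} → k < n → suc k ∈ range1 n
∈-range1⁺ k<n = ∈-map⁺ suc (∈-upTo⁺ k<n)

∈-range1⁻ : ∀ {n k} → k ∈ range1 n → (0 < k) × (k ≤ n)
∈-range1⁻ i with ∈-map⁻ suc i
... | j , j∈ , refl = s≤s z≤n , ∈-upTo⁻ j∈

∈-range1 : ∀ {n k} → 0 < k → k ≤ n → k ∈ range1 n
∈-range1 {k = suc k} _ k<n = ∈-range1⁺ k<n

unique-range1 : ∀ n → Unique (range1 n)
unique-range1 n = Unq.map⁺ ℕₚ.suc-injective (Unq.upTo⁺ n)

record IsTab (p n : ℕ) (T : Tableau) : Set where
  field
    height  : length T ≡ p
    lengths : All (λ r → length r ≡ p) T
    entries : All (All (λ x → (0 < x) × (x ≤ n))) T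
    once    : ∀ k → k ∈ range1 n → occurrences k (concat T) ≡ 1
    rows    : All (λ r → strictlyIncreasing r ≡ true) T
    columns : columnsIncreasing T ≡ true

∈-SYT⁻ : ∀ p {T} → T ∈ SYT (square p) → IsTab p (size (square p)) T
∈-SYT⁻ p {T} i = let j , e = ∈-filterB⁻ (isSYT n) {xs = fillings (square p) n} i; o , e′ = ∧-true e; r , c = ∧-true {allB strictlyIncreasing T} e′
                     h , ws = cells p (∈-choices⁻ _ j) in record
  { height  = h
  ; lengths = All.map (λ w → proj₁ (∈-wordsOf⁻ p w)) ws
  ; entries = All.map (λ w → All.map ∈-range1⁻ (proj₂ (∈-wordsOf⁻ p w))) ws
  ; once    = λ k k∈ → ℕₚ.≡ᵇ⇒≡ _ 1 (≡true⇒T (lookup (allB⁻ (λ k → occurrences k (concat T) ≡ᵇ 1) (range1 n) o) k∈))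
  ; rows    = allB⁻ strictlyIncreasing T r
  ; columns = c
  }
  where
  n = size (square p)
  cells : ∀ q {T} → Pointwise _∈_ T (map (λ l → wordsOf l (range1 n)) (replicate q p)) → (length T ≡ q) × All (_∈ wordsOf p (range1 n)) T
  cells zero    []       = refl , []
  cells (suc q) (i ∷ is) = let h , a = cells q is in cong suc h , i ∷ a

∈-SYT⁺ : ∀ p {T} → IsTab p (size (square p)) T → T ∈ SYT (square p)
∈-SYT⁺ p {T} t = ∈-filterB⁺ (isSYT n) {xs = fillings (square p) n}
  (∈-choices⁺ (subst (λ q → Pointwise _∈_ T (map (λ l → wordsOf l (range1 n)) (replicate q p))) height (cells lengths entries)))
  (cong₂ _∧_ (allB⁺ (λ k → occurrences k (concat T) ≡ᵇ 1) (All.tabulate (λ k∈ → cong (_≡ᵇ 1) (once _ k∈)))) (cong₂ _∧_ (allB⁺ strictlyIncreasing rows) columns))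
  where
  open IsTab t
  n = size (square p)
  cells : ∀ {T} → All (λ r → length r ≡ p) T → All (All (λ x → (0 < x) × (x ≤ n))) T →
    Pointwise _∈_ T (map (λ l → wordsOf l (range1 n)) (replicate (length T) p))
  cells []         []       = []
  cells {r ∷ _} (l ∷ ls) (e ∷ es) = subst (λ q → r ∈ wordsOf q (range1 n)) l (∈-wordsOf⁺ r (All.map (λ (a , b) → ∈-range1 a b) e)) ∷ cells ls es

unique-SYT : ∀ p → Unique (SYT (square p))
unique-SYT p = Unq.filter⁺ (λ T → T? (isSYT (size (square p)) T))
  (unique-choices (Allₚ.map⁺ (universal (λ l → unique-wordsOf l (unique-range1 (size (square p)))) (square p))))

descent : Tableau → ℕ → Bool
descent T i = rowOf T i <ᵇ rowOf T (suc i)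

Alternates : (ℕ → Bool) → ℕ → Tableau → Set
Alternates h n T = ∀ i → i ∈ range1 (n ∸ 1) → descent T i ≡ h i

alternates⁻ : ∀ h n T → eqList (descentSet n T) (filterB h (range1 (n ∸ 1))) ≡ true → Alternates h n T
alternates⁻ h n T e = filterB-agree (descent T) h (range1 (n ∸ 1)) (eqList-sound (descentSet n T) _ e)

alternates⁺ : ∀ h n T → Alternates h n T → eqList (descentSet n T) (filterB h (range1 (n ∸ 1))) ≡ true
alternates⁺ h n T a = subst (λ l → eqList (descentSet n T) l ≡ true) (filterB-cong (range1 (n ∸ 1)) a) (eqList-refl (descentSet n T))

occurrences-concat : ∀ k (r : List ℕ) rs → occurrences k (concat (r ∷ rs)) ≡ occurrences k r + occurrences k (concat rs)
occurrences-concat k r rs = countB-++ (λ x → x ≡ᵇ k) r (concat rs)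

below : ℕ → List ℕ → ℕ
below m = countB (_<ᵇ m)

below-suc : ∀ m r → below (suc m) r ≡ below m r + occurrences m r
below-suc m []      = refl
below-suc m (x ∷ r) = begin
  below (suc m) (x ∷ r) ≡⟨ countB-∷ (_<ᵇ suc m) x r ⟩
  b→ℕ (x <ᵇ suc m) + below (suc m) r ≡⟨ cong₂ _+_ (indicator x m) (below-suc m r) ⟩
  (b→ℕ (x <ᵇ m) + b→ℕ (x ≡ᵇ m)) + (below m r + occurrences m r) ≡⟨ lemma (b→ℕ (x <ᵇ m)) (b→ℕ (x ≡ᵇ m)) (below m r) (occurrences m r) ⟩
  (b→ℕ (x <ᵇ m) + below m r) + (b→ℕ (x ≡ᵇ m) + occurrences m r) ≡⟨ cong₂ _+_ (countB-∷ (_<ᵇ m) x r) (countB-∷ (_≡ᵇ m) x r) ⟨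
  below m (x ∷ r) + occurrences m (x ∷ r) ∎
  where
  indicator : ∀ x m → b→ℕ (x <ᵇ suc m) ≡ b→ℕ (x <ᵇ m) + b→ℕ (x ≡ᵇ m)
  indicator zero    zero    = refl
  indicator zero    (suc m) = refl
  indicator (suc x) zero    = refl
  indicator (suc x) (suc m) = indicator x m
  lemma : ∀ a b c d → (a + b) + (c + d) ≡ (a + c) + (b + d)
  lemma = solve-∀ℕ

-- The encoded shape of the subtableau of entries less than `m`; the summand `suc (length rs)` plays
-- the part of p - i.
shapeBelow : ℕ → Tableau → Shape
shapeBelow m []       = []
shapeBelow m (r ∷ rs) = (below m r + suc (length rs)) ∷ shapeBelow m rs

shapeBelow-stable : ∀ m T → occurrences m (concat T) ≡ 0 → shapeBelow (suc m) T ≡ shapeBelow m T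
shapeBelow-stable m []       o = refl
shapeBelow-stable m (r ∷ rs) o = cong₂ _∷_ (cong (_+ suc (length rs)) (trans (below-suc m r) (trans (cong (_+_ (below m r)) (ℕₚ.m+n≡0⇒m≡0 _ o′)) (ℕₚ.+-identityʳ _))))
  (shapeBelow-stable m rs (ℕₚ.m+n≡0⇒n≡0 (occurrences m r) o′))
  where
  o′ : occurrences m r + occurrences m (concat rs) ≡ 0
  o′ = trans (sym (occurrences-concat m r rs)) o

rem-shapeBelow : ∀ m T → occurrences m (concat T) ≡ 1 → rem (rowOf T m) (shapeBelow (suc m) T) ≡ shapeBelow m T
rem-shapeBelow m (r ∷ rs) o with occurrences m r in e | trans (sym (occurrences-concat m r rs)) o
... | zero        | o′ = cong₂ _∷_ (cong (_+ suc (length rs)) (trans (below-suc m r) (trans (cong (_+_ (below m r)) e) (ℕₚ.+-identityʳ _)))) (rem-shapeBelow m rs o′)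
... | suc zero    | o′ = cong₂ _∷_ (trans (cong (λ t → pred (t + suc (length rs))) (trans (below-suc m r) (trans (cong (_+_ (below m r)) e) (ℕₚ.+-comm (below m r) 1)))) refl)
  (shapeBelow-stable m rs (ℕₚ.suc-injective o′))
... | suc (suc _) | ()

rowOf-< : ∀ m T → occurrences m (concat T) ≡ 1 → rowOf T m < length T
rowOf-< m (r ∷ rs) o with occurrences m r in e | trans (sym (occurrences-concat m r rs)) o
... | zero  | o′ = s≤s (rowOf-< m rs o′)
... | suc _ | _  = s≤s z≤n

below-columns : ∀ m r s → length s ≤ length r → colsOK r s ≡ true → below m s ≤ below m r
below-columns m r       []      l c = z≤n
below-columns m (x ∷ r) (y ∷ s) (s≤s l) c = let a , b = ∧-true c in
  subst₂ _≤_ (sym (countB-∷ (_<ᵇ m) y s)) (sym (countB-∷ (_<ᵇ m) x r)) (ℕₚ.+-mono-≤ (mono (ℕₚ.<ᵇ⇒< x y (≡true⇒T a))) (below-columns m r s l b))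
  where
  mono : x < y → b→ℕ (y <ᵇ m) ≤ b→ℕ (x <ᵇ m)
  mono x<y with y <ᵇ m in e
  ... | false = z≤n
  ... | true  = ℕₚ.≤-reflexive (cong b→ℕ (sym (<⇒<ᵇ-true (ℕₚ.<-trans x<y (ℕₚ.<ᵇ⇒< y m (≡true⇒T e))))))

-- An entry less than `m` has a smaller entry above it, so the numbers of such entries decrease
-- weakly from row to row.
valid-shapeBelow : ∀ m p {T} → All (λ r → length r ≡ p) T → columnsIncreasing T ≡ true → Valid (shapeBelow m T)
valid-shapeBelow m p {[]}         ls c = []
valid-shapeBelow m p {r ∷ []}     ls c = subst (0 <_) (ℕₚ.+-comm 1 (below m r)) (s≤s z≤n) ∷ []
valid-shapeBelow m p {r ∷ s ∷ rs} (l ∷ l′ ∷ ls) c = let a , b = ∧-true c in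
  ℕₚ.+-mono-≤-< (below-columns m r s (ℕₚ.≤-reflexive (trans l′ (sym l))) a) (ℕₚ.n<1+n (suc (length rs))) ∷ valid-shapeBelow m p (l′ ∷ ls) b

word : ℕ → Tableau → List ℕ
word zero    T = []
word (suc k) T = rowOf T (suc k) ∷ word k T

length-word : ∀ k T → length (word k T) ≡ k
length-word zero    T = refl
length-word (suc k) T = cong suc (length-word k T)

eqStair-stair : ∀ p → eqStair p (stair p) ≡ true
eqStair-stair zero    = refl
eqStair-stair (suc p) = cong₂ _∧_ (≡ᵇ-refl p) (eqStair-stair p)

does-valid : ∀ {a} → Valid a → does (valid? a) ≡ true
does-valid {a} v with valid? a
... | yes _ = refl
... | no ¬v = ⊥-elim (¬v v)

isEven-suc : ∀ k → isEven (suc k) ≡ not (isEven k)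
isEven-suc zero          = refl
isEven-suc (suc zero)    = refl
isEven-suc (suc (suc k)) = isEven-suc k

not-not : ∀ b → not (not b) ≡ b
not-not true  = refl
not-not false = refl

below-small : ∀ r → All (0 <_) r → below 1 r ≡ 0
below-small []          []       = refl
below-small (suc x ∷ r) (_ ∷ ps) = below-small r ps

below-large : ∀ n r → All (_≤ n) r → below (suc n) r ≡ length r
below-large n []      []       = refl
below-large n (x ∷ r) (l ∷ ls) = trans (countB-∷ (_<ᵇ suc n) x r) (cong₂ (λ b t → b→ℕ b + t) (<⇒<ᵇ-true (s≤s l)) (below-large n r ls))

module ToWord (p n : ℕ) (T : Tableau) (t : IsTab p (suc n) T) where
  open IsTab t
  open Words p

  shapeBelow-one : shapeBelow 1 T ≡ stair p
  shapeBelow-one = trans (go T entries) (cong stair height)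
    where
    go : ∀ T → All (All (λ x → (0 < x) × (x ≤ suc n))) T → shapeBelow 1 T ≡ stair (length T)
    go []      []       = refl
    go (r ∷ T) (e ∷ es) = cong₂ _∷_ (cong (_+ suc (length T)) (below-small r (All.map proj₁ e))) (go T es)

  shapeBelow-all : shapeBelow (suc (suc n)) T ≡ squareShape p
  shapeBelow-all = trans (go T lengths entries) (cong (λ q → map (_+_ p) (stair q)) height)
    where
    go : ∀ T → All (λ r → length r ≡ p) T → All (All (λ x → (0 < x) × (x ≤ suc n))) T → shapeBelow (suc (suc n)) T ≡ map (_+_ p) (stair (length T))
    go []      _        []       = refl
    go (r ∷ T) (l ∷ ls) (e ∷ es) = cong₂ _∷_ (cong (_+ suc (length T)) (trans (below-large (suc n) r (All.map proj₂ e)) l)) (go T ls es)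

  word-letters : ∀ k → k ≤ suc n → All (_∈ upTo p) (word k T)
  word-letters zero    _   = []
  word-letters (suc k) k<n = ∈-upTo⁺ (subst (rowOf T (suc k) <_) height (rowOf-< (suc k) T (once (suc k) (∈-range1⁺ k<n)))) ∷ word-letters k (ℕₚ.<⇒≤ k<n)

  okTail-word : Alternates isEven (suc n) T → ∀ k → k ≤ n → okTail (isEven k) (rowOf T (suc k)) (word k T) (shapeBelow (suc k) T) ≡ true
  okTail-word alt zero    k≤n = trans (cong (eqStair p) shapeBelow-one) (eqStair-stair p)
  okTail-word alt (suc k) k≤n = cong₂ _∧_ (does-valid (valid-shapeBelow (suc (suc k)) p lengths columns))
    -- The new letter is the row of the entry k + 1 and the previous letter that of k + 2, so
    -- `follows` tests for a descent at k + 1.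
    (cong₂ _∧_ (follows-descent (isEven (suc k)) (descent T (suc k)) (alt (suc k) (∈-range1⁺ k≤n)))
      (trans (cong₂ (λ b a → okTail b (rowOf T (suc k)) (word k T) a) (trans (cong not (isEven-suc k)) (not-not (isEven k)))
               (rem-shapeBelow (suc k) T (once (suc k) (∈-range1⁺ (ℕₚ.m<n⇒m<1+n k≤n)))))
        (okTail-word alt k (ℕₚ.<⇒≤ k≤n))))
    where
    follows-descent : ∀ b c → c ≡ b → (if b then c else not c) ≡ true
    follows-descent true  .true  refl = refl
    follows-descent false .false refl = refl

  -- The initial flag `true` of `okWord` is the parity of `n`, the largest possible descent.
  okWord-word : isEven n ≡ true → Alternates isEven (suc n) T → okWord (squareShape p) (word (suc n) T) ≡ true
  okWord-word ev alt = subst (λ a → okWord a (word (suc n) T) ≡ true) shapeBelow-all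
    (cong₂ _∧_ (does-valid (valid-shapeBelow (suc (suc n)) p lengths columns))
      (trans (cong₂ (λ b a → okTail b (rowOf T (suc n)) (word n T) a) (sym ev) (rem-shapeBelow (suc n) T (once (suc n) (∈-range1⁺ ℕₚ.≤-refl))))
        (okTail-word alt n ℕₚ.≤-refl)))

-- Rebuilding a tableau from its word

appendTo : ℕ → ℕ → Tableau → Tableau
appendTo y       k []       = []
appendTo zero    k (r ∷ rs) = (r ++ k ∷ []) ∷ rs
appendTo (suc y) k (r ∷ rs) = r ∷ appendTo y k rs

length-appendTo : ∀ y k T → length (appendTo y k T) ≡ length T
length-appendTo y       k []      = refl
length-appendTo zero    k (r ∷ T) = refl
length-appendTo (suc y) k (r ∷ T) = cong suc (length-appendTo y k T)

-- The last letter places the entry 1 and the head letter the largest entry, inverting the order of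
-- removal.
build : ℕ → List ℕ → Tableau
build p []      = replicate p []
build p (y ∷ w) = appendTo y (suc (length w)) (build p w)

data Sorted : List ℕ → Set where
  []  : Sorted []
  _∷_ : ∀ {x r} → All (x <_) r → Sorted r → Sorted (x ∷ r)

sorted⁻ : ∀ r → strictlyIncreasing r ≡ true → Sorted r
sorted⁻ []          e = []
sorted⁻ (x ∷ [])    e = [] ∷ []
sorted⁻ (x ∷ y ∷ r) e with sorted⁻ (y ∷ r) (proj₂ (∧-true e))
... | ys ∷ s = (x<y ∷ All.map (ℕₚ.<-trans x<y) ys) ∷ ys ∷ s
  where
  x<y : x < y
  x<y = ℕₚ.<ᵇ⇒< x y (≡true⇒T (proj₁ (∧-true e)))

occurrences-zero : ∀ m r → All (_≢ m) r → occurrences m r ≡ 0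
occurrences-zero m []      []       = refl
occurrences-zero m (x ∷ r) (n ∷ ns) = trans (countB-∷ (_≡ᵇ m) x r) (cong₂ (λ b t → b→ℕ b + t) (≢⇒≡ᵇ-false x m n) (occurrences-zero m r ns))

filter-absent : ∀ m r → occurrences m r ≡ 0 → filterB (_<ᵇ suc m) r ≡ filterB (_<ᵇ m) r
filter-absent m []      o = refl
filter-absent m (x ∷ r) o with x <ᵇ suc m in a | x <ᵇ m in b | x ≡ᵇ m in c
filter-absent m (x ∷ r) () | _     | _     | true
filter-absent m (x ∷ r) o  | true  | true  | false = cong (x ∷_) (filter-absent m r o)
filter-absent m (x ∷ r) o  | false | false | false = filter-absent m r o
filter-absent m (x ∷ r) o  | true  | false | false with ℕₚ.m≤n⇒m<n∨m≡n (ℕₚ.≤-pred (ℕₚ.<ᵇ⇒< x (suc m) (≡true⇒T a)))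
... | inj₁ x<m = case trans (sym b) (<⇒<ᵇ-true x<m) of λ ()
... | inj₂ refl = case trans (sym c) (≡ᵇ-refl x) of λ ()
filter-absent m (x ∷ r) o  | false | true  | false = case trans (sym a) (<⇒<ᵇ-true (ℕₚ.m<n⇒m<1+n (ℕₚ.<ᵇ⇒< x m (≡true⇒T b)))) of λ ()

filter-none : ∀ m r → All (m ≤_) r → filterB (_<ᵇ m) r ≡ []
filter-none m []      []       = refl
filter-none m (x ∷ r) (l ∷ ls) with x <ᵇ m in e
... | true  = ⊥-elim (ℕₚ.<⇒≱ (ℕₚ.<ᵇ⇒< x m (≡true⇒T e)) l)
... | false = filter-none m r ls

filter-present : ∀ m r → Sorted r → 0 < occurrences m r → filterB (_<ᵇ suc m) r ≡ filterB (_<ᵇ m) r ++ m ∷ []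
filter-present m []      []       ()
filter-present m (x ∷ r) (xs ∷ s) o with ℕₚ.<-cmp x m
... | tri< x<m x≢m _ rewrite <⇒<ᵇ-true x<m | <⇒<ᵇ-true (ℕₚ.m<n⇒m<1+n x<m) | ≢⇒≡ᵇ-false x m x≢m = cong (x ∷_) (filter-present m r s o)
... | tri≈ _ refl _ rewrite <⇒<ᵇ-true (ℕₚ.n<1+n x) | ≤⇒<ᵇ-false (ℕₚ.≤-refl {x}) =
  trans (cong (x ∷_) (filter-none (suc x) r xs)) (cong (_++ x ∷ []) (sym (filter-none x r (All.map ℕₚ.<⇒≤ xs))))
... | tri> _ x≢m m<x = ⊥-elim (ℕₚ.<⇒≢ o (sym (occurrences-zero m (x ∷ r) (x≢m ∷ All.map (λ x<y → ℕₚ.>⇒≢ (ℕₚ.<-trans m<x x<y)) xs))))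

restrict : ℕ → Tableau → Tableau
restrict m = map (filterB (_<ᵇ m))

restrict-absent : ∀ m T → occurrences m (concat T) ≡ 0 → restrict (suc m) T ≡ restrict m T
restrict-absent m []      o = refl
restrict-absent m (r ∷ T) o = cong₂ _∷_ (filter-absent m r (ℕₚ.m+n≡0⇒m≡0 _ o′)) (restrict-absent m T (ℕₚ.m+n≡0⇒n≡0 (occurrences m r) o′))
  where
  o′ : occurrences m r + occurrences m (concat T) ≡ 0
  o′ = trans (sym (occurrences-concat m r T)) o

restrict-step : ∀ m T → All (λ r → strictlyIncreasing r ≡ true) T → occurrences m (concat T) ≡ 1 →
  restrict (suc m) T ≡ appendTo (rowOf T m) m (restrict m T)
restrict-step m (r ∷ T) (i ∷ is) o with occurrences m r in e | trans (sym (occurrences-concat m r T)) o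
... | zero        | o′ = cong₂ _∷_ (filter-absent m r e) (restrict-step m T is o′)
... | suc zero    | o′ = cong₂ _∷_ (filter-present m r (sorted⁻ r i) (subst (0 <_) (sym e) (s≤s z≤n))) (restrict-absent m T (ℕₚ.suc-injective o′))
... | suc (suc _) | ()

-- The invariant of the induction: the last k letters rebuild the subtableau of entries at most k.
build-word : ∀ p n T → IsTab p n T → build p (word n T) ≡ T
build-word p n T t = trans (go n ℕₚ.≤-refl) (restrict-all T entries)
  where
  open IsTab t
  restrict-one : ∀ T → All (All (λ x → (0 < x) × (x ≤ n))) T → replicate (length T) [] ≡ restrict 1 T
  restrict-one []      []       = refl
  restrict-one (r ∷ T) (e ∷ es) = cong₂ _∷_ (sym (filter-none 1 r (All.map proj₁ e))) (restrict-one T es)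
  filter-all : ∀ r → All (_≤ n) r → filterB (_<ᵇ suc n) r ≡ r
  filter-all []      []       = refl
  filter-all (x ∷ r) (l ∷ ls) rewrite <⇒<ᵇ-true (s≤s l) = cong (x ∷_) (filter-all r ls)
  restrict-all : ∀ T → All (All (λ x → (0 < x) × (x ≤ n))) T → restrict (suc n) T ≡ T
  restrict-all []      []       = refl
  restrict-all (r ∷ T) (e ∷ es) = cong₂ _∷_ (filter-all r (All.map proj₂ e)) (restrict-all T es)
  go : ∀ k → k ≤ n → build p (word k T) ≡ restrict (suc k) T
  go zero    _   = trans (cong (λ q → replicate q []) (sym height)) (restrict-one T entries)
  go (suc k) k<n = begin
    appendTo (rowOf T (suc k)) (suc (length (word k T))) (build p (word k T))
      ≡⟨ cong₂ (λ l T′ → appendTo (rowOf T (suc k)) (suc l) T′) (length-word k T) (go k (ℕₚ.<⇒≤ k<n)) ⟩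
    appendTo (rowOf T (suc k)) (suc k) (restrict (suc k) T)
      ≡⟨ restrict-step (suc k) T rows (once (suc k) (∈-range1⁺ k<n)) ⟨
    restrict (suc (suc k)) T ∎

lengthShape : Tableau → Shape
lengthShape []       = []
lengthShape (r ∷ rs) = (length r + suc (length rs)) ∷ lengthShape rs

incr : ℕ → Shape → Shape
incr y       []       = []
incr zero    (a ∷ as) = suc a ∷ as
incr (suc y) (a ∷ as) = a ∷ incr y as

incr-rem : ∀ y {a} → Valid a → y < length a → incr y (rem y a) ≡ a
incr-rem zero    (_∷_ {suc a} h v) _       = refl
incr-rem (suc y) (_∷_ {a} h v)     (s≤s l) = cong (a ∷_) (incr-rem y v l)

lengthShape-appendTo : ∀ y k T → lengthShape (appendTo y k T) ≡ incr y (lengthShape T)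
lengthShape-appendTo y       k []      = refl
lengthShape-appendTo zero    k (r ∷ T) = cong (λ l → (l + suc (length T)) ∷ lengthShape T) (trans (length-++ r) (ℕₚ.+-comm (length r) 1))
lengthShape-appendTo (suc y) k (r ∷ T) = cong₂ _∷_ (cong (λ l → length r + suc l) (length-appendTo y k T)) (lengthShape-appendTo y k T)

length-build : ∀ p w → length (build p w) ≡ p
length-build p []      = length-replicate p
length-build p (y ∷ w) = trans (length-appendTo y _ (build p w)) (length-build p w)

appendTo-All : ∀ {P : List ℕ → Set} y k T → (∀ {r} → P r → P (r ++ k ∷ [])) → All P T → All P (appendTo y k T)
appendTo-All y       k []      f []       = []
appendTo-All zero    k (r ∷ T) f (e ∷ es) = f e ∷ es
appendTo-All (suc y) k (r ∷ T) f (e ∷ es) = e ∷ appendTo-All y k T f es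

entries-build : ∀ p w → All (All (λ x → (0 < x) × (x ≤ length w))) (build p w)
entries-build p []      = Allₚ.replicate⁺ p []
entries-build p (y ∷ w) = appendTo-All y (suc (length w)) (build p w) (λ e → Allₚ.++⁺ e ((s≤s z≤n , ℕₚ.≤-refl) ∷ []))
  (All.map (All.map (λ (a , b) → a , ℕₚ.m≤n⇒m≤1+n b)) (entries-build p w))

strictlyIncreasing-snoc : ∀ r k → All (_< k) r → strictlyIncreasing r ≡ true → strictlyIncreasing (r ++ k ∷ []) ≡ true
strictlyIncreasing-snoc []          k ls       e = refl
strictlyIncreasing-snoc (x ∷ [])    k (l ∷ []) e = cong (_∧ true) (<⇒<ᵇ-true l)
strictlyIncreasing-snoc (x ∷ y ∷ r) k (l ∷ ls) e = let a , b = ∧-true e in cong₂ _∧_ a (strictlyIncreasing-snoc (y ∷ r) k ls b)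

rows-build : ∀ p w → All (λ r → strictlyIncreasing r ≡ true) (build p w)
rows-build p w = All.map proj₂ (go w)
  where
  go : ∀ w → All (λ r → All (_≤ length w) r × strictlyIncreasing r ≡ true) (build p w)
  go []      = Allₚ.replicate⁺ p ([] , refl)
  go (y ∷ w) = appendTo-bounded y (build p w) (go w)
    where
    k = suc (length w)
    appendTo-bounded : ∀ y T → All (λ r → All (_≤ length w) r × strictlyIncreasing r ≡ true) T → All (λ r → All (_≤ k) r × strictlyIncreasing r ≡ true) (appendTo y k T)
    appendTo-bounded y       []      []             = []
    appendTo-bounded zero    (r ∷ T) ((l , s) ∷ es) = (Allₚ.++⁺ (All.map ℕₚ.m≤n⇒m≤1+n l) (ℕₚ.≤-refl ∷ []) , strictlyIncreasing-snoc r k (All.map s≤s l) s)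
      ∷ All.map (λ (l , s) → All.map ℕₚ.m≤n⇒m≤1+n l , s) es
    appendTo-bounded (suc y) (r ∷ T) ((l , s) ∷ es) = (All.map ℕₚ.m≤n⇒m≤1+n l , s) ∷ appendTo-bounded y T es

occurrences-snoc : ∀ m r k → occurrences m (r ++ k ∷ []) ≡ occurrences m r + b→ℕ (k ≡ᵇ m)
occurrences-snoc m r k = trans (countB-++ (_≡ᵇ m) r (k ∷ [])) (cong (_+_ (occurrences m r)) (trans (countB-∷ (_≡ᵇ m) k []) (ℕₚ.+-identityʳ _)))

occurrences-appendTo : ∀ m y k T → y < length T → occurrences m (concat (appendTo y k T)) ≡ occurrences m (concat T) + b→ℕ (k ≡ᵇ m)
occurrences-appendTo m zero k (r ∷ T) _ = begin
  occurrences m (concat ((r ++ k ∷ []) ∷ T)) ≡⟨ occurrences-concat m (r ++ k ∷ []) T ⟩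
  occurrences m (r ++ k ∷ []) + occurrences m (concat T) ≡⟨ cong (_+ occurrences m (concat T)) (occurrences-snoc m r k) ⟩
  (occurrences m r + b→ℕ (k ≡ᵇ m)) + occurrences m (concat T) ≡⟨ lemma (occurrences m r) (b→ℕ (k ≡ᵇ m)) (occurrences m (concat T)) ⟩
  (occurrences m r + occurrences m (concat T)) + b→ℕ (k ≡ᵇ m) ≡⟨ cong (_+ b→ℕ (k ≡ᵇ m)) (occurrences-concat m r T) ⟨
  occurrences m (concat (r ∷ T)) + b→ℕ (k ≡ᵇ m) ∎
  where
  lemma : ∀ a b c → (a + b) + c ≡ (a + c) + b
  lemma = solve-∀ℕ
occurrences-appendTo m (suc y) k (r ∷ T) (s≤s l) = begin
  occurrences m (concat (r ∷ appendTo y k T)) ≡⟨ occurrences-concat m r (appendTo y k T) ⟩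
  occurrences m r + occurrences m (concat (appendTo y k T)) ≡⟨ cong (_+_ (occurrences m r)) (occurrences-appendTo m y k T l) ⟩
  occurrences m r + (occurrences m (concat T) + b→ℕ (k ≡ᵇ m)) ≡⟨ ℕₚ.+-assoc (occurrences m r) (occurrences m (concat T)) (b→ℕ (k ≡ᵇ m)) ⟨
  (occurrences m r + occurrences m (concat T)) + b→ℕ (k ≡ᵇ m) ≡⟨ cong (_+ b→ℕ (k ≡ᵇ m)) (occurrences-concat m r T) ⟨
  occurrences m (concat (r ∷ T)) + b→ℕ (k ≡ᵇ m) ∎

occurrences-above : ∀ m T → All (All (_< m)) T → occurrences m (concat T) ≡ 0
occurrences-above m T a = occurrences-zero m (concat T) (All.map ℕₚ.<⇒≢ (Allₚ.concat⁺ a))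

occurrences-new : ∀ p w → occurrences (suc (length w)) (concat (build p w)) ≡ 0
occurrences-new p w = occurrences-above _ (build p w) (All.map (All.map (λ (_ , b) → s≤s b)) (entries-build p w))

once-build : ∀ p w → All (_< p) w → ∀ k → k ∈ range1 (length w) → occurrences k (concat (build p w)) ≡ 1
once-build p (y ∷ w) (y<p ∷ ls) k k∈ = trans (occurrences-appendTo k y (suc (length w)) (build p w) (subst (y <_) (sym (length-build p w)) y<p)) main
  where
  main : occurrences k (concat (build p w)) + b→ℕ (suc (length w) ≡ᵇ k) ≡ 1
  main with ∈-range1⁻ k∈
  ... | 0<k , k≤ with ℕₚ.m≤n⇒m<n∨m≡n k≤
  ... | inj₂ refl = cong₂ (λ a b → a + b→ℕ b) (occurrences-new p w) (≡ᵇ-refl (length w))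
  ... | inj₁ k<   = cong₂ (λ a b → a + b→ℕ b) (once-build p w ls k (∈-range1 0<k (ℕₚ.≤-pred k<))) (≢⇒≡ᵇ-false (suc (length w)) k (ℕₚ.>⇒≢ k<))

rowOf-other : ∀ m y k T → m ≢ k → rowOf (appendTo y k T) m ≡ rowOf T m
rowOf-other m y       k []      m≢k = refl
rowOf-other m zero    k (r ∷ T) m≢k = cong (λ o → if 0 <ᵇ o then 0 else suc (rowOf T m))
  (trans (occurrences-snoc m r k) (trans (cong (λ b → occurrences m r + b→ℕ b) (≢⇒≡ᵇ-false k m (λ e → m≢k (sym e)))) (ℕₚ.+-identityʳ _)))
rowOf-other m (suc y) k (r ∷ T) m≢k = cong (λ t → if 0 <ᵇ occurrences m r then 0 else suc t) (rowOf-other m y k T m≢k)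

rowOf-new : ∀ y k T → occurrences k (concat T) ≡ 0 → y < length T → rowOf (appendTo y k T) k ≡ y
rowOf-new zero    k (r ∷ T) o _ = cong (λ o → if 0 <ᵇ o then 0 else suc (rowOf T k))
  (trans (occurrences-snoc k r k) (trans (cong (λ b → occurrences k r + b→ℕ b) (≡ᵇ-refl k)) (ℕₚ.+-comm (occurrences k r) 1)))
rowOf-new (suc y) k (r ∷ T) o (s≤s l) = cong₂ (λ o t → if 0 <ᵇ o then 0 else suc t) (ℕₚ.m+n≡0⇒m≡0 (occurrences k r) o′) (rowOf-new y k T (ℕₚ.m+n≡0⇒n≡0 (occurrences k r) o′) l)
  where
  o′ : occurrences k r + occurrences k (concat T) ≡ 0
  o′ = trans (sym (occurrences-concat k r T)) o

word-cong : ∀ k {T T′} → (∀ m → m ≤ k → rowOf T m ≡ rowOf T′ m) → word k T ≡ word k T′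
word-cong zero    e = refl
word-cong (suc k) e = cong₂ _∷_ (e (suc k) ℕₚ.≤-refl) (word-cong k (λ m m≤k → e m (ℕₚ.m≤n⇒m≤1+n m≤k)))

word-build : ∀ p w → All (_< p) w → word (length w) (build p w) ≡ w
word-build p []      []         = refl
word-build p (y ∷ w) (y<p ∷ ls) = cong₂ _∷_ (rowOf-new y (suc (length w)) (build p w) (occurrences-new p w) (subst (y <_) (sym (length-build p w)) y<p))
  (trans (word-cong (length w) (λ m m≤ → rowOf-other m y (suc (length w)) (build p w) (ℕₚ.<⇒≢ (s≤s m≤)))) (word-build p w ls))

colsOK-upper : ∀ r s k → length s ≤ length r → colsOK r s ≡ true → colsOK (r ++ k ∷ []) s ≡ true
colsOK-upper []      []      k l       c = refl
colsOK-upper (x ∷ r) []      k l       c = refl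
colsOK-upper (x ∷ r) (y ∷ s) k (s≤s l) c = let a , b = ∧-true c in cong₂ _∧_ a (colsOK-upper r s k l b)

colsOK-lower : ∀ r s k → All (_< k) r → colsOK r s ≡ true → colsOK r (s ++ k ∷ []) ≡ true
colsOK-lower []          s       k ls       c = refl
colsOK-lower (x ∷ [])    []      k (l ∷ ls) c = cong (_∧ true) (<⇒<ᵇ-true l)
colsOK-lower (x ∷ y ∷ r) []      k (l ∷ ls) c = cong (_∧ true) (<⇒<ᵇ-true l)
colsOK-lower (x ∷ r)     (y ∷ s) k (l ∷ ls) c = let a , b = ∧-true c in cong₂ _∧_ a (colsOK-lower r s k ls b)

-- The new entry is the largest, so it may stand below anything. It must not stand above an old
-- entry, and validity of the old shape ensures this.
columns-appendTo : ∀ y k T → Valid (lengthShape T) → All (All (_< k)) T → columnsIncreasing T ≡ true → columnsIncreasing (appendTo y k T) ≡ true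
columns-appendTo y       k []          v        a        c = refl
columns-appendTo zero    k (r ∷ [])    v        a        c = refl
columns-appendTo (suc y) k (r ∷ [])    v        a        c = refl
columns-appendTo zero    k (r ∷ s ∷ T) (h ∷ v)  a        c = let d , e = ∧-true c in cong₂ _∧_ (colsOK-upper r s k s≤r d) e
  where
  s≤r : length s ≤ length r
  s≤r = ℕₚ.+-cancelʳ-≤ (suc (length T)) (length s) (length r) (ℕₚ.≤-pred (subst (length s + suc (length T) <_) (ℕₚ.+-suc (length r) (suc (length T))) h))
columns-appendTo (suc zero) k (r ∷ s ∷ T) (h ∷ v) (l ∷ ls) c = let d , e = ∧-true c in cong₂ _∧_ (colsOK-lower r s k l d) (columns-appendTo zero k (s ∷ T) v ls e)
columns-appendTo (suc (suc y)) k (r ∷ s ∷ T) (h ∷ v) (l ∷ ls) c = let d , e = ∧-true c in cong₂ _∧_ d (columns-appendTo (suc y) k (s ∷ T) v ls e)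

-- w is a lattice word: every suffix is the row word of a tableau of partition shape.
data Lattice (p : ℕ) : List ℕ → Set where
  []   : Lattice p []
  cons : ∀ {y w} → Valid (lengthShape (build p w)) → Lattice p w → Lattice p (y ∷ w)

columns-build : ∀ p {w} → Lattice p w → columnsIncreasing (build p w) ≡ true
columns-build p []                  = go p
  where
  go : ∀ p → columnsIncreasing (replicate p []) ≡ true
  go zero          = refl
  go (suc zero)    = refl
  go (suc (suc p)) = go (suc p)
columns-build p (cons {y} {w} v la) = columns-appendTo y (suc (length w)) (build p w) v
  (All.map (All.map (λ (_ , b) → s≤s b)) (entries-build p w)) (columns-build p la)

lengthShape-empty : ∀ p → lengthShape (replicate p []) ≡ stair p
lengthShape-empty zero    = refl
lengthShape-empty (suc p) = cong₂ _∷_ (cong suc (length-replicate p)) (lengthShape-empty p)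

does-valid⁻ : ∀ {a} → does (valid? a) ≡ true → Valid a
does-valid⁻ {a} e with valid? a
... | yes v = v

module FromWord (p : ℕ) where
  open Words p

  -- `okTail` shrinks the shape from the outside while `build` grows it from the empty one; the two
  -- meet because `incr` undoes `rem` on valid shapes.
  okTail-lattice : ∀ b x w a → All (_< p) w → length a ≡ p → okTail b x w a ≡ true →
    Lattice p w × (lengthShape (build p w) ≡ a) × Valid a
  okTail-lattice b x []      a []         l ok with eqStair-sound p a ok
  ... | refl = [] , lengthShape-empty p , valid-stair p
  okTail-lattice b x (y ∷ w) a (y<p ∷ ls) l ok with ∧-true ok
  ... | va , ok′ with okTail-lattice (not b) y w (rem y a) ls (trans (length-rem y a) l) (proj₂ (∧-true {if b then y <ᵇ x else not (y <ᵇ x)} ok′))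
  ... | la , e , v = cons (subst Valid (sym e) v) la , trans (lengthShape-appendTo y _ (build p w)) (trans (cong (incr y) e) (incr-rem y v′ (subst (y <_) (sym l) y<p))) , v′
    where
    v′ : Valid a
    v′ = does-valid⁻ va

  okWord-lattice : ∀ w a → All (_< p) w → length a ≡ p → okWord a w ≡ true → Lattice p w × (lengthShape (build p w) ≡ a)
  okWord-lattice (y ∷ w) a (y<p ∷ ls) l ok with ∧-true ok
  ... | va , ok′ with okTail-lattice true y w (rem y a) ls (trans (length-rem y a) l) ok′
  ... | la , e , v = cons (subst Valid (sym e) v) la , trans (lengthShape-appendTo y _ (build p w)) (trans (cong (incr y) e) (incr-rem y (does-valid⁻ va) (subst (y <_) (sym l) y<p)))

  lengths-square : ∀ T → lengthShape T ≡ map (_+_ p) (stair (length T)) → All (λ r → length r ≡ p) T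
  lengths-square []      e = []
  lengths-square (r ∷ T) e = ℕₚ.+-cancelʳ-≡ (suc (length T)) (length r) p (cong hd e) ∷ lengths-square T (∷-injectiveʳ e)

  length-squareShape : length (squareShape p) ≡ p
  length-squareShape = trans (length-map (_+_ p) (stair p)) (length-stair p)

  build-IsTab : ∀ w → All (_< p) w → okWord (squareShape p) w ≡ true → IsTab p (length w) (build p w)
  build-IsTab w ls ok = let la , e = okWord-lattice w (squareShape p) ls length-squareShape ok in record
    { height  = length-build p w
    ; lengths = lengths-square (build p w) (trans e (cong (λ q → map (_+_ p) (stair q)) (sym (length-build p w))))
    ; entries = entries-build p w
    ; once    = once-build p w ls
    ; rows    = rows-build p w
    ; columns = columns-build p la
    }

  okTail-descents : ∀ T k a → okTail (isEven k) (rowOf T (suc k)) (word k T) a ≡ true → ∀ i → 0 < i → i ≤ k → descent T i ≡ isEven i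
  okTail-descents T zero    a ok (suc i) 0<i ()
  okTail-descents T (suc k) a ok i 0<i i≤k with ∧-true {follows (isEven (suc k)) (rowOf T (suc (suc k))) (rowOf T (suc k))} (proj₂ (∧-true {does (valid? a)} ok)) | ℕₚ.m≤n⇒m<n∨m≡n i≤k
  ... | f , ok′ | inj₂ refl      = reflect (isEven (suc k)) (descent T (suc k)) f
    where
    reflect : ∀ b c → (if b then c else not c) ≡ true → c ≡ b
    reflect true  true  e = refl
    reflect false false e = refl
  ... | f , ok′ | inj₁ (s≤s i≤k′) = okTail-descents T k (rem (rowOf T (suc k)) a)
    (subst (λ b → okTail b (rowOf T (suc k)) (word k T) (rem (rowOf T (suc k)) a) ≡ true) (trans (cong not (isEven-suc k)) (not-not (isEven k))) ok′) i 0<i i≤k′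

  build-alternates : ∀ n w → isEven n ≡ true → length w ≡ suc n → All (_< p) w → okWord (squareShape p) w ≡ true → Alternates isEven (suc n) (build p w)
  build-alternates n w ev l ls ok i i∈ = let 0<i , i≤n = ∈-range1⁻ i∈ in
    okTail-descents (build p w) n (rem (rowOf (build p w) (suc n)) (squareShape p))
      (trans (cong (λ b → okTail b (rowOf (build p w) (suc n)) (word n (build p w)) (rem (rowOf (build p w) (suc n)) (squareShape p))) ev)
        (proj₂ (∧-true {does (valid? (squareShape p))} (subst (λ w → okWord (squareShape p) w ≡ true) (sym w≡) ok)))) i 0<i i≤n
    where
    w≡ : word (suc n) (build p w) ≡ w
    w≡ = trans (cong (λ k → word k (build p w)) (sym l)) (word-build p w ls)

ralt≡count : ∀ p n → size (square p) ≡ suc n → isEven n ≡ true →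
  ralt (square p) ≡ countB (Words.okWord p (squareShape p)) (Words.letters p (suc n))
ralt≡count p n e ev = ℕₚ.≤-antisym
  (length-injection (word (suc n)) (Unq.filter⁺ (λ T → T? (reverseAlternating (size (square p)) T)) (unique-SYT p)) into₁ inj₁′)
  (length-injection (build p) (Unq.filter⁺ (λ w → T? (okWord (squareShape p) w)) (unique-wordsOf (suc n) (Unq.upTo⁺ p))) into₂ inj₂′)
  where
  open Words p
  open FromWord p
  N = size (square p)
  tableau : ∀ {T} → T ∈ filterB (reverseAlternating N) (SYT (square p)) → IsTab p (suc n) T × Alternates isEven (suc n) T
  tableau {T} i = let j , a = ∈-filterB⁻ (reverseAlternating N) {xs = SYT (square p)} i in
    subst (λ k → IsTab p k T) e (∈-SYT⁻ p j) , subst (λ k → Alternates isEven k T) e (alternates⁻ isEven N T a)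
  into₁ : ∀ {T} → T ∈ filterB (reverseAlternating N) (SYT (square p)) → word (suc n) T ∈ filterB (okWord (squareShape p)) (letters (suc n))
  into₁ {T} i = let t , a = tableau i in ∈-filterB⁺ (okWord (squareShape p)) {xs = letters (suc n)}
    (subst (λ k → word (suc n) T ∈ wordsOf k (upTo p)) (length-word (suc n) T) (∈-wordsOf⁺ (word (suc n) T) (ToWord.word-letters p n T t (suc n) ℕₚ.≤-refl)))
    (ToWord.okWord-word p n T t ev a)
  inj₁′ : ∀ {T T′} → T ∈ filterB (reverseAlternating N) (SYT (square p)) → T′ ∈ filterB (reverseAlternating N) (SYT (square p)) → word (suc n) T ≡ word (suc n) T′ → T ≡ T′
  inj₁′ i i′ eq = trans (sym (build-word p (suc n) _ (proj₁ (tableau i)))) (trans (cong (build p) eq) (build-word p (suc n) _ (proj₁ (tableau i′))))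
  lattice : ∀ {w} → w ∈ filterB (okWord (squareShape p)) (letters (suc n)) → (length w ≡ suc n) × All (_< p) w × (okWord (squareShape p) w ≡ true)
  lattice i = let j , ok = ∈-filterB⁻ (okWord (squareShape p)) {xs = letters (suc n)} i; l , a = ∈-wordsOf⁻ (suc n) j in l , All.map ∈-upTo⁻ a , ok
  into₂ : ∀ {w} → w ∈ filterB (okWord (squareShape p)) (letters (suc n)) → build p w ∈ filterB (reverseAlternating N) (SYT (square p))
  into₂ {w} i = let l , a , ok = lattice i in ∈-filterB⁺ (reverseAlternating N) {xs = SYT (square p)}
    (∈-SYT⁺ p (subst (λ k → IsTab p k (build p w)) (trans l (sym e)) (build-IsTab w a ok)))
    (alternates⁺ isEven N (build p w) (subst (λ k → Alternates isEven k (build p w)) (sym e) (build-alternates n w ev l a ok)))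
  inj₂′ : ∀ {w w′} → w ∈ filterB (okWord (squareShape p)) (letters (suc n)) → w′ ∈ filterB (okWord (squareShape p)) (letters (suc n)) → build p w ≡ build p w′ → w ≡ w′
  inj₂′ {w} {w′} i i′ eq = let l , a , _ = lattice i; l′ , a′ , _ = lattice i′ in
    trans (sym (word-build p w a)) (trans (cong₂ word (trans l (sym l′)) eq) (word-build p w′ a′))

-- Transposition

transposeTab : ℕ → Tableau → Tableau
transposeTab p T = applyUpTo (λ j → map (nth j) T) p

cell : Tableau → ℕ → ℕ → ℕ
cell T i j = nth j (nthRow i T)

nth-map : ∀ j i T → i < length T → nth i (map (nth j) T) ≡ cell T i j
nth-map j zero    (r ∷ T) _       = refl
nth-map j (suc i) (r ∷ T) (s≤s l) = nth-map j i T l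

nthRow-applyUpTo : ∀ (f : ℕ → List ℕ) j p → j < p → nthRow j (applyUpTo f p) ≡ f j
nthRow-applyUpTo f zero    (suc p) _       = refl
nthRow-applyUpTo f (suc j) (suc p) (s≤s l) = nthRow-applyUpTo (f ∘ suc) j p l

cell-transpose : ∀ p T i j → i < length T → j < p → cell (transposeTab p T) j i ≡ cell T i j
cell-transpose p T i j i< j< = trans (cong (nth i) (nthRow-applyUpTo (λ j → map (nth j) T) j p j<)) (nth-map j i T i<)

applyUpTo-nth : ∀ r → applyUpTo (λ j → nth j r) (length r) ≡ r
applyUpTo-nth []      = refl
applyUpTo-nth (x ∷ r) = cong (x ∷_) (applyUpTo-nth r)

All-applyUpTo : ∀ {A : Set} {P : A → Set} (f : ℕ → A) n → (∀ i → i < n → P (f i)) → All P (applyUpTo f n)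
All-applyUpTo f zero    h = []
All-applyUpTo f (suc n) h = h 0 (s≤s z≤n) ∷ All-applyUpTo (f ∘ suc) n (λ i i<n → h (suc i) (s≤s i<n))

nth-All : ∀ {P : ℕ → Set} {r} j → j < length r → All P r → P (nth j r)
nth-All zero    _       (e ∷ es) = e
nth-All (suc j) (s≤s l) (e ∷ es) = nth-All j l es

nth-sorted : ∀ {r} → Sorted r → ∀ {j j′} → j < j′ → j′ < length r → nth j r < nth j′ r
nth-sorted (xs ∷ s) {zero}  {suc j′} _       (s≤s l) = nth-All j′ l xs
nth-sorted (xs ∷ s) {suc j} {suc j′} (s≤s k) (s≤s l) = nth-sorted s k l

colsOK-nth : ∀ r s j → j < length r → j < length s → colsOK r s ≡ true → (nth j r <ᵇ nth j s) ≡ true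
colsOK-nth (x ∷ r) (y ∷ s) zero    _       _        c = proj₁ (∧-true c)
colsOK-nth (x ∷ r) (y ∷ s) (suc j) (s≤s l) (s≤s l′) c = colsOK-nth r s j l l′ (proj₂ (∧-true c))

increasing-column : ∀ p j T → j < p → All (λ r → length r ≡ p) T → columnsIncreasing T ≡ true → strictlyIncreasing (map (nth j) T) ≡ true
increasing-column p j []          j<p ls            c = refl
increasing-column p j (r ∷ [])    j<p ls            c = refl
increasing-column p j (r ∷ s ∷ T) j<p (l ∷ l′ ∷ ls) c = let a , b = ∧-true c in
  cong₂ _∧_ (colsOK-nth r s j (subst (j <_) (sym l) j<p) (subst (j <_) (sym l′) j<p) a) (increasing-column p j (s ∷ T) j<p (l′ ∷ ls) b)

colsOK-columns : ∀ p j T → suc j < p → All (λ r → length r ≡ p) T → All (λ r → strictlyIncreasing r ≡ true) T → colsOK (map (nth j) T) (map (nth (suc j)) T) ≡ true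
colsOK-columns p j []      j<p []       []       = refl
colsOK-columns p j (r ∷ T) j<p (l ∷ ls) (i ∷ is) =
  cong₂ _∧_ (<⇒<ᵇ-true (nth-sorted (sorted⁻ r i) (ℕₚ.n<1+n j) (subst (suc j <_) (sym l) j<p))) (colsOK-columns p j T j<p ls is)

columns-applyUpTo : ∀ (f : ℕ → List ℕ) p → (∀ j → suc j < p → colsOK (f j) (f (suc j)) ≡ true) → columnsIncreasing (applyUpTo f p) ≡ true
columns-applyUpTo f zero          h = refl
columns-applyUpTo f (suc zero)    h = refl
columns-applyUpTo f (suc (suc p)) h = cong₂ _∧_ (h 0 (s≤s (s≤s z≤n))) (columns-applyUpTo (f ∘ suc) (suc p) (λ j l → h (suc j) (s≤s l)))

countB-transpose : ∀ f p T → All (λ r → length r ≡ p) T → countB f (concat (transposeTab p T)) ≡ countB f (concat T)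
countB-transpose f p []      []       = empty p
  where
  empty : ∀ p → countB f (concat (applyUpTo (λ _ → []) p)) ≡ 0
  empty zero    = refl
  empty (suc p) = empty p
countB-transpose f p (r ∷ T) (l ∷ ls) = begin
  countB f (concat (applyUpTo (λ j → nth j r ∷ map (nth j) T) p))
    ≡⟨ interleave (λ j → nth j r) (λ j → map (nth j) T) p ⟩
  countB f (applyUpTo (λ j → nth j r) p) + countB f (concat (transposeTab p T))
    ≡⟨ cong₂ (λ r n → countB f r + n) (trans (cong (applyUpTo (λ j → nth j r)) (sym l)) (applyUpTo-nth r)) (countB-transpose f p T ls) ⟩
  countB f r + countB f (concat T)
    ≡⟨ countB-++ f r (concat T) ⟨
  countB f (concat (r ∷ T)) ∎
  where
  lemma : ∀ a b c d → a + (b + (c + d)) ≡ (a + c) + (b + d)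
  lemma = solve-∀ℕ
  interleave : ∀ (g : ℕ → ℕ) (G : ℕ → List ℕ) p →
    countB f (concat (applyUpTo (λ j → g j ∷ G j) p)) ≡ countB f (applyUpTo g p) + countB f (concat (applyUpTo G p))
  interleave g G zero    = refl
  interleave g G (suc p) = begin
    countB f (g 0 ∷ G 0 ++ concat (applyUpTo (λ j → g (suc j) ∷ G (suc j)) p))
      ≡⟨ trans (countB-∷ f (g 0) _) (cong (_+_ (b→ℕ (f (g 0)))) (trans (countB-++ f (G 0) _) (cong (_+_ (countB f (G 0))) (interleave (g ∘ suc) (G ∘ suc) p)))) ⟩
    b→ℕ (f (g 0)) + (countB f (G 0) + (countB f (applyUpTo (g ∘ suc) p) + countB f (concat (applyUpTo (G ∘ suc) p))))
      ≡⟨ lemma (b→ℕ (f (g 0))) (countB f (G 0)) (countB f (applyUpTo (g ∘ suc) p)) (countB f (concat (applyUpTo (G ∘ suc) p))) ⟩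
    (b→ℕ (f (g 0)) + countB f (applyUpTo (g ∘ suc) p)) + (countB f (G 0) + countB f (concat (applyUpTo (G ∘ suc) p)))
      ≡⟨ cong₂ _+_ (countB-∷ f (g 0) (applyUpTo (g ∘ suc) p)) (countB-++ f (G 0) (concat (applyUpTo (G ∘ suc) p))) ⟨
    countB f (applyUpTo g (suc p)) + countB f (concat (applyUpTo G (suc p))) ∎

transpose-IsTab : ∀ {p n T} → IsTab p n T → IsTab p n (transposeTab p T)
transpose-IsTab {p} {n} {T} t = record
  { height  = length-applyUpTo _ p
  ; lengths = All-applyUpTo _ p (λ j _ → trans (length-map (nth j) T) height)
  ; entries = All-applyUpTo _ p (λ j j<p → column j j<p lengths entries)
  ; once    = λ k k∈ → trans (countB-transpose (_≡ᵇ k) p T lengths) (once k k∈)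
  ; rows    = All-applyUpTo _ p (λ j j<p → increasing-column p j T j<p lengths columns)
  ; columns = columns-applyUpTo _ p (λ j l → colsOK-columns p j T l lengths rows)
  }
  where
  open IsTab t
  column : ∀ {P : ℕ → Set} j → j < p → ∀ {T} → All (λ r → length r ≡ p) T → All (All P) T → All P (map (nth j) T)
  column j j<p []       []       = []
  column j j<p (l ∷ ls) (e ∷ es) = nth-All j (subst (j <_) (sym l) j<p) e ∷ column j j<p ls es

tableau-ext : ∀ p {T T′} → length T ≡ length T′ → All (λ r → length r ≡ p) T → All (λ r → length r ≡ p) T′ →
  (∀ i j → i < length T → j < p → cell T i j ≡ cell T′ i j) → T ≡ T′
tableau-ext p {[]}    {[]}      h []       []         e = refl
tableau-ext p {r ∷ T} {r′ ∷ T′} h (l ∷ ls) (l′ ∷ ls′) e = cong₂ _∷_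
  (trans (sym (applyUpTo-nth r)) (trans (cong (applyUpTo (λ j → nth j r)) l)
    (trans (applyUpTo-cong p (λ j j<p → e 0 j (s≤s z≤n) j<p)) (trans (cong (applyUpTo (λ j → nth j r′)) (sym l′)) (applyUpTo-nth r′)))))
  (tableau-ext p (ℕₚ.suc-injective h) ls ls′ (λ i j i< j<p → e (suc i) j (s≤s i<) j<p))

transpose-involutive : ∀ {p n T} → IsTab p n T → transposeTab p (transposeTab p T) ≡ T
transpose-involutive {p} {n} {T} t = tableau-ext p (trans (IsTab.height t″) (sym height)) (IsTab.lengths t″) lengths
  (λ i j i< j<p → let i<p = subst (i <_) (IsTab.height t″) i< in
    trans (cell-transpose p (transposeTab p T) j i (subst (j <_) (sym (IsTab.height t′)) j<p) i<p) (cell-transpose p T i j (subst (i <_) (sym height) i<p) j<p))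
  where
  open IsTab t
  t′ = transpose-IsTab t
  t″ = transpose-IsTab t′

occurs : ∀ m j r → j < length r → nth j r ≡ m → 0 < occurrences m r
occurs m zero    (x ∷ r) _       refl = subst (0 <_) (sym (trans (countB-∷ (_≡ᵇ x) x r) (cong (λ b → b→ℕ b + countB (_≡ᵇ x) r) (≡ᵇ-refl x)))) (s≤s z≤n)
occurs m (suc j) (x ∷ r) (s≤s l) e    = subst (0 <_) (sym (countB-∷ (_≡ᵇ m) x r)) (ℕₚ.<-≤-trans (occurs m j r l e) (ℕₚ.m≤n+m _ (b→ℕ (x ≡ᵇ m))))

occurs-cell : ∀ m i j T → i < length T → j < length (nthRow i T) → cell T i j ≡ m → 0 < occurrences m (concat T)
occurs-cell m zero    j (r ∷ T) _       l′ e = subst (0 <_) (sym (occurrences-concat m r T)) (ℕₚ.<-≤-trans (occurs m j r l′ e) (ℕₚ.m≤m+n _ _))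
occurs-cell m (suc i) j (r ∷ T) (s≤s l) l′ e = subst (0 <_) (sym (occurrences-concat m r T)) (ℕₚ.<-≤-trans (occurs-cell m i j T l l′ e) (ℕₚ.m≤n+m _ (occurrences m r)))

rowOf-cell : ∀ m i j T → occurrences m (concat T) ≡ 1 → i < length T → j < length (nthRow i T) → cell T i j ≡ m → rowOf T m ≡ i
rowOf-cell m zero    j (r ∷ T) o _       l′ e with occurrences m r | occurs m j r l′ e
... | suc _ | _ = refl
rowOf-cell m (suc i) j (r ∷ T) o (s≤s l) l′ e with occurrences m r | trans (sym (occurrences-concat m r T)) o
... | zero  | o′ = cong suc (rowOf-cell m i j T o′ l l′ e)
... | suc a | o′ = ⊥-elim (ℕₚ.<⇒≢ (occurs-cell m i j T l l′ e) (sym (ℕₚ.m+n≡0⇒n≡0 a (ℕₚ.suc-injective o′))))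

find-column : ∀ m r → 0 < occurrences m r → ∃ λ j → (j < length r) × (nth j r ≡ m)
find-column m (x ∷ r) o with x ℕₚ.≟ m
... | yes refl = 0 , s≤s z≤n , refl
... | no x≢m   = let j , l , e = find-column m r (subst (0 <_) (trans (countB-∷ (_≡ᵇ m) x r) (cong (λ b → b→ℕ b + countB (_≡ᵇ m) r) (≢⇒≡ᵇ-false x m x≢m))) o) in suc j , s≤s l , e

find-cell : ∀ m T → 0 < occurrences m (concat T) → ∃ λ i → ∃ λ j → (i < length T) × (j < length (nthRow i T)) × (cell T i j ≡ m)
find-cell m (r ∷ T) o with occurrences m r in eq
... | suc _ = let j , l , e = find-column m r (subst (0 <_) (sym eq) (s≤s z≤n)) in 0 , j , s≤s z≤n , l , e
... | zero  = let i , j , l , l′ , e = find-cell m T (subst (0 <_) (trans (occurrences-concat m r T) (cong (_+ occurrences m (concat T)) eq)) o) in suc i , j , s≤s l , l′ , e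

nthRow-length : ∀ {p} i T → i < length T → All (λ r → length r ≡ p) T → length (nthRow i T) ≡ p
nthRow-length zero    (r ∷ T) _       (l ∷ ls) = l
nthRow-length (suc i) (r ∷ T) (s≤s k) (l ∷ ls) = nthRow-length i T k ls

nthRow-increasing : ∀ i T → i < length T → All (λ r → strictlyIncreasing r ≡ true) T → strictlyIncreasing (nthRow i T) ≡ true
nthRow-increasing zero    (r ∷ T) _       (l ∷ ls) = l
nthRow-increasing (suc i) (r ∷ T) (s≤s k) (l ∷ ls) = nthRow-increasing i T k ls

module Cells {p n T} (t : IsTab p n T) where
  open IsTab t

  row< : ∀ {i j j′} → i < p → j < j′ → j′ < p → cell T i j < cell T i j′
  row< {i} i<p j<j′ j′<p = nth-sorted (sorted⁻ (nthRow i T) (nthRow-increasing i T i<T rows)) j<j′ (subst (_ <_) (sym (nthRow-length i T i<T lengths)) j′<p)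
    where
    i<T : i < length T
    i<T = subst (i <_) (sym height) i<p

  column< : ∀ {i i′ j} → i < i′ → i′ < p → j < p → cell T i j < cell T i′ j
  column< {i} {i′} {j} i<i′ i′<p j<p = subst₂ _<_ (nth-map j i T (ℕₚ.<-trans i<i′ i′<T)) (nth-map j i′ T i′<T)
    (nth-sorted (sorted⁻ (map (nth j) T) (increasing-column p j T j<p lengths columns)) i<i′ (subst (i′ <_) (sym (length-map (nth j) T)) i′<T))
    where
    i′<T : i′ < length T
    i′<T = subst (i′ <_) (sym height) i′<p

  column≤ : ∀ {i i′ j} → i ≤ i′ → i′ < p → j < p → cell T i j ≤ cell T i′ j
  column≤ i≤i′ i′<p j<p with ℕₚ.m≤n⇒m<n∨m≡n i≤i′
  ... | inj₁ i<i′ = ℕₚ.<⇒≤ (column< i<i′ i′<p j<p)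
  ... | inj₂ refl = ℕₚ.≤-refl

  row≤ : ∀ {i j j′} → i < p → j ≤ j′ → j′ < p → cell T i j ≤ cell T i j′
  row≤ i<p j≤j′ j′<p with ℕₚ.m≤n⇒m<n∨m≡n j≤j′
  ... | inj₁ j<j′ = ℕₚ.<⇒≤ (row< i<p j<j′ j′<p)
  ... | inj₂ refl = ℕₚ.≤-refl

  locate : ∀ k → k ∈ range1 n → ∃ λ i → ∃ λ j → (i < p) × (j < p) × (cell T i j ≡ k) × (rowOf T k ≡ i) × (rowOf (transposeTab p T) k ≡ j)
  locate k k∈ with find-cell k T (subst (0 <_) (sym (once k k∈)) (s≤s z≤n))
  ... | i , j , i<T , j<r , e = i , j , i<p , j<p , e , rowOf-cell k i j T (once k k∈) i<T j<r e ,
    rowOf-cell k j i (transposeTab p T) (IsTab.once t′ k k∈) j<T′ (subst (i <_) (sym (nthRow-length j _ j<T′ (IsTab.lengths t′))) i<p) (trans (cell-transpose p T i j i<T j<p) e)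
    where
    t′ = transpose-IsTab t
    i<p : i < p
    i<p = subst (i <_) height i<T
    j<p : j < p
    j<p = subst (j <_) (nthRow-length i T i<T lengths) j<r
    j<T′ : j < length (transposeTab p T)
    j<T′ = subst (j <_) (sym (IsTab.height t′)) j<p

  -- If k + 1 lay strictly below and strictly to the right of k, the cell in the row of k and the
  -- column of k + 1 would hold an entry strictly between them. If it lay weakly above and weakly to
  -- the left, it could not be larger than k. So exactly one direction is strict.
  descent-transpose : ∀ k → k ∈ range1 (n ∸ 1) → descent (transposeTab p T) k ≡ not (descent T k)
  descent-transpose k k∈ with locate k (∈-range1 (proj₁ b) (ℕₚ.≤-trans (proj₂ b) (ℕₚ.m∸n≤m n 1))) | locate (suc k) (∈-range1 (s≤s z≤n) (k<n (proj₁ b) (proj₂ b)))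
    where
    b = ∈-range1⁻ k∈
    k<n : ∀ {k n} → 0 < k → k ≤ n ∸ 1 → k < n
    k<n {suc k} {zero}  _ ()
    k<n {suc k} {suc n} _ l = s≤s l
  ... | i , j , i<p , j<p , e , r , c | i′ , j′ , i′<p , j′<p , e′ , r′ , c′ =
    trans (cong₂ _<ᵇ_ c c′) (trans main (cong not (sym (cong₂ _<ᵇ_ r r′))))
    where
    main : (j <ᵇ j′) ≡ not (i <ᵇ i′)
    main with j ℕₚ.<? j′ | i ℕₚ.<? i′
    ... | yes j<j′ | yes i<i′ = ⊥-elim (ℕₚ.1+n≰n (subst₂ (λ a b → suc a < b) e e′ (ℕₚ.≤-trans (s≤s (row< i<p j<j′ j′<p)) (column< i<i′ i′<p j′<p))))
    ... | yes j<j′ | no i≮i′  = trans (<⇒<ᵇ-true j<j′) (cong not (sym (≤⇒<ᵇ-false (ℕₚ.≮⇒≥ i≮i′))))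
    ... | no j≮j′  | yes i<i′ = trans (≤⇒<ᵇ-false (ℕₚ.≮⇒≥ j≮j′)) (cong not (sym (<⇒<ᵇ-true i<i′)))
    ... | no j≮j′  | no i≮i′  = ⊥-elim (ℕₚ.1+n≰n (subst₂ _≤_ e′ e (ℕₚ.≤-trans (column≤ (ℕₚ.≮⇒≥ i≮i′) i<p j′<p) (row≤ i<p (ℕₚ.≮⇒≥ j≮j′) j<p))))

isOdd-not : ∀ k → isOdd k ≡ not (isEven k)
isOdd-not zero          = refl
isOdd-not (suc zero)    = refl
isOdd-not (suc (suc k)) = isOdd-not k

-- Only an inequality is needed per direction: applied to odd and even descents in both orders, it
-- yields equality.
transpose-≤ : ∀ p (g h : ℕ → Bool) → (∀ i → not (g i) ≡ h i) →
  let n = size (square p) in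
  countB (λ T → eqList (descentSet n T) (filterB g (range1 (n ∸ 1)))) (SYT (square p))
    ≤ countB (λ T → eqList (descentSet n T) (filterB h (range1 (n ∸ 1)))) (SYT (square p))
transpose-≤ p g h gh = length-injection (transposeTab p) (Unq.filter⁺ (λ T → T? (G T)) (unique-SYT p)) into inj
  where
  n = size (square p)
  G H : Tableau → Bool
  G T = eqList (descentSet n T) (filterB g (range1 (n ∸ 1)))
  H T = eqList (descentSet n T) (filterB h (range1 (n ∸ 1)))
  tableau : ∀ {T} → T ∈ filterB G (SYT (square p)) → IsTab p n T × Alternates g n T
  tableau {T} i = let j , a = ∈-filterB⁻ G {xs = SYT (square p)} i in ∈-SYT⁻ p j , alternates⁻ g n T a
  into : ∀ {T} → T ∈ filterB G (SYT (square p)) → transposeTab p T ∈ filterB H (SYT (square p))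
  into {T} i = let t , a = tableau i in ∈-filterB⁺ H {xs = SYT (square p)} (∈-SYT⁺ p (transpose-IsTab t))
    (alternates⁺ h n (transposeTab p T) (λ k k∈ → trans (Cells.descent-transpose t k k∈) (trans (cong not (a k k∈)) (gh k))))
  inj : ∀ {T T′} → T ∈ filterB G (SYT (square p)) → T′ ∈ filterB G (SYT (square p)) → transposeTab p T ≡ transposeTab p T′ → T ≡ T′
  inj i i′ e = trans (sym (transpose-involutive (proj₁ (tableau i)))) (trans (cong (transposeTab p) e) (transpose-involutive (proj₁ (tableau i′))))

alt≡ralt : ∀ p → alt (square p) ≡ ralt (square p)
alt≡ralt p = ℕₚ.≤-antisym (transpose-≤ p isOdd isEven (λ i → trans (cong not (isOdd-not i)) (not-not (isEven i))))
  (transpose-≤ p isEven isOdd (λ i → sym (isOdd-not i)))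

-- Assembly for odd p

odd-dbl : ∀ p → p % 2 ≡ 1 → ∃ λ j → p ≡ suc (dbl j)
odd-dbl (suc zero)    e = 0 , refl
odd-dbl (suc (suc p)) e = let j , e′ = odd-dbl p e in suc j , cong (suc ∘ suc) e′

dbl≡+ : ∀ n → dbl n ≡ n + n
dbl≡+ zero    = refl
dbl≡+ (suc n) = cong suc (trans (cong suc (dbl≡+ n)) (sym (ℕₚ.+-suc n n)))

+-double-injective : ∀ {m n} → m + m ≡ n + n → m ≡ n
+-double-injective {m} {n} e with ℕₚ.<-cmp m n
... | tri≈ _ m≡n _ = m≡n
... | tri< m<n _ _ = ⊥-elim (ℕₚ.<⇒≢ (ℕₚ.+-mono-< m<n m<n) e)
... | tri> _ _ n<m = ⊥-elim (ℕₚ.<⇒≢ (ℕₚ.+-mono-< n<m n<m) (sym e))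

size-square : ∀ p → size (square p) ≡ p * p
size-square p = go p
  where
  go : ∀ q → sum (replicate q p) ≡ q * p
  go zero    = refl
  go (suc q) = cong (_+_ p) (go q)

-- Here (p² - 1)/2 = 2 j (j + 1) is even. The form as a double doubling gives both the odd word
-- length and the sign of the single word count that survives in `twice-A`.
odd-square : ∀ j → suc (dbl j) * suc (dbl j) ≡ suc (dbl (dbl (j * suc j)))
odd-square j = trans (cong (λ t → suc t * suc t) (dbl≡+ j)) (trans (lemma j)
  (cong suc (sym (trans (dbl≡+ (dbl (j * suc j))) (cong₂ _+_ (dbl≡+ (j * suc j)) (dbl≡+ (j * suc j)))))))
  where
  lemma : ∀ j → suc (j + j) * suc (j + j) ≡ suc ((j * suc j + j * suc j) + (j * suc j + j * suc j))
  lemma = solve-∀ℕ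

sum-squareShape : ∀ p → sum (squareShape p) ≡ p * p + sum (stair p)
sum-squareShape p = trans (go (stair p)) (cong (λ l → l * p + sum (stair p)) (length-stair p))
  where
  lemma : ∀ p a l s → (p + a) + (l * p + s) ≡ (p + l * p) + (a + s)
  lemma = solve-∀ℕ
  go : ∀ as → sum (map (_+_ p) as) ≡ length as * p + sum as
  go []       = refl
  go (a ∷ as) = trans (cong (_+_ (p + a)) (go as)) (lemma p a (length as) (sum as))

valid-squareShape : ∀ p → Valid (squareShape p)
valid-squareShape p = go p
  where
  go : ∀ q → Valid (map (_+_ p) (stair q))
  go zero          = []
  go (suc zero)    = subst (0 <_) (ℕₚ.+-comm 1 p) (s≤s z≤n) ∷ []
  go (suc (suc q)) = ℕₚ.+-monoʳ-< p (ℕₚ.n<1+n (suc q)) ∷ go (suc q)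

module _ (p : ℕ) where
  open Alternating p

  signedWords-single : ∀ i a → (∀ j → j ≢ i → words j a ≡ 0ℚ) → ∀ J → i < J → signedWords J a ≡ (-ℚ signℚ i) *ℚ words i a
  signedWords-single i a z (suc J) i<J with ℕₚ.m≤n⇒m<n∨m≡n (ℕₚ.≤-pred i<J)
  ... | inj₁ i<J′ = trans (cong₂ (λ x y → x +ℚ (-ℚ signℚ J) *ℚ y) (signedWords-single i a z J i<J′) (z J (ℕₚ.>⇒≢ i<J′))) (lemma _ (-ℚ signℚ J))
    where
    lemma : ∀ x s → x +ℚ s *ℚ 0ℚ ≡ x
    lemma = solve-∀ ringℚ
  ... | inj₂ refl = trans (cong (_+ℚ (-ℚ signℚ i) *ℚ words i a) (none i ℕₚ.≤-refl)) (ℚₚ.+-identityˡ _)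
    where
    none : ∀ J → J ≤ i → signedWords J a ≡ 0ℚ
    none zero    _   = refl
    none (suc J) J<i = trans (cong₂ (λ x y → x +ℚ (-ℚ signℚ J) *ℚ y) (none J (ℕₚ.<⇒≤ J<i)) (z J (ℕₚ.<⇒≢ J<i))) (lemma (-ℚ signℚ J))
      where
      lemma : ∀ s → 0ℚ +ℚ s *ℚ 0ℚ ≡ 0ℚ
      lemma = solve-∀ ringℚ

module Odd (j : ℕ) where
  p i n : ℕ
  p = suc (dbl j)
  i = dbl (j * suc j)
  n = dbl i

  sq : Shape
  sq = squareShape p

  open Alternating p

  ralt≡words : ℕtoℚ (ralt (square p)) ≡ words i sq
  ralt≡words = trans (cong ℕtoℚ (ralt≡count p n (trans (size-square p) (odd-square j)) (isEven-dbl i))) (Words.count≡words p i sq)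

  sum-sq : sum sq ≡ suc (i + i + sum (stair p))
  sum-sq = trans (sum-squareShape p) (cong (_+ sum (stair p)) (trans (odd-square j) (cong suc (dbl≡+ i))))

  words-other : ∀ k → k ≢ i → words k sq ≡ 0ℚ
  words-other k k≢i = words-size k sq (FromWord.length-squareShape p)
    (λ e → k≢i (sym (+-double-injective (ℕₚ.+-cancelʳ-≡ (sum (stair p)) _ _ (ℕₚ.suc-injective (trans (sym sum-sq) e))))))

  -- `J` has to exceed the sum of the encoded square for `abel-F`, which then prescribes `N`. The
  -- summand `L + L` makes `N` large enough for `abel-umbral` as well, so that both evaluations
  -- concern the same Abel sum.
  L J N : ℕ
  L = length (numerator p)
  J = suc (sum sq + (L + L))
  N = p * (J + p) + 1

  J≤N : J ≤ N
  J≤N = ℕₚ.≤-trans (ℕₚ.m≤m+n J p) (ℕₚ.≤-trans (ℕₚ.m≤m+n (J + p) (dbl j * (J + p))) (ℕₚ.m≤m+n _ 1))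

  A H : ℚ
  A = abel N (λ m → F p m sq)
  H = ℕtoℚ (hookProduct (square p))

  δ-sq : δ p sq ≡ 0ℚ
  δ-sq = δ-zero p sq (λ e → ℕₚ.m+1+n≢m p (cong hd e))

  twice-A : (1ℚ +ℚ 1ℚ) *ℚ A ≡ -ℚ words i sq
  twice-A = begin
    (1ℚ +ℚ 1ℚ) *ℚ A ≡⟨ abel-F p J sq (s≤s (ℕₚ.m≤m+n (sum sq) (L + L))) (FromWord.length-squareShape p) (valid-squareShape p) ⟩
    δ p sq +ℚ signedWords J sq ≡⟨ cong₂ _+ℚ_ δ-sq (signedWords-single p i sq words-other J i<J) ⟩
    0ℚ +ℚ (-ℚ signℚ i) *ℚ words i sq ≡⟨ cong (λ s → 0ℚ +ℚ (-ℚ s) *ℚ words i sq) (sign-dbl (j * suc j)) ⟩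
    0ℚ +ℚ (-ℚ 1ℚ) *ℚ words i sq ≡⟨ lemma (words i sq) ⟩
    -ℚ words i sq ∎
    where
    lemma : ∀ w → 0ℚ +ℚ (-ℚ 1ℚ) *ℚ w ≡ -ℚ w
    lemma = solve-∀ ringℚ
    i<J : i < J
    i<J = s≤s (ℕₚ.≤-trans (ℕₚ.m≤m+n i i) (ℕₚ.≤-trans (ℕₚ.m≤m+n (i + i) _) (ℕₚ.≤-trans (ℕₚ.n≤1+n _) (ℕₚ.≤-trans (ℕₚ.≤-reflexive (sym sum-sq)) (ℕₚ.m≤m+n (sum sq) (L + L))))))

  ralt-formula : ℕtoℚ (ralt (square p)) *ℚ H ≡ umbral (numerator p)
  ralt-formula = begin
    ℕtoℚ (ralt (square p)) *ℚ H ≡⟨ cong (_*ℚ H) ralt≡words ⟩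
    words i sq *ℚ H ≡⟨ lemma₁ (words i sq) H ⟩
    (-ℚ 1ℚ) *ℚ ((-ℚ words i sq) *ℚ H) ≡⟨ cong (λ t → (-ℚ 1ℚ) *ℚ (t *ℚ H)) twice-A ⟨
    (-ℚ 1ℚ) *ℚ (((1ℚ +ℚ 1ℚ) *ℚ A) *ℚ H) ≡⟨ lemma₂ A H ⟩
    (-ℚ 1ℚ) *ℚ ((1ℚ +ℚ 1ℚ) *ℚ (A *ℚ H)) ≡⟨ cong (λ t → (-ℚ 1ℚ) *ℚ ((1ℚ +ℚ 1ℚ) *ℚ t)) (abel-square N j (ℕₚ.≤-trans (s≤s (ℕₚ.m≤n+m (L + L) (sum sq))) J≤N)) ⟩
    (-ℚ 1ℚ) *ℚ ((1ℚ +ℚ 1ℚ) *ℚ (-½ *ℚ umbral (numerator p))) ≡⟨ lemma₃ (umbral (numerator p)) ⟩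
    umbral (numerator p) ∎
    where
    lemma₁ : ∀ w h → w *ℚ h ≡ (-ℚ 1ℚ) *ℚ ((-ℚ w) *ℚ h)
    lemma₁ = solve-∀ ringℚ
    lemma₂ : ∀ a h → (-ℚ 1ℚ) *ℚ (((1ℚ +ℚ 1ℚ) *ℚ a) *ℚ h) ≡ (-ℚ 1ℚ) *ℚ ((1ℚ +ℚ 1ℚ) *ℚ (a *ℚ h))
    lemma₂ = solve-∀ ringℚ
    lemma₃ : ∀ u → (-ℚ 1ℚ) *ℚ ((1ℚ +ℚ 1ℚ) *ℚ (-½ *ℚ u)) ≡ u
    lemma₃ = solve-∀ ringℚ

Formula : ℕ → Set
Formula p = (alt (square p) ≡ ralt (square p))
  × (ℕtoℚ (alt (square p)) *ℚ ℕtoℚ (hookProduct (square p)) ≡ umbral (numerator p))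

formula : ∀ j → Formula (suc (dbl j))
formula j = alt≡ralt p , trans (cong (λ a → ℕtoℚ a *ℚ H) (alt≡ralt p)) ralt-formula
  where open Odd j

theorem4p4 : (p : ℕ) → p % 2 ≡ 1 →
    (alt (square p) ≡ ralt (square p))
    × (ℕtoℚ (alt (square p)) *ℚ ℕtoℚ (hookProduct (square p)) ≡ umbral (numerator p))
theorem4p4 p odd = let j , e = odd-dbl p odd in subst Formula (sym e) (formula j)
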